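{- Let $N$ be a positive integer and let $d\neq1$ be a divisor of $N$. Let $C_d=\varphi(\gcd(d,N/d))\cdot(P_1)-(P_d)$ on $X_0(N)$. Then $$\mathsf{GCD}(C_d)=\mathfrak{g}(N,d)\quad\text{and}\quad\mathfrak{h}(C_d)=\mathfrak{h}(N,d),$$ where $\mathfrak{g}(N,d)$ and $\mathfrak{h}(N,d)$ are as follows. If $d=N$, then $\mathfrak{g}(N,N)=\mathfrak{g}(N)$ and $\mathfrak{h}(N,N)=\mathfrak{h}(N)$. If $d\ne N$, put $z=\gcd(d,N/d)$; then: 1. $\mathfrak{g}(N,d)=\mathfrak{g}(d)$ if $z=1$; 2. $\mathfrak{g}(N,d)=\gcd(p,\mathfrak{g}(d/p))$ if $z=p$ is a prime and $\mathrm{val}_p(d)=1$; 3. $\mathfrak{g}(N,d)=\frac{z}{\mathrm{rad}(z)}$ otherwise. Also, for $d\neq N$, $\mathfrak{h}(N,d)=2$ if one of the following holds, and $\mathfrak{h}(N,d)=1$ otherwise: 1. $N=2^r$ with $r\ge2$ and $d=2$; 2. $N=2^r$ with $r\ge2$ and $d=2^f$ with $f$ even; 3. $N=2^rp$ with $r\ge2$ and $d=2p$, where $p\equiv1\pmod4$ is a prime; 4. $N=2^rd$ with $r\ge1$ and $d=p$, where $p$ is an odd prime; 5. $N=2^rd$ with $r\ge1$ and $d=pq$, where $p,q$ are two distinct odd primes such that $\mathrm{val}_2(p-1)=\mathrm{val}_2(q-1)$ and $\mathrm{val}_2(p+1)=\mathrm{val}_2(q+1)$.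
   Context: **The one-variable functions.** $\mathfrak{g}(1)=0$; $\mathfrak{g}(M)=\gcd(M+(-1)^{t-1},\,p_i^2-1:1\le i\le t)$ if $M=\prod_{i=1}^tp_i>1$ is squarefree; $\mathfrak{g}(M)=\gcd(p,\mathfrak{g}(M'))$ if $M=M'p^2$ with $p$ prime, $\gcd(M',p)=1$ and $M'$ squarefree; $\mathfrak{g}(M)=1$ otherwise. $\mathfrak{h}(M)=2$ if $M$ is prime; or $M=2^r$ with $r$ odd; or $M=pq$ for distinct odd primes with $\mathrm{val}_2(p-1)=\mathrm{val}_2(q-1)$ and $\mathrm{val}_2(p+1)=\mathrm{val}_2(q+1)$; or $M=4p$ with $p$ a prime congruent to $1$ modulo $4$; and $\mathfrak{h}(M)=1$ otherwise. $\mathrm{rad}(z)$ is the product of the primes dividing $z$. **Divisors and invariants.** For $d\mid N$, a cusp of $X_0(N)$ is of level $d$ if it is represented by $x/d$ with $\gcd(x,d)=1$; $(P_d)$ is the sum of all cusps of level $d$, each with multiplicity one. For a prime $p$ and $r\ge1$, with $m(j)=\min(j,r-j)$, let $\Upsilon(p^r)$ be the matrix indexed by divisors of $p^r$ with $\Upsilon(p^r)_{p^ip^j}=p$ if $i=j\in\{0,r\}$; $p^{m(j)-1}(p^2+1)$ if $1\le i=j\le r-1$; $-p^{m(j)}$ if $|i-j|=1$; $0$ if $|i-j|\ge2$. For $N=\prod p_i^{r_i}$, $\delta=\prod p_i^{e_i}$, $d=\prod p_i^{f_i}$, put $\Upsilon(N)_{\delta d}=\prod_i\Upsilon(p_i^{r_i})_{p_i^{e_i}p_i^{f_i}}$.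 For nonzero $C=\sum_{d\mid N} a_d(P_d)$ ($a_d\in\mathbf{Z}$): $V(C)_\delta=\sum_{d\mid N}\Upsilon(N)_{\delta d}\,a_d$; $\mathsf{GCD}(C)$ is the greatest common divisor of the entries $V(C)_\delta$, $\delta\mid N$; $\mathbb{V}(C)=\mathsf{GCD}(C)^{ -1}V(C)$; for a prime $p$, $\mathsf{Pw}_p(C)=\sum_{\delta\mid N,\ \mathrm{val}_p(\delta)\ \text{odd}}\mathbb{V}(C)_\delta$; $\mathfrak{h}(C)=1$ if $\mathsf{Pw}_p(C)$ is even for all primes $p$, and $\mathfrak{h}(C)=2$ otherwise. -}

module Defs where

open import Data.Bool using (if_then_else_)
open import Data.Integer as ℤ using (ℤ; +_; ∣_∣; 0ℤ; 1ℤ; -1ℤ)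
open import Data.List using (List; map; filter; foldr; length; applyUpTo)
open import Data.List.Properties using (filter-none)
open import Data.List.Membership.Propositional using (_∈_)
open import Data.List.Membership.Propositional.Properties using (∈-filter⁻; ∈-applyUpTo⁻)
open import Data.List.Relation.Unary.All as All using (All)
open import Data.Nat using (ℕ; zero; suc; _+_; _*_; _∸_; _^_; _⊓_; _/_; _%_; _≤_; _<_; s≤s; z≤n; ∣_-_∣; NonZero; >-nonZero)
open import Data.Nat.Coprimality using (Coprime; coprime?)
open import Data.Nat.Divisibility using (_∣_; _∣?_; ∣⇒≤; _∣0; ∣-refl)
open import Data.Nat.GCD using (gcd)
open import Data.Nat.ListAction using (product)
open import Data.Nat.Primality using (Prime; prime?; prime⇒nonZero)
open import Data.Nat.Properties
open import Data.Product using (∃; _×_; _,_; proj₁)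
open import Data.Sum using (_⊎_)
open import Relation.Binary.PropositionalEquality using (_≡_; _≢_; refl; sym; trans; cong; subst)
open import Relation.Nullary using (Dec; yes; no; ¬_; does; contradiction; ¬?)
open import Relation.Nullary.Decidable using (map′; _×-dec_; _⊎-dec_; _→-dec_)
open import Relation.Unary using (Decidable)

infixl 7 _÷_ _÷ℤ_

-- Totalised division; used only for exact quotients by nonzero numbers.
_÷_ : ℕ → ℕ → ℕ
m ÷ zero  = 0
m ÷ suc n = m / suc n

_÷ℤ_ : ℤ → ℕ → ℤ
i ÷ℤ zero  = 0ℤ
i ÷ℤ suc n = i ℤ./ℕ suc n

range : ℕ → List ℕ
range n = applyUpTo suc n

divisors : ℕ → List ℕ
divisors n = filter (_∣? n) (range n)

primeDivisors : ℕ → List ℕ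
primeDivisors n = filter (λ p → prime? p ×-dec (p ∣? n)) (range n)

rad : ℕ → ℕ
rad n = product (primeDivisors n)

φ : ℕ → ℕ
φ n = length (filter (λ k → coprime? k n) (range n))

-- The largest k ≤ b with p ^ k ∣ n (0 if there is none).
valUpTo : ℕ → ℕ → ℕ → ℕ
valUpTo p n zero    = 0
valUpTo p n (suc b) = if does (p ^ suc b ∣? n) then suc b else valUpTo p n b

-- For p ≥ 2 and n ≥ 1 every k with p ^ k ∣ n satisfies k < n, so this is the
-- p-adic valuation.
val : ℕ → ℕ → ℕ
val p n = valUpTo p n n

sumℤ productℤ : List ℤ → ℤ
sumℤ     = foldr ℤ._+_ 0ℤ
productℤ = foldr ℤ._*_ 1ℤ

∃? : ∀ {P : ℕ → Set} b → (∀ {n} → P n → n ≤ b) → Decidable P → Dec (∃ P)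
∃? b bound P? =
  map′ (λ (n , _ , Pn) → n , Pn) (λ (n , Pn) → n , s≤s (bound Pn) , Pn) (anyUpTo? P? (suc b))

r≤2^r : ∀ r → r ≤ 2 ^ r
r≤2^r r = <⇒≤ (n<2^n r)
  where
  n<2^n : ∀ n → n < 2 ^ n
  n<2^n zero    = s≤s z≤n
  n<2^n (suc n) = ≤-trans (+-mono-≤ (m^n>0 2 n) (n<2^n n))
                          (≤-reflexive (cong (λ x → 2 ^ n + x) (sym (+-identityʳ (2 ^ n)))))

r≤2^r*m : ∀ r m → .{{NonZero m}} → r ≤ 2 ^ r * m
r≤2^r*m r m = ≤-trans (r≤2^r r) (m≤m*n (2 ^ r) m)

Squarefree : ℕ → Set
Squarefree n = ∀ k → k * k ∣ n → k ≡ 1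

squarefree? : Decidable Squarefree
squarefree? zero = no λ sf → contradiction (sf 0 ∣-refl) λ ()
squarefree? n@(suc _) =
  map′ (λ f k k²∣n → f (s≤s (k≤n k k²∣n)) k²∣n) (λ f {k} _ → f k)
       (allUpTo? (λ k → (k * k ∣? n) →-dec (k ≟ 1)) (suc n))
  where
  k≤n : ∀ k → k * k ∣ n → k ≤ n
  k≤n zero    _ = z≤n
  k≤n (suc k) d = ≤-trans (m≤m*n (suc k) (suc k)) (∣⇒≤ d)

PrimeSquareTimes : ℕ → ℕ → ℕ → Set
PrimeSquareTimes M p M′ = M ≡ M′ * (p * p) × Prime p × gcd M′ p ≡ 1 × Squarefree M′

primeSquareTimes? : ∀ M → Dec (∃ λ p → ∃ λ M′ → PrimeSquareTimes M p M′)
primeSquareTimes? M =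
  ∃? M (λ (_ , h) → p≤M h) λ p → ∃? M M′≤M λ M′ →
    (M ≟ M′ * (p * p)) ×-dec prime? p ×-dec (gcd M′ p ≟ 1) ×-dec squarefree? M′
  where
  M′≤M : ∀ {p M′} → PrimeSquareTimes M p M′ → M′ ≤ M
  M′≤M {p} {M′} (refl , pr , _) = m≤m*n M′ (p * p) {{m*n≢0 p p {{nz}} {{nz}}}}
    where nz = prime⇒nonZero pr
  p≤M : ∀ {p M′} → PrimeSquareTimes M p M′ → p ≤ M
  p≤M {p} {zero}   (_ , _ , _ , sf)  = contradiction (sf 0 ∣-refl) λ ()
  p≤M {p} {suc M′} (refl , pr , _) =
    ≤-trans (m≤m*n p p {{prime⇒nonZero pr}}) (m≤n*m (p * p) (suc M′))

𝔤-squarefree : ℕ → ℕ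
𝔤-squarefree 1 = 0
𝔤-squarefree M =
  foldr gcd ∣ + M ℤ.+ -1ℤ ℤ.^ (length (primeDivisors M) ∸ 1) ∣
    (map (λ p → p ^ 2 ∸ 1) (primeDivisors M))

-- In the second case M′ is squarefree, so 𝔤 M′ is 𝔤-squarefree M′; the prime p
-- and M′ are determined by M.
𝔤 : ℕ → ℕ
𝔤 M with squarefree? M | primeSquareTimes? M
... | yes _ | _                = 𝔤-squarefree M
... | no  _ | yes (p , M′ , _) = gcd p (𝔤-squarefree M′)
... | no  _ | no  _            = 1

OddPrime : ℕ → Set
OddPrime p = Prime p × p ≢ 2

oddPrime? : Decidable OddPrime
oddPrime? p = prime? p ×-dec ¬? (p ≟ 2)

BalancedPrimes : ℕ → ℕ → Set
BalancedPrimes p q =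
  OddPrime p × OddPrime q × p ≢ q ×
  val 2 (p ∸ 1) ≡ val 2 (q ∸ 1) × val 2 (p + 1) ≡ val 2 (q + 1)

balancedPrimes? : ∀ p q → Dec (BalancedPrimes p q)
balancedPrimes? p q =
  oddPrime? p ×-dec oddPrime? q ×-dec ¬? (p ≟ q) ×-dec
  (val 2 (p ∸ 1) ≟ val 2 (q ∸ 1)) ×-dec (val 2 (p + 1) ≟ val 2 (q + 1))

IsBalancedProduct : ℕ → Set
IsBalancedProduct M = ∃ λ p → ∃ λ q → M ≡ p * q × BalancedPrimes p q

isBalancedProduct? : Decidable IsBalancedProduct
isBalancedProduct? M =
  ∃? M (λ (_ , h) → p≤M h) λ p → ∃? M q≤M λ q → (M ≟ p * q) ×-dec balancedPrimes? p q
  where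
  p≤M : ∀ {p q} → M ≡ p * q × BalancedPrimes p q → p ≤ M
  p≤M {p} {q} (refl , _ , (qp , _) , _) = m≤m*n p q {{prime⇒nonZero qp}}
  q≤M : ∀ {p q} → M ≡ p * q × BalancedPrimes p q → q ≤ M
  q≤M {p} {q} (refl , (pp , _) , _) = m≤n*m q p {{prime⇒nonZero pp}}

𝔥-Cond : ℕ → Set
𝔥-Cond M =
    Prime M
  ⊎ (∃ λ r → M ≡ 2 ^ r × r % 2 ≡ 1)
  ⊎ IsBalancedProduct M
  ⊎ (∃ λ p → M ≡ 4 * p × Prime p × p % 4 ≡ 1)

𝔥-cond? : Decidable 𝔥-Cond
𝔥-cond? M =
    prime? M
  ⊎-dec ∃? M (λ { {r} (refl , _) → r≤2^r r }) (λ r → (M ≟ 2 ^ r) ×-dec (r % 2 ≟ 1))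
  ⊎-dec isBalancedProduct? M
  ⊎-dec ∃? M (λ { {p} (refl , _) → m≤n*m p 4 })
             (λ p → (M ≟ 4 * p) ×-dec prime? p ×-dec (p % 4 ≟ 1))

𝔥 : ℕ → ℕ
𝔥 M = if does (𝔥-cond? M) then 2 else 1

𝔤₂ : ℕ → ℕ → ℕ
𝔤₂ N d =
  if does (d ≟ N) then 𝔤 N
  else if does (z ≟ 1) then 𝔤 d
  else if does (prime? z ×-dec (val z d ≟ 1)) then gcd z (𝔤 (d ÷ z))
  else z ÷ rad z
  where z = gcd d (N ÷ d)

𝔥₂-Cond : ℕ → ℕ → Set
𝔥₂-Cond N d =
    (∃ λ r → N ≡ 2 ^ r × 2 ≤ r × d ≡ 2)
  ⊎ (∃ λ r → N ≡ 2 ^ r × 2 ≤ r × ∃ λ f → d ≡ 2 ^ f × 2 ∣ f)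
  ⊎ (∃ λ r → ∃ λ p → N ≡ 2 ^ r * p × 2 ≤ r × d ≡ 2 * p × Prime p × p % 4 ≡ 1)
  ⊎ (∃ λ r → N ≡ 2 ^ r * d × 1 ≤ r × OddPrime d)
  ⊎ (∃ λ r → N ≡ 2 ^ r * d × 1 ≤ r × IsBalancedProduct d)

𝔥₂-cond? : ∀ N d → Dec (𝔥₂-Cond N d)
𝔥₂-cond? N d =
    ∃? N (λ { {r} (refl , _) → r≤2^r r }) (λ r → (N ≟ 2 ^ r) ×-dec (2 ≤? r) ×-dec (d ≟ 2))
  ⊎-dec ∃? N (λ { {r} (refl , _) → r≤2^r r })
             (λ r → (N ≟ 2 ^ r) ×-dec (2 ≤? r) ×-dec
               ∃? d (λ { {f} (refl , _) → r≤2^r f }) (λ f → (d ≟ 2 ^ f) ×-dec (2 ∣? f)))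
  ⊎-dec ∃? N (λ { {r} (p , refl , _ , _ , pr , _) → r≤2^r*m r p {{prime⇒nonZero pr}} })
             (λ r → ∃? N (λ { {p} (refl , _) → m≤n*m p (2 ^ r) {{m^n≢0 2 r}} })
               (λ p → (N ≟ 2 ^ r * p) ×-dec (2 ≤? r) ×-dec (d ≟ 2 * p) ×-dec
                      prime? p ×-dec (p % 4 ≟ 1)))
  ⊎-dec ∃? N (λ { {r} (refl , _ , pr , _) → r≤2^r*m r d {{prime⇒nonZero pr}} })
             (λ r → (N ≟ 2 ^ r * d) ×-dec (1 ≤? r) ×-dec oddPrime? d)
  ⊎-dec ∃? N (λ { {r} (refl , _ , p , q , refl , (pp , _) , (qp , _) , _) →
                  r≤2^r*m r (p * q) {{m*n≢0 p q {{prime⇒nonZero pp}} {{prime⇒nonZero qp}}}} })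
             (λ r → (N ≟ 2 ^ r * d) ×-dec (1 ≤? r) ×-dec isBalancedProduct? d)

𝔥₂ : ℕ → ℕ → ℕ
𝔥₂ N d =
  if does (d ≟ N) then 𝔥 N
  else if does (𝔥₂-cond? N d) then 2
  else 1

-- Divisors on X₀(N) of the form ∑_{δ ∣ N} a_δ · (P_δ), given by δ ↦ a_δ.  The
-- supports of the (P_δ) are nonempty and pairwise disjoint, so the coefficients
-- are determined by the divisor.  Values at δ ∤ N are never used.
CuspDivisor : Set
CuspDivisor = ℕ → ℤ

infixl 6 _⊖_
infixl 7 _·_

P : ℕ → CuspDivisor
P δ e = if does (δ ≟ e) then 1ℤ else 0ℤ

_·_ : ℕ → CuspDivisor → CuspDivisor
(n · A) δ = + n ℤ.* A δ

_⊖_ : CuspDivisor → CuspDivisor → CuspDivisor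
(A ⊖ B) δ = A δ ℤ.- B δ

C : ℕ → ℕ → CuspDivisor
C N d = φ (gcd d (N ÷ d)) · P 1 ⊖ P d

-- The entry of Υ(p^r) in row p^i and column p^j.
υ : (p r i j : ℕ) → ℤ
υ p r i j =
  if does (i ≟ j) then
    (if does ((j ≟ 0) ⊎-dec (j ≟ r)) then + p else + (p ^ (m ∸ 1) * (p ^ 2 + 1)))
  else if does (∣ i - j ∣ ≟ 1) then ℤ.- (+ (p ^ m))
  else 0ℤ
  where m = j ⊓ (r ∸ j)

Υ : ℕ → ℕ → ℕ → ℤ
Υ N δ d = productℤ (map (λ p → υ p (val p N) (val p δ) (val p d)) (primeDivisors N))

V : ℕ → CuspDivisor → ℕ → ℤ
V N A δ = sumℤ (map (λ d → Υ N δ d ℤ.* A d) (divisors N))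

GCD : ℕ → CuspDivisor → ℕ
GCD N A = foldr gcd 0 (map (λ δ → ∣ V N A δ ∣) (divisors N))

𝕍 : ℕ → CuspDivisor → ℕ → ℤ
𝕍 N A δ = V N A δ ÷ℤ GCD N A

Pw : ℕ → ℕ → CuspDivisor → ℤ
Pw p N A = sumℤ (map (𝕍 N A) (filter (λ δ → val p δ % 2 ≟ 1) (divisors N)))

AllPwEven : ℕ → CuspDivisor → Set
AllPwEven N A = ∀ p → Prime p → 2 ∣ ∣ Pw p N A ∣

valUpTo≡0 : ∀ {p n} → n < p → .{{NonZero n}} → ∀ b → valUpTo p n b ≡ 0
valUpTo≡0 n<p zero = refl
valUpTo≡0 {p} {n} n<p (suc b) with p ^ suc b ∣? n
... | no  _ = valUpTo≡0 n<p b
... | yes h = contradiction (≤-trans p≤p^ (∣⇒≤ h)) (<⇒≱ n<p)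
  where
  instance _ = >-nonZero (≤-trans (s≤s z≤n) n<p)
  p≤p^ : p ≤ p ^ suc b
  p≤p^ = m≤m*n p (p ^ b) {{m^n≢0 p b}}

Pw≡0 : ∀ {p} N A → N < p → Pw p N A ≡ 0ℤ
Pw≡0 {p} N A N<p =
  cong (λ l → sumℤ (map (𝕍 N A) l))
       (filter-none (λ δ → val p δ % 2 ≟ 1) (All.tabulate even))
  where
  even : ∀ {δ} → δ ∈ divisors N → ¬ (val p δ % 2 ≡ 1)
  even δ∈ h with ∈-applyUpTo⁻ suc (proj₁ (∈-filter⁻ (_∣? N) {xs = range N} δ∈))
  ... | i , i<N , refl =
    contradiction (trans (sym (cong (_% 2) (valUpTo≡0 (≤-<-trans i<N N<p) (suc i)))) h) λ ()

allPwEven? : ∀ N A → Dec (AllPwEven N A)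
allPwEven? N A =
  map′ extend (λ f {p} _ → f p)
       (allUpTo? (λ p → prime? p →-dec (2 ∣? ∣ Pw p N A ∣)) (suc N))
  where
  extend : (∀ {p} → p < suc N → Prime p → 2 ∣ ∣ Pw p N A ∣) → AllPwEven N A
  extend f p pr with p ≤? N
  ... | yes p≤N = f (s≤s p≤N) pr
  ... | no  p≰N = subst (λ i → 2 ∣ ∣ i ∣) (sym (Pw≡0 N A (≰⇒> p≰N))) (2 ∣0)

𝔥-div : ℕ → CuspDivisor → ℕ
𝔥-div N A = if does (allPwEven? N A) then 1 else 2

-- Both 𝔤 and 𝔥 are read off local data.  At each prime p dividing N, the columns
-- of Υ(p^r) at 1 and at the exponent of p in d, scaled by φ and by the common
-- factor p^(m-1), are sparse vectors A_p and B_p, so that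
-- V(C_d) = (z / rad z) (⊗ A_p − ⊗ B_p), and GCD(C_d) = (z / rad z) G where n ∣ G
-- iff n divides every entry of ⊗ A_p − ⊗ B_p.  Every B_p has coprime entries.  If
-- p³ ∣ d and p ∤ z, or p² ∣ d and p ∣ z, then the entries of B_p at which A_p
-- vanishes are still coprime, so G = 1.  If p² ∥ d and p ∤ z, or p ∥ d and p ∣ z,
-- then G ∣ p, and two such primes force G = 1.  If d is squarefree and z = 1, with
-- t primes dividing d, then n ∣ G iff n ∣ d − (−1)^t and n ∣ p² − 1 for all p ∣ d.
--
-- For the parity, A_p and B_p have the same coordinate sum (p − 1 or (p − 1)²), so
-- X = G · Pw_p is the difference of the sums over odd positions at p times the product
-- of the coordinate sums at the other primes, and the question is whether 2 G
-- divides X.  It does as soon as G ∣ o c with o odd and 2 c ∣ X.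
module Submission where

import Algebra.Properties.CommutativeSemigroup as CommutativeSemigroupₚ
open import Defs
open import Data.Bool using (if_then_else_)
open import Data.Integer as ℤ using (ℤ; +_; ∣_∣; 0ℤ; 1ℤ; -1ℤ)
import Data.Integer.Properties as ℤₚ
import Data.Integer.DivMod as ℤDM
open import Data.Integer.Divisibility.Signed as ℤ∣ using (divides; ∣ᵤ⇒∣; ∣⇒∣ᵤ) renaming (_∣_ to _∣ᶻ_)
open import Data.Integer.Tactic.RingSolver using (solve-∀)
open import Data.Empty using (⊥)
open import Data.List using (List; []; _∷_; _++_; map; filter; foldr; length)
open import Data.List.Membership.Propositional using (_∈_)
import Data.List.Membership.Propositional.Properties as ∈ₚ
import Data.List.Properties as Listₚ
open import Data.List.Relation.Binary.Permutation.Propositional as Perm using (_↭_; ↭-sym; ↭-trans; ↭-refl; prep; swap)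
import Data.List.Relation.Binary.Permutation.Propositional.Properties as ↭ₚ
open import Data.List.Relation.Binary.BagAndSetEquality using (∼bag⇒↭)
open import Data.List.Membership.Propositional.Properties.WithK using (unique∧set⇒bag)
open import Data.List.Relation.Unary.All as All using (All; []; _∷_)
import Data.List.Relation.Unary.All.Properties as Allₚ
open import Data.List.Relation.Unary.Any using (here; there)
open import Data.List.Relation.Unary.AllPairs using ([]; _∷_)
open import Data.List.Relation.Unary.Unique.Propositional using (Unique)
import Data.List.Relation.Unary.Unique.Propositional.Properties as Uniqueₚ
open import Data.Nat using (ℕ; zero; suc; _+_; _*_; _∸_; _^_; _⊓_; _/_; _%_; _≤_; _<_; s≤s; z≤n; ∣_-_∣; NonZero; >-nonZero; ≢-nonZero; ≢-nonZero⁻¹)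
import Data.Nat.Coprimality as Coprimality
import Data.Nat.DivMod as DM
open import Data.Nat.Divisibility as ∣ using (_∣_; _∣?_; divides)
open import Data.Nat.GCD using (gcd; gcd-comm; gcd-zeroʳ; gcd[m,n]∣m; gcd[m,n]∣n; gcd-greatest; c*gcd[m,n]≡gcd[cm,cn])
open import Data.Nat.ListAction using (product)
import Data.Nat.ListAction.Properties as LAₚ
open import Data.Nat.Primality using (Prime; prime?; prime⇒nonZero; euclidsLemma; prime⇒irreducible; prime[2]; ¬prime[1]; ¬prime[0])
import Data.Nat.Primality.Factorisation as Fact
open import Data.Nat.Properties
import Data.Nat.Tactic.RingSolver as ℕR
open import Data.Product using (∃; _×_; _,_; proj₁; proj₂; map₂)
open import Data.Sum using (_⊎_; inj₁; inj₂)
open import Data.Unit using (⊤; tt)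
open import Function using (_∘_; mk⇔)
open import Relation.Binary.PropositionalEquality
open import Relation.Nullary using (Dec; yes; no; ¬_; does; contradiction)
open import Relation.Nullary.Decidable using (dec-true; dec-false; does-⇔; from-no; _×-dec_)

-- `Divides` replaces a gcd over all divisors of N by a recursion over primes. Fixing the exponent
-- at one prime multiplies x by an entry of `A` and y by an entry of `B`, so two positions of a
-- single column can be combined to make x vanish. The condition is invariant under permutation, so
-- any prime may come first. G is reached only through its divisors n. For the parity, an odd G asks
-- only whether X is even. An even G leaves two situations. Either the special prime is 2, so G ∣ 2
-- and everything is decided modulo 4, or d is odd and squarefree with z = 1. Then o c is one of the
-- known multiples of G: p² - 1 with p ∣ d, or d - (-1)^t. With three or more primes in d, residues
-- modulo 4 select one that works. With exactly two they do not suffice, and the 2-adic valuations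
-- of p ± 1 and q ± 1 enter; this is the origin of the balanced pairs. For the converse G is never
-- evaluated: a divisor n of G with 2 n ∤ X is exhibited.

module ℕ+ = CommutativeSemigroupₚ +-commutativeSemigroup
module ℕ* = CommutativeSemigroupₚ *-commutativeSemigroup
module ℤ+ = CommutativeSemigroupₚ ℤₚ.+-commutativeSemigroup
module ℤ* = CommutativeSemigroupₚ ℤₚ.*-commutativeSemigroup

-- Local data at a prime p: the exponents (r, f) of p in N and in d are
-- (1 + r′, 0), (1 + r′, 1 + r′) and (1 + f′ + 1 + k, 1 + f′) respectively.
data Shape : Set where
  absent full : (r′ : ℕ) → Shape
  mid         : (f′ k : ℕ) → Shape

Loc : Set
Loc = ℕ × Shape

-- Local exponents and sparse columns.

rExp fExp : Shape → ℕ
rExp (absent r′) = suc r′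
rExp (full r′)   = suc r′
rExp (mid f′ k)  = suc f′ + suc k
fExp (absent r′) = 0
fExp (full r′)   = suc r′
fExp (mid f′ k)  = suc f′

-- Defined by recursion instead of a decision, so that column entries at numeral positions compute
-- and can be handed to the ring solver directly.
kron : ℕ → ℕ → ℤ
kron zero    zero    = 1ℤ
kron zero    (suc j) = 0ℤ
kron (suc i) zero    = 0ℤ
kron (suc i) (suc j) = kron i j

kron-refl : ∀ i → kron i i ≡ 1ℤ
kron-refl zero    = refl
kron-refl (suc i) = kron-refl i

kron-≢ : ∀ {i j} → i ≢ j → kron i j ≡ 0ℤ
kron-≢ {zero}  {zero}  i≢j = contradiction refl i≢j
kron-≢ {zero}  {suc j} i≢j = refl
kron-≢ {suc i} {zero}  i≢j = refl
kron-≢ {suc i} {suc j} i≢j = kron-≢ (i≢j ∘ cong suc)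

kron-suc : ∀ i → kron (suc i) i ≡ 0ℤ
kron-suc i = kron-≢ {suc i} {i} 1+n≢n

kron-pred : ∀ i → kron i (suc i) ≡ 0ℤ
kron-pred i = kron-≢ {i} {suc i} (1+n≢n ∘ sym)

-- A sparse vector: (a , j) stands for the entry a in position j.
Column : Set
Column = List (ℤ × ℕ)

entry : Column → ℕ → ℤ
entry []            i = 0ℤ
entry ((a , j) ∷ c) i = a ℤ.* kron i j ℤ.+ entry c i

-- The columns of Υ(p^r) belonging to P₁ (times φ) and to P_d, both divided by
-- p^(m-1) in the case 0 < f < r.
colA colB : ℕ → Shape → Column
colA p (mid f′ k)  = ((+ p ℤ.- 1ℤ) ℤ.* + p , 0) ∷ (ℤ.- (+ p ℤ.- 1ℤ) , 1) ∷ []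
colA p _           = (+ p , 0) ∷ (-1ℤ , 1) ∷ []
colB p (absent r′) = (+ p , 0) ∷ (-1ℤ , 1) ∷ []
colB p (full r′)   = (-1ℤ , r′) ∷ (+ p , suc r′) ∷ []
colB p (mid f′ k)  = (ℤ.- + p , f′) ∷ (+ p ℤ.* + p ℤ.+ 1ℤ , suc f′) ∷ (ℤ.- + p , suc (suc f′)) ∷ []

A B : ℕ → Shape → ℕ → ℤ
A p s = entry (colA p s)
B p s = entry (colB p s)

-- n divides x ∏ A_p(i_p) − y ∏ B_p(i_p) for every choice of exponents i_p ≤ r_p.
Divides : ℕ → List Loc → ℤ → ℤ → Set
Divides n []            x y = + n ∣ᶻ x ℤ.- y
Divides n ((p , s) ∷ L) x y = ∀ i → i ≤ rExp s → Divides n L (x ℤ.* A p s i) (y ℤ.* B p s i)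

-- Divisibility of all tensor entries at once.

∣-lin : ∀ {n x y} a b → n ∣ᶻ x → n ∣ᶻ y → n ∣ᶻ a ℤ.* x ℤ.+ b ℤ.* y
∣-lin a b n∣x n∣y = ℤ∣.∣m∣n⇒∣m+n (ℤ∣.∣n⇒∣m*n a n∣x) (ℤ∣.∣n⇒∣m*n b n∣y)

∣-resp : ∀ {n x y} → x ≡ y → n ∣ᶻ x → n ∣ᶻ y
∣-resp = subst (_ ∣ᶻ_)

∣-0 : ∀ n → n ∣ᶻ 0ℤ
∣-0 n = divides 0ℤ refl

Divides-≡ : ∀ {n} L {x y x′ y′} → x ≡ x′ → y ≡ y′ → Divides n L x y → Divides n L x′ y′
Divides-≡ L refl refl h = h

Divides-cong : ∀ {n} L {x y x′ y′} → + n ∣ᶻ x′ ℤ.- x → + n ∣ᶻ y′ ℤ.- y → Divides n L x y → Divides n L x′ y′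
Divides-cong [] {x} {y} {x′} {y′} hx hy h =
  ∣-resp (lemma x y x′ y′) (∣-lin 1ℤ 1ℤ h (∣-lin 1ℤ -1ℤ hx hy))
  where
  lemma : ∀ x y x′ y′ → 1ℤ ℤ.* (x ℤ.- y) ℤ.+ 1ℤ ℤ.* (1ℤ ℤ.* (x′ ℤ.- x) ℤ.+ -1ℤ ℤ.* (y′ ℤ.- y)) ≡ x′ ℤ.- y′
  lemma = solve-∀
Divides-cong ((p , s) ∷ L) {x} {y} {x′} {y′} hx hy h i i≤r =
  Divides-cong L (times (A p s i) x x′ hx) (times (B p s i) y y′ hy) (h i i≤r)
  where
  lemma : ∀ c x x′ → c ℤ.* (x′ ℤ.- x) ≡ x′ ℤ.* c ℤ.- x ℤ.* c
  lemma = solve-∀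
  times : ∀ {n} c x x′ → + n ∣ᶻ x′ ℤ.- x → + n ∣ᶻ x′ ℤ.* c ℤ.- x ℤ.* c
  times c x x′ h = ∣-resp (lemma c x x′) (ℤ∣.∣n⇒∣m*n c h)

-- For each choice of exponents x and y are multiplied by fixed integers, so the admissible pairs (x
-- , y) form a submodule of ℤ². This permits combining two positions of one column.
Divides-lin : ∀ {n} L {x y x′ y′} a b → Divides n L x y → Divides n L x′ y′ →
              Divides n L (a ℤ.* x ℤ.+ b ℤ.* x′) (a ℤ.* y ℤ.+ b ℤ.* y′)
Divides-lin [] {x} {y} {x′} {y′} a b h h′ = ∣-resp (lemma a b x y x′ y′) (∣-lin a b h h′)
  where
  lemma : ∀ a b x y x′ y′ → a ℤ.* (x ℤ.- y) ℤ.+ b ℤ.* (x′ ℤ.- y′) ≡ (a ℤ.* x ℤ.+ b ℤ.* x′) ℤ.- (a ℤ.* y ℤ.+ b ℤ.* y′)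
  lemma = solve-∀
Divides-lin ((p , s) ∷ L) {x} {y} {x′} {y′} a b h h′ i i≤r =
  Divides-≡ L (lemma a b x x′ (A p s i)) (lemma a b y y′ (B p s i)) (Divides-lin L a b (h i i≤r) (h′ i i≤r))
  where
  lemma : ∀ a b x x′ c → a ℤ.* (x ℤ.* c) ℤ.+ b ℤ.* (x′ ℤ.* c) ≡ (a ℤ.* x ℤ.+ b ℤ.* x′) ℤ.* c
  lemma = solve-∀

Divides-scale : ∀ {n} L {x y} c → Divides n L x y → Divides n L (c ℤ.* x) (c ℤ.* y)
Divides-scale L {x} {y} c h = Divides-≡ L (lemma c x) (lemma c y) (Divides-lin L c 0ℤ h h)
  where
  lemma : ∀ c x → c ℤ.* x ℤ.+ 0ℤ ℤ.* x ≡ c ℤ.* x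
  lemma = solve-∀

-- Lets any prime be moved to the head, where the recursion exposes its column.
Divides-↭ : ∀ {n L L′} {x y} → L ↭ L′ → Divides n L x y → Divides n L′ x y
Divides-↭ Perm.refl h = h
Divides-↭ (prep _ π) h i i≤r = Divides-↭ π (h i i≤r)
Divides-↭ {L = (p , s) ∷ (q , t) ∷ L} {x = x} {y} (swap _ _ π) h j j≤ i i≤ =
  Divides-↭ π (Divides-≡ L (lemma x (A p s i) (A q t j)) (lemma y (B p s i) (B q t j)) (h i i≤ j j≤))
  where
  lemma : ∀ x a b → x ℤ.* a ℤ.* b ≡ x ℤ.* b ℤ.* a
  lemma = solve-∀
Divides-↭ (Perm.trans π ρ) h = Divides-↭ ρ (Divides-↭ π h)

A-full≥2 : ∀ p r′ i → A p (full r′) (suc (suc i)) ≡ 0ℤ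
A-full≥2 p r′ i = lemma (+ p)
  where
  lemma : ∀ p → p ℤ.* 0ℤ ℤ.+ (-1ℤ ℤ.* 0ℤ ℤ.+ 0ℤ) ≡ 0ℤ
  lemma = solve-∀

A-mid≥2 : ∀ p f′ k i → A p (mid f′ k) (suc (suc i)) ≡ 0ℤ
A-mid≥2 p f′ k i = lemma (+ p)
  where
  lemma : ∀ p → (p ℤ.- 1ℤ) ℤ.* p ℤ.* 0ℤ ℤ.+ ((ℤ.- (p ℤ.- 1ℤ)) ℤ.* 0ℤ ℤ.+ 0ℤ) ≡ 0ℤ
  lemma = solve-∀

B-full-top : ∀ p r′ → B p (full r′) (suc r′) ≡ + p
B-full-top p r′ rewrite kron-suc r′ | kron-refl r′ = lemma (+ p)
  where
  lemma : ∀ p → 0ℤ ℤ.+ (p ℤ.* 1ℤ ℤ.+ 0ℤ) ≡ p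
  lemma = solve-∀

B-full-below : ∀ p r′ → B p (full r′) r′ ≡ -1ℤ
B-full-below p r′ rewrite kron-pred r′ | kron-refl r′ = lemma (+ p)
  where
  lemma : ∀ p → -1ℤ ℤ.+ (p ℤ.* 0ℤ ℤ.+ 0ℤ) ≡ -1ℤ
  lemma = solve-∀

B-mid-centre : ∀ p f′ k → B p (mid f′ k) (suc f′) ≡ + p ℤ.* + p ℤ.+ 1ℤ
B-mid-centre p f′ k rewrite kron-suc f′ | kron-refl f′ | kron-pred f′ = lemma (+ p)
  where
  lemma : ∀ p → (ℤ.- p) ℤ.* 0ℤ ℤ.+ ((p ℤ.* p ℤ.+ 1ℤ) ℤ.* 1ℤ ℤ.+ ((ℤ.- p) ℤ.* 0ℤ ℤ.+ 0ℤ)) ≡ p ℤ.* p ℤ.+ 1ℤ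
  lemma = solve-∀

B-mid-above : ∀ p f′ k → B p (mid f′ k) (suc (suc f′)) ≡ ℤ.- + p
B-mid-above p f′ k rewrite kron-suc f′ | kron-refl f′ | kron-≢ {suc (suc f′)} {f′} (λ e → m+1+n≢n 1 {f′} e) = lemma (+ p)
  where
  lemma : ∀ p → (ℤ.- p) ℤ.* 0ℤ ℤ.+ ((p ℤ.* p ℤ.+ 1ℤ) ℤ.* 0ℤ ℤ.+ ((ℤ.- p) ℤ.* 1ℤ ℤ.+ 0ℤ)) ≡ ℤ.- p
  lemma = solve-∀

cancel-full : ∀ y → -1ℤ ℤ.* (y ℤ.* -1ℤ) ≡ y
cancel-full = solve-∀

-- The Bézout relation (p² + 1) + p · (-p) = 1 between the central entry of a `mid` column and a
-- neighbouring one.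
cancel-mid : ∀ y p → 1ℤ ℤ.* (y ℤ.* (p ℤ.* p ℤ.+ 1ℤ)) ℤ.+ p ℤ.* (y ℤ.* (ℤ.- p)) ≡ y
cancel-mid = solve-∀

-- The columns B_p are primitive, and so is their tensor product.
Divides-0ˡ : ∀ {n} L {y} → Divides n L 0ℤ y → + n ∣ᶻ y
Divides-0ˡ [] {y} h = ∣-resp (lemma y) (ℤ∣.∣n⇒∣m*n -1ℤ h)
  where
  lemma : ∀ y → -1ℤ ℤ.* (0ℤ ℤ.- y) ≡ y
  lemma = solve-∀
Divides-0ˡ {n} ((p , absent r′) ∷ L) {y} h =
  ∣-resp (lemma y (+ p)) (ℤ∣.∣n⇒∣m*n -1ℤ (Divides-0ˡ L (h 1 (s≤s z≤n))))
  where
  lemma : ∀ y p → -1ℤ ℤ.* (y ℤ.* (p ℤ.* 0ℤ ℤ.+ (-1ℤ ℤ.* 1ℤ ℤ.+ 0ℤ))) ≡ y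
  lemma = solve-∀
Divides-0ˡ {n} ((p , full r′) ∷ L) {y} h =
  ∣-resp (cancel-full y) (ℤ∣.∣n⇒∣m*n -1ℤ (Divides-0ˡ L (subst (λ b → Divides n L 0ℤ (y ℤ.* b)) (B-full-below p r′) (h r′ (n≤1+n r′)))))
Divides-0ˡ {n} ((p , mid f′ k) ∷ L) {y} h =
  ∣-resp (cancel-mid y (+ p)) (∣-lin 1ℤ (+ p)
    (Divides-0ˡ L (subst (λ b → Divides n L 0ℤ (y ℤ.* b)) (B-mid-centre p f′ k) (h (suc f′) (m≤m+n (suc f′) (suc k)))))
    (Divides-0ˡ L (subst (λ b → Divides n L 0ℤ (y ℤ.* b)) (B-mid-above p f′ k)
      (h (suc (suc f′)) (s≤s (≤-trans (m≤m+n (suc f′) k) (≤-reflexive (sym (+-suc f′ k)))))))))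

-- Classification of local shapes.

-- Column `A` lives on positions 0 and 1. The three classes record what `B` has beyond these:
-- nothing (`Thin`), a single entry ±p in position 2 (`Special`), or coprime entries (`Fat`).
data Thin : Shape → Set where
  absent : ∀ {r′} → Thin (absent r′)
  full   : Thin (full 0)

data Special : Shape → Set where
  full : Special (full 1)
  mid  : ∀ {k} → Special (mid 0 k)

data Fat : Shape → Set where
  full : ∀ {r″} → Fat (full (suc (suc r″)))
  mid  : ∀ {f″ k} → Fat (mid (suc f″) k)

data Degenerate (L : List Loc) : Set where
  fat : ∀ {p s L′} → L ↭ (p , s) ∷ L′ → Fat s → Degenerate L
  two : ∀ {p s q t L′} → L ↭ (p , s) ∷ (q , t) ∷ L′ → Special s → Special t → Degenerate L

data Class (L : List Loc) : Set where
  thin       : All (Thin ∘ proj₂) L → Class L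
  one        : ∀ {p s L′} → L ↭ (p , s) ∷ L′ → Special s → All (Thin ∘ proj₂) L′ → Class L
  degenerate : Degenerate L → Class L

swap-head : ∀ {a} {X : Set a} {L L′ : List X} {x y} → L ↭ y ∷ L′ → x ∷ L ↭ y ∷ x ∷ L′
swap-head {x = x} {y} π = ↭-trans (prep x π) (swap x y ↭-refl)

classify : ∀ L → Class L
classify [] = thin []
classify ((p , s) ∷ L) = go s (classify L)
  where
  addThin : ∀ {s} → Thin s → Class L → Class ((p , s) ∷ L)
  addThin h (thin hs)                       = thin (h ∷ hs)
  addThin h (one π sp hs)                   = one (swap-head π) sp (h ∷ hs)
  addThin h (degenerate (fat π ft))         = degenerate (fat (swap-head π) ft)
  addThin h (degenerate (two π sp sp′))     = degenerate (two (↭-trans (swap-head π) (prep _ (swap _ _ ↭-refl))) sp sp′)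
  addSpecial : ∀ {s} → Special s → Class L → Class ((p , s) ∷ L)
  addSpecial h (thin hs)                    = one ↭-refl h hs
  addSpecial h (one π sp hs)                = degenerate (two (prep _ π) h sp)
  addSpecial h (degenerate (fat π ft))      = degenerate (fat (swap-head π) ft)
  addSpecial h (degenerate (two π sp sp′))  = degenerate (two (↭-trans (swap-head π) (prep _ (swap _ _ ↭-refl))) sp sp′)
  go : ∀ s → Class L → Class ((p , s) ∷ L)
  go (absent r′)          = addThin absent
  go (full 0)             = addThin full
  go (full 1)             = addSpecial full
  go (full (suc (suc _))) = λ _ → degenerate (fat ↭-refl full)
  go (mid 0 k)            = addSpecial mid
  go (mid (suc f″) k)     = λ _ → degenerate (fat ↭-refl mid)

-- A position where `A` vanishes kills x, and primitivity of the remaining `B` columns then isolates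
-- the scalar y b.
Divides-at : ∀ {n p s L x y} i {b} → i ≤ rExp s → A p s i ≡ 0ℤ → B p s i ≡ b →
             Divides n ((p , s) ∷ L) x y → + n ∣ᶻ y ℤ.* b
Divides-at {L = L} {x} i i≤r a≡0 refl h =
  Divides-0ˡ L (Divides-≡ L (trans (cong (x ℤ.*_) a≡0) (ℤₚ.*-zeroʳ x)) refl (h i i≤r))

Divides-fat : ∀ {n p s L x y} → Fat s → Divides n ((p , s) ∷ L) x y → + n ∣ᶻ y
Divides-fat {n} {p} {_} {L} {x} {y} (full {r″}) h =
  ∣-resp (cancel-full y) (ℤ∣.∣n⇒∣m*n -1ℤ
    (Divides-at {p = p} {full r′} {L} {x} {y} r′ (n≤1+n r′) (A-full≥2 p r′ r″) (B-full-below p r′) h))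
  where
  r′ = suc (suc r″)
Divides-fat {n} {p} {_} {L} {x} {y} (mid {f″} {k}) h =
  ∣-resp (cancel-mid y (+ p)) (∣-lin 1ℤ (+ p)
    (Divides-at {p = p} {mid f′ k} {L} {x} {y} (suc f′) (m≤m+n (suc f′) (suc k)) (A-mid≥2 p f′ k f″) (B-mid-centre p f′ k) h)
    (Divides-at {p = p} {mid f′ k} {L} {x} {y} (suc (suc f′)) (s≤s (≤-trans (m≤m+n (suc f′) k) (≤-reflexive (sym (+-suc f′ k)))))
      (A-mid≥2 p f′ k (suc f″)) (B-mid-above p f′ k) h))
  where
  f′ = suc f″

Divides-special : ∀ {n p s L} → Special s → Divides n ((p , s) ∷ L) 1ℤ 1ℤ → n ∣ p
Divides-special {n} {p} {_} {L} full h =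
  ∣⇒∣ᵤ (∣-resp (ℤₚ.*-identityˡ (+ p)) (Divides-at {p = p} {full 1} {L} {1ℤ} {1ℤ} 2 ≤-refl (A-full≥2 p 1 0) (B-full-top p 1) h))
Divides-special {n} {p} {_} {L} (mid {k}) h =
  ∣⇒∣ᵤ (∣-resp (lemma (+ p)) (ℤ∣.∣n⇒∣m*n -1ℤ
    (Divides-at {p = p} {mid 0 k} {L} {1ℤ} {1ℤ} 2 (s≤s (s≤s z≤n)) (A-mid≥2 p 0 k 0) (B-mid-above p 0 k) h)))
  where
  lemma : ∀ p → -1ℤ ℤ.* (1ℤ ℤ.* (ℤ.- p)) ≡ p
  lemma = solve-∀

-- Read off at position 1. For `full` both entries are -1. For `mid` they are 1 - p and p² + 1, both
-- congruent to 1 modulo p, hence modulo n because n ∣ p.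
Divides-tail : ∀ {n p s L} → Special s → Divides n ((p , s) ∷ L) 1ℤ 1ℤ → Divides n L 1ℤ 1ℤ
Divides-tail {n} {p} {_} {L} full h =
  Divides-≡ L (lemmaA (+ p)) (lemmaB (+ p)) (Divides-scale L -1ℤ (h 1 (s≤s z≤n)))
  where
  lemmaA : ∀ p → -1ℤ ℤ.* (1ℤ ℤ.* (p ℤ.* 0ℤ ℤ.+ -1ℤ)) ≡ 1ℤ
  lemmaA = solve-∀
  lemmaB : ∀ p → -1ℤ ℤ.* (1ℤ ℤ.* (-1ℤ ℤ.+ (p ℤ.* 0ℤ ℤ.+ 0ℤ))) ≡ 1ℤ
  lemmaB = solve-∀
Divides-tail {n} {p} {_} {L} sp@(mid {k}) h =
  Divides-cong L (∣-resp (lemmaA (+ p)) n∣p) (∣-resp (lemmaB (+ p)) (ℤ∣.∣n⇒∣m*n (ℤ.- + p) n∣p)) (h 1 (s≤s z≤n))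
  where
  n∣p = ∣ᵤ⇒∣ {+ n} {+ p} (Divides-special {L = L} sp h)
  lemmaA : ∀ p → p ≡ 1ℤ ℤ.- 1ℤ ℤ.* ((p ℤ.- 1ℤ) ℤ.* p ℤ.* 0ℤ ℤ.+ ((ℤ.- (p ℤ.- 1ℤ)) ℤ.* 1ℤ ℤ.+ 0ℤ))
  lemmaA = solve-∀
  lemmaB : ∀ p → (ℤ.- p) ℤ.* p ≡ 1ℤ ℤ.- 1ℤ ℤ.* ((ℤ.- p) ℤ.* 0ℤ ℤ.+ ((p ℤ.* p ℤ.+ 1ℤ) ℤ.* 1ℤ ℤ.+ ((ℤ.- p) ℤ.* 0ℤ ℤ.+ 0ℤ)))
  lemmaB = solve-∀

private
  -- Modulo p the columns A and B of a special prime agree.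
  special-cong : ∀ {n p s} → Special s → n ∣ p → ∀ i →
                 ∃ λ c → + n ∣ᶻ A p s i ℤ.- c × + n ∣ᶻ B p s i ℤ.- c
  special-cong {n} {p} {s} sp n∣p i = go sp
    where
    k₀ = kron i 0
    k₁ = kron i 1
    k₂ = kron i 2
    multiple : ∀ c {x} → c ℤ.* + p ≡ x → + n ∣ᶻ x
    multiple c refl = ℤ∣.∣n⇒∣m*n c (∣ᵤ⇒∣ {+ n} {+ p} n∣p)
    full-A : ∀ p x y → x ℤ.* p ≡ p ℤ.* x ℤ.+ (-1ℤ ℤ.* y ℤ.+ 0ℤ) ℤ.- (ℤ.- y)
    full-A = solve-∀
    full-B : ∀ p y z → z ℤ.* p ≡ -1ℤ ℤ.* y ℤ.+ (p ℤ.* z ℤ.+ 0ℤ) ℤ.- (ℤ.- y)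
    full-B = solve-∀
    mid-A : ∀ p x y → ((p ℤ.- 1ℤ) ℤ.* x ℤ.- y) ℤ.* p ≡
            (p ℤ.- 1ℤ) ℤ.* p ℤ.* x ℤ.+ ((ℤ.- (p ℤ.- 1ℤ)) ℤ.* y ℤ.+ 0ℤ) ℤ.- y
    mid-A = solve-∀
    mid-B : ∀ p x y z → (p ℤ.* y ℤ.- x ℤ.- z) ℤ.* p ≡
            (ℤ.- p) ℤ.* x ℤ.+ ((p ℤ.* p ℤ.+ 1ℤ) ℤ.* y ℤ.+ ((ℤ.- p) ℤ.* z ℤ.+ 0ℤ)) ℤ.- y
    mid-B = solve-∀
    go : Special s → ∃ λ c → + n ∣ᶻ A p s i ℤ.- c × + n ∣ᶻ B p s i ℤ.- c
    go full = ℤ.- k₁ , multiple k₀ (full-A (+ p) k₀ k₁) , multiple k₂ (full-B (+ p) k₁ k₂)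
    go mid  = k₁ , multiple ((+ p ℤ.- 1ℤ) ℤ.* k₀ ℤ.- k₁) (mid-A (+ p) k₀ k₁)
            , multiple (+ p ℤ.* k₁ ℤ.- k₀ ℤ.- k₂) (mid-B (+ p) k₀ k₁ k₂)

-- Modulo n both columns of a special prime have the same entry c at each position, so the condition
-- is c times the one for the tail.
Divides-cons : ∀ {n p s L} → Special s → n ∣ p → Divides n L 1ℤ 1ℤ → Divides n ((p , s) ∷ L) 1ℤ 1ℤ
Divides-cons {n} {p} {s} {L} sp n∣p h i _ with special-cong sp n∣p i
... | c , hA , hB =
  Divides-cong L (∣-resp (lemma (A p s i) c) hA) (∣-resp (lemma (B p s i) c) hB) (Divides-scale L c h)
  where
  lemma : ∀ a c → a ℤ.- c ≡ 1ℤ ℤ.* a ℤ.- c ℤ.* 1ℤ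
  lemma = solve-∀

prime-∣⇒≡ : ∀ {p q} → Prime p → Prime q → p ∣ q → p ≡ q
prime-∣⇒≡ pp pq p∣q with prime⇒irreducible pq p∣q
... | inj₁ refl = contradiction pp ¬prime[1]
... | inj₂ p≡q  = p≡q

distinct-primes-coprime : ∀ {p q} → Prime p → Prime q → p ≢ q → Coprimality.Coprime p q
distinct-primes-coprime pp pq p≢q {n} (n∣p , n∣q) with prime⇒irreducible pp n∣p
... | inj₁ n≡1  = n≡1
... | inj₂ refl = contradiction (prime-∣⇒≡ pp pq n∣q) p≢q

-- Well-formed lists and degenerate lists.

WF : List Loc → Set
WF L = Unique (map proj₁ L) × All (Prime ∘ proj₁) L

WF-↭ : ∀ {L L′} → L ↭ L′ → WF L → WF L′
WF-↭ π (u , ps) = Unique-↭ (↭ₚ.map⁺ proj₁ π) u , ↭ₚ.All-resp-↭ π ps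
  where
  Unique-↭ : ∀ {xs ys : List ℕ} → xs ↭ ys → Unique xs → Unique ys
  Unique-↭ Perm.refl u = u
  Unique-↭ (prep x π) (h ∷ u) = ↭ₚ.All-resp-↭ π h ∷ Unique-↭ π u
  Unique-↭ (swap x y π) ((x≢y ∷ hx) ∷ hy ∷ u) =
    ((x≢y ∘ sym) ∷ ↭ₚ.All-resp-↭ π hy) ∷ ↭ₚ.All-resp-↭ π hx ∷ Unique-↭ π u
  Unique-↭ (Perm.trans π ρ) u = Unique-↭ ρ (Unique-↭ π u)

WF-tail : ∀ {l L} → WF (l ∷ L) → WF L
WF-tail (_ ∷ u , _ ∷ ps) = u , ps

heads-distinct : ∀ {p s q t L L′} → WF L → L ↭ (p , s) ∷ (q , t) ∷ L′ → p ≢ q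
heads-distinct wf π with WF-↭ π wf
... | (p≢q ∷ _) ∷ _ , _ = p≢q

Divides-degenerate : ∀ {n L} → WF L → Degenerate L → Divides n L 1ℤ 1ℤ → n ≡ 1
Divides-degenerate {n} wf (fat {p} {s} {L′} π ft) h =
  ∣.∣1⇒≡1 (∣⇒∣ᵤ {+ n} {1ℤ} (Divides-fat {p = p} {L = L′} {x = 1ℤ} ft (Divides-↭ π h)))
Divides-degenerate wf (two {p} {s} {q} {t} {L′} π sp sp′) h with WF-↭ π wf
... | (p≢q ∷ _) ∷ _ , pp ∷ pq ∷ _ =
  distinct-primes-coprime pp pq p≢q
    ( Divides-special {p = p} {L = (q , t) ∷ L′} sp (Divides-↭ π h)
    , Divides-special {p = q} {L = (p , s) ∷ L′} sp′ (Divides-↭ (↭-trans π (swap _ _ ↭-refl)) h) )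

-- One product serves for N, d, N / d, z and z / rad z, and with zero exponents for 1, so valuations
-- and prime divisors are treated once for all of them.
power : (Shape → ℕ) → List Loc → ℕ
power e []            = 1
power e ((p , s) ∷ L) = p ^ e s * power e L

NOf dOf : List Loc → ℕ
NOf = power rExp
dOf = power fExp

-- The thin case: congruence conditions on d and its primes.

sgn : List Loc → ℤ
sgn []                  = 1ℤ
sgn ((p , absent _) ∷ L) = sgn L
sgn ((p , _) ∷ L)        = ℤ.- sgn L

-- The factor y is the `B` scalar accumulated by `Divides`. The descent along a thin list only
-- multiplies it by -1, so the condition can be carried back to the start.
SquareIsOne : ℕ → ℤ → Loc → Set
SquareIsOne n y (p , full _) = + n ∣ᶻ (+ p ℤ.* + p ℤ.- 1ℤ) ℤ.* y
SquareIsOne n y (p , _)      = ⊤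

+[p*m] : ∀ p m → + (p ^ 1 * m) ≡ + p ℤ.* + m
+[p*m] p m = trans (cong (λ x → + (x * m)) (*-identityʳ p)) (ℤₚ.pos-* p m)

-- Evaluate at one corner: position 1 at absent primes, where both entries are -1, and position 0 at
-- full primes, where `A` gives p and `B` gives -1.
Divides⇒product : ∀ {n L x y} → All (Thin ∘ proj₂) L → Divides n L x y → + n ∣ᶻ x ℤ.* + dOf L ℤ.- y ℤ.* sgn L
Divides⇒product {x = x} {y} [] h = ∣-resp (lemma x y) h
  where
  lemma : ∀ x y → x ℤ.- y ≡ x ℤ.* 1ℤ ℤ.- y ℤ.* 1ℤ
  lemma = solve-∀
Divides⇒product {L = (p , _) ∷ L} {x} {y} (absent ∷ hs) h =
  ∣-resp (trans (lemma (+ p) x y (+ dOf L) (sgn L)) (cong (λ e → x ℤ.* + e ℤ.- y ℤ.* sgn L) (sym (*-identityˡ (dOf L)))))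
    (ℤ∣.∣n⇒∣m*n -1ℤ (Divides⇒product hs (h 1 (s≤s z≤n))))
  where
  lemma : ∀ p x y d s → -1ℤ ℤ.* (x ℤ.* (p ℤ.* 0ℤ ℤ.+ -1ℤ) ℤ.* d ℤ.- y ℤ.* (p ℤ.* 0ℤ ℤ.+ -1ℤ) ℤ.* s) ≡ x ℤ.* d ℤ.- y ℤ.* s
  lemma = solve-∀
Divides⇒product {L = (p , _) ∷ L} {x} {y} (full ∷ hs) h =
  ∣-resp (trans (lemma (+ p) x y (+ dOf L) (sgn L)) (cong (λ e → x ℤ.* e ℤ.- y ℤ.* (ℤ.- sgn L)) (sym (+[p*m] p (dOf L)))))
    (Divides⇒product hs (h 0 z≤n))
  where
  lemma : ∀ p x y d s → x ℤ.* (p ℤ.* 1ℤ ℤ.+ 0ℤ) ℤ.* d ℤ.- y ℤ.* (-1ℤ ℤ.* 1ℤ ℤ.+ (p ℤ.* 0ℤ ℤ.+ 0ℤ)) ℤ.* s ≡ x ℤ.* (p ℤ.* d) ℤ.- y ℤ.* (ℤ.- s)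
  lemma = solve-∀

SquareIsOne-≡ : ∀ {n y y′} → (∀ x → + n ∣ᶻ x ℤ.* y → + n ∣ᶻ x ℤ.* y′) → ∀ {l} → SquareIsOne n y l → SquareIsOne n y′ l
SquareIsOne-≡ f {p , absent _} _ = tt
SquareIsOne-≡ f {p , full _}   h = f (+ p ℤ.* + p ℤ.- 1ℤ) h
SquareIsOne-≡ f {p , mid _ _}  _ = tt

-- At a full prime the combination (position 0) + p · (position 1) annihilates the column (p, -1) of
-- `A` and turns the column (-1, p) of `B` into p² - 1.
Divides⇒squares : ∀ {n L x y} → All (Thin ∘ proj₂) L → Divides n L x y → All (SquareIsOne n y) L
Divides⇒squares [] h = []
Divides⇒squares {n} {L = (p , _) ∷ L} {x} {y} (absent ∷ hs) h =
  tt ∷ All.map (λ {l} → SquareIsOne-≡ (λ x h′ → ∣-resp (lemma x y (+ p)) (ℤ∣.∣n⇒∣m*n -1ℤ h′)) {l}) (Divides⇒squares hs (h 1 (s≤s z≤n)))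
  where
  lemma : ∀ x y p → -1ℤ ℤ.* (x ℤ.* (y ℤ.* (p ℤ.* 0ℤ ℤ.+ -1ℤ))) ≡ x ℤ.* y
  lemma = solve-∀
Divides⇒squares {n} {L = (p , _) ∷ L} {x} {y} (full ∷ hs) h =
  ∣-resp (ℤₚ.*-comm y _) (Divides-0ˡ L (Divides-≡ L (lemmaA x (+ p)) (lemmaB y (+ p)) (Divides-lin L 1ℤ (+ p) (h 0 z≤n) (h 1 (s≤s z≤n)))))
  ∷ All.map (λ {l} → SquareIsOne-≡ (λ x h′ → ∣-resp (lemma x y (+ p)) (ℤ∣.∣n⇒∣m*n -1ℤ h′)) {l}) (Divides⇒squares hs (h 0 z≤n))
  where
  lemmaA : ∀ x p → 1ℤ ℤ.* (x ℤ.* (p ℤ.* 1ℤ ℤ.+ 0ℤ)) ℤ.+ p ℤ.* (x ℤ.* (p ℤ.* 0ℤ ℤ.+ -1ℤ)) ≡ 0ℤ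
  lemmaA = solve-∀
  lemmaB : ∀ y p → 1ℤ ℤ.* (y ℤ.* (-1ℤ ℤ.+ (p ℤ.* 0ℤ ℤ.+ 0ℤ))) ℤ.+ p ℤ.* (y ℤ.* (0ℤ ℤ.+ (p ℤ.* 1ℤ ℤ.+ 0ℤ))) ≡ y ℤ.* (p ℤ.* p ℤ.- 1ℤ)
  lemmaB = solve-∀
  lemma : ∀ x y p → -1ℤ ℤ.* (x ℤ.* (y ℤ.* (-1ℤ ℤ.+ (p ℤ.* 0ℤ ℤ.+ 0ℤ)))) ≡ x ℤ.* y
  lemma = solve-∀

-- Modulo n each p is its own inverse, so B_p = -p A_p entrywise.
product⇒Divides : ∀ {n L x y} → All (Thin ∘ proj₂) L → All (SquareIsOne n 1ℤ) L →
                  + n ∣ᶻ x ℤ.* + dOf L ℤ.- y ℤ.* sgn L → Divides n L x y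
product⇒Divides {x = x} {y} [] [] h = ∣-resp (lemma x y) h
  where
  lemma : ∀ x y → x ℤ.* 1ℤ ℤ.- y ℤ.* 1ℤ ≡ x ℤ.- y
  lemma = solve-∀
product⇒Divides {n} {L = (p , _) ∷ L} {x} {y} (absent ∷ hs) (_ ∷ us) h i _ =
  product⇒Divides hs us (∣-resp (lemma c x y (+ dOf L) (sgn L)) (ℤ∣.∣n⇒∣m*n c
    (subst (λ e → + n ∣ᶻ x ℤ.* + e ℤ.- y ℤ.* sgn L) (*-identityˡ (dOf L)) h)))
  where
  c = A p (absent 0) i
  lemma : ∀ c x y d s → c ℤ.* (x ℤ.* d ℤ.- y ℤ.* s) ≡ x ℤ.* c ℤ.* d ℤ.- y ℤ.* c ℤ.* s
  lemma = solve-∀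
product⇒Divides {n} {L = (p , _) ∷ L} {x} {y} (full ∷ hs) (u ∷ us) h = go
  where
  h′ : + n ∣ᶻ x ℤ.* (+ p ℤ.* + dOf L) ℤ.- y ℤ.* (ℤ.- sgn L)
  h′ = subst (λ e → + n ∣ᶻ x ℤ.* e ℤ.- y ℤ.* (ℤ.- sgn L)) (+[p*m] p (dOf L)) h
  lemma₀ : ∀ p x y d s → x ℤ.* (p ℤ.* d) ℤ.- y ℤ.* (ℤ.- s) ≡ x ℤ.* (p ℤ.* 1ℤ ℤ.+ 0ℤ) ℤ.* d ℤ.- y ℤ.* (-1ℤ ℤ.+ (p ℤ.* 0ℤ ℤ.+ 0ℤ)) ℤ.* s
  lemma₀ = solve-∀
  lemma₁ : ∀ p x y d s → (ℤ.- p) ℤ.* (x ℤ.* (p ℤ.* d) ℤ.- y ℤ.* (ℤ.- s)) ℤ.+ (x ℤ.* d) ℤ.* ((p ℤ.* p ℤ.- 1ℤ) ℤ.* 1ℤ)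
    ≡ x ℤ.* (p ℤ.* 0ℤ ℤ.+ -1ℤ) ℤ.* d ℤ.- y ℤ.* (0ℤ ℤ.+ (p ℤ.* 1ℤ ℤ.+ 0ℤ)) ℤ.* s
  lemma₁ = solve-∀
  go : ∀ i → i ≤ 1 → Divides n L (x ℤ.* A p (full 0) i) (y ℤ.* B p (full 0) i)
  go 0 _ = product⇒Divides hs us (∣-resp (lemma₀ (+ p) x y (+ dOf L) (sgn L)) h′)
  go 1 _ = product⇒Divides hs us (∣-resp (lemma₁ (+ p) x y (+ dOf L) (sgn L)) (∣-lin (ℤ.- + p) (x ℤ.* + dOf L) h′ u))
  go (suc (suc i)) (s≤s ())

-- Valuations and the factorisation of N and d into local data.

prime>1 : ∀ {p} → Prime p → 2 ≤ p
prime>1 {0} pp = contradiction pp ¬prime[0]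
prime>1 {1} pp = contradiction pp ¬prime[1]
prime>1 {suc (suc p)} pp = s≤s (s≤s z≤n)

^≢0 : ∀ {p} → Prime p → ∀ k → NonZero (p ^ k)
^≢0 {p} pp k = m^n≢0 p k {{prime⇒nonZero pp}}

∤⇒≢0 : ∀ {p m} → ¬ p ∣ m → NonZero m
∤⇒≢0 {p} {zero}  p∤m = contradiction (p ∣.∣0) p∤m
∤⇒≢0 {p} {suc m} p∤m = _

^-∣ : ∀ p {i j} → i ≤ j → p ^ i ∣ p ^ j
^-∣ p {i} {j} i≤j = subst (λ e → p ^ i ∣ p ^ e) (m+[n∸m]≡n i≤j)
  (subst (p ^ i ∣_) (sym (^-distribˡ-+-* p i (j ∸ i))) (∣.m∣m*n (p ^ (j ∸ i))))

pow-∣⇒≤ : ∀ {p m} j k → Prime p → ¬ p ∣ m → p ^ j ∣ p ^ k * m → j ≤ k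
pow-∣⇒≤ {p} {m} j k pp p∤m h with j ≤? k
... | yes j≤k = j≤k
... | no  j≰k = contradiction
  (∣.*-cancelˡ-∣ (p ^ k) {{^≢0 pp k}}
    (∣.∣-trans (subst (_∣ p ^ j) (*-comm p (p ^ k)) (^-∣ p (≰⇒> j≰k))) h)) p∤m

valUpTo-≡ : ∀ {p n} b k → k ≤ b → p ^ k ∣ n → (∀ j → p ^ j ∣ n → j ≤ k) → valUpTo p n b ≡ k
valUpTo-≡ zero    zero k≤b h max = refl
valUpTo-≡ {p} {n} (suc b) k k≤b h max with p ^ suc b ∣? n
... | yes h′ = ≤-antisym (max (suc b) h′) k≤b
... | no  ¬h with m≤n⇒m<n∨m≡n k≤b
...   | inj₁ (s≤s k≤b′) = valUpTo-≡ b k k≤b′ h max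
...   | inj₂ refl       = contradiction h ¬h

val-≡ : ∀ {p m} k → Prime p → ¬ p ∣ m → val p (p ^ k * m) ≡ k
val-≡ {p} {m} k pp p∤m = valUpTo-≡ (p ^ k * m) k k≤n (∣.m∣m*n m) (λ j → pow-∣⇒≤ j k pp p∤m)
  where
  k≤n : k ≤ p ^ k * m
  k≤n = ≤-trans (r≤2^r*m k m {{∤⇒≢0 p∤m}}) (*-monoˡ-≤ m (^-monoˡ-≤ k (prime>1 pp)))

exact-power : ∀ {p n} → Prime p → .{{NonZero n}} → ∃ λ k → ∃ λ m → n ≡ p ^ k * m × ¬ p ∣ m
exact-power {p} {n} pp = go n n ≤-refl
  where
  go : ∀ fuel n → n ≤ fuel → .{{NonZero n}} → ∃ λ k → ∃ λ m → n ≡ p ^ k * m × ¬ p ∣ m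
  go zero (suc n) ()
  go (suc fuel) n n≤ with p ∣? n
  ... | no  p∤n = 0 , n , sym (*-identityˡ n) , p∤n
  ... | yes p∣n@(divides q refl) with go fuel q (≤-pred (≤-trans q<n n≤)) {{q≢0}}
    where
    q≢0 : NonZero q
    q≢0 = m*n≢0⇒m≢0 q
    q<n : q < q * p
    q<n = m<m*n q p {{q≢0}} (prime>1 pp)
  ...   | k , m , refl , p∤m = suc k , m , trans (*-comm (p ^ k * m) p) (sym (*-assoc p (p ^ k) m)) , p∤m

val-split : ∀ {p n} → Prime p → .{{NonZero n}} → ∃ λ m → n ≡ p ^ val p n * m × ¬ p ∣ m
val-split {p} {n} pp with exact-power {p} {n} pp
... | k , m , refl , p∤m rewrite val-≡ k pp p∤m = m , refl , p∤m

∤-* : ∀ {p m n} → Prime p → ¬ p ∣ m → ¬ p ∣ n → ¬ p ∣ m * n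
∤-* pp p∤m p∤n h with euclidsLemma _ _ pp h
... | inj₁ p∣m = p∤m p∣m
... | inj₂ p∣n = p∤n p∣n

∤-^ : ∀ {p q} → Prime p → Prime q → p ≢ q → ∀ k → ¬ p ∣ q ^ k
∤-^ pp pq p≢q zero    h = contradiction (subst Prime (∣.∣1⇒≡1 h) pp) ¬prime[1]
∤-^ pp pq p≢q (suc k) h = ∤-* pp (p≢q ∘ prime-∣⇒≡ pp pq) (∤-^ pp pq p≢q k) h

val-skip : ∀ {p q n} → Prime p → Prime q → q ≢ p → .{{NonZero n}} → ∀ i → val q (p ^ i * n) ≡ val q n
val-skip {p} {q} {n} pp pq q≢p i with exact-power {q} {n} pq
... | k , m , refl , q∤m =
  trans (cong (val q) (swap-* (p ^ i) (q ^ k) m))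
    (trans (val-≡ k pq (∤-* pq (∤-^ pq pp q≢p i) q∤m)) (sym (val-≡ k pq q∤m)))
  where
  swap-* : ∀ a b c → a * (b * c) ≡ b * (a * c)
  swap-* = ℕR.solve-∀

Apart : ℕ → List Loc → Set
Apart p L = All (p ≢_) (map proj₁ L)

∤-power : ∀ {p L} e → Prime p → Apart p L → All (Prime ∘ proj₁) L → ¬ p ∣ power e L
∤-power e pp [] [] h = contradiction (subst Prime (∣.∣1⇒≡1 h) pp) ¬prime[1]
∤-power {L = (q , s) ∷ L} e pp (p≢q ∷ ap) (pq ∷ pL) = ∤-* pp (∤-^ pp pq p≢q (e s)) (∤-power e pp ap pL)

power≢0 : ∀ {L} e → All (Prime ∘ proj₁) L → NonZero (power e L)
power≢0 e [] = _
power≢0 {(q , s) ∷ L} e (pq ∷ pL) = m*n≢0 (q ^ e s) (power e L) {{^≢0 pq (e s)}} {{power≢0 e pL}}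

power-↭ : ∀ {L L′} e → L ↭ L′ → power e L ≡ power e L′
power-↭ e Perm.refl = refl
power-↭ e (prep (p , s) π) = cong (p ^ e s *_) (power-↭ e π)
power-↭ {L′ = _ ∷ _ ∷ L′} e (swap (p , s) (q , t) π) =
  trans (cong (λ x → p ^ e s * (q ^ e t * x)) (power-↭ e π)) (ℕ*.x∙yz≈y∙xz (p ^ e s) (q ^ e t) (power e L′))
power-↭ e (Perm.trans π ρ) = trans (power-↭ e π) (power-↭ e ρ)

∈⇒↭ : ∀ {X : Set} {x : X} {xs} → x ∈ xs → ∃ λ ys → xs ↭ x ∷ ys
∈⇒↭ {x = x} x∈xs with ∈ₚ.∈-∃++ x∈xs
... | as , bs , refl = as ++ bs , ↭ₚ.shift x as bs

val-power : ∀ {p s L} e → WF L → (p , s) ∈ L → val p (power e L) ≡ e s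
val-power {p} {s} e wf l∈L with ∈⇒↭ l∈L
... | L′ , π with WF-↭ π wf
...   | ap ∷ _ , pp ∷ pL = trans (cong (val p) (power-↭ e π)) (val-≡ (e s) pp (∤-power e pp ap pL))

prime-∣-power : ∀ {q L} e → Prime q → All (Prime ∘ proj₁) L → q ∣ power e L → ∃ λ s → (q , s) ∈ L × e s ≢ 0
prime-∣-power e pq [] h = contradiction (subst Prime (∣.∣1⇒≡1 h) pq) ¬prime[1]
prime-∣-power {q} {(p , s) ∷ L} e pq (pp ∷ pL) h with euclidsLemma (p ^ e s) _ pq h
... | inj₂ h′ with prime-∣-power e pq pL h′
...   | t , t∈L , et≢0 = t , there t∈L , et≢0
prime-∣-power {q} {(p , s) ∷ L} e pq (pp ∷ pL) h | inj₁ h′ with q ≟ p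
... | no  q≢p  = contradiction h′ (∤-^ pq pp q≢p (e s))
... | yes refl = s , here refl , λ es≡0 → contradiction
  (subst Prime (∣.∣1⇒≡1 (subst (λ k → q ∣ q ^ k) es≡0 h′)) pq) ¬prime[1]

∈⇒∣power : ∀ {p s L} e → (p , s) ∈ L → p ^ e s ∣ power e L
∈⇒∣power {p} {s} {L} e l∈L with ∈⇒↭ l∈L
... | L′ , π = subst (p ^ e s ∣_) (sym (power-↭ e π)) (∣.m∣m*n (power e L′))

p∣p^k : ∀ p {k} → k ≢ 0 → p ∣ p ^ k
p∣p^k p {zero}  k≢0 = contradiction refl k≢0
p∣p^k p {suc k} k≢0 = ∣.m∣m*n (p ^ k)

rExp≢0 : ∀ s → rExp s ≢ 0
rExp≢0 (absent r′) ()
rExp≢0 (full r′) ()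
rExp≢0 (mid f′ k) ()

range-unique : ∀ n → Unique (range n)
range-unique n = Uniqueₚ.applyUpTo⁺₁ suc n (λ i<j _ e → <⇒≢ i<j (suc-injective e))

∈-range : ∀ {k n} → .{{NonZero k}} → k ≤ n → k ∈ range n
∈-range {suc k} k≤n = ∈ₚ.∈-applyUpTo⁺ suc k≤n

∈-primeDivisors⁺ : ∀ {p n} → .{{NonZero n}} → Prime p → p ∣ n → p ∈ primeDivisors n
∈-primeDivisors⁺ {p} {n} pp p∣n =
  ∈ₚ.∈-filter⁺ (λ p → prime? p ×-dec (p ∣? n)) (∈-range {{prime⇒nonZero pp}} (∣.∣⇒≤ p∣n)) (pp , p∣n)

∈-primeDivisors⁻ : ∀ {p n} → p ∈ primeDivisors n → Prime p × p ∣ n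
∈-primeDivisors⁻ {p} {n} p∈ = proj₂ (∈ₚ.∈-filter⁻ (λ p → prime? p ×-dec (p ∣? n)) {xs = range n} p∈)

primeDivisors-unique : ∀ n → Unique (primeDivisors n)
primeDivisors-unique n = Uniqueₚ.filter⁺ (λ p → prime? p ×-dec (p ∣? n)) (range-unique n)

∈-divisors⁺ : ∀ {m n} → .{{NonZero n}} → m ∣ n → m ∈ divisors n
∈-divisors⁺ {zero}  {suc n} m∣n with () ← ∣.0∣⇒≡0 m∣n
∈-divisors⁺ {suc m} {n} m∣n = ∈ₚ.∈-filter⁺ (_∣? n) (∈-range (∣.∣⇒≤ m∣n)) m∣n

∈-divisors⁻ : ∀ {m n} → m ∈ divisors n → m ∣ n
∈-divisors⁻ {m} {n} m∈ = proj₂ (∈ₚ.∈-filter⁻ (_∣? n) {xs = range n} m∈)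

divisors-unique : ∀ n → Unique (divisors n)
divisors-unique n = Uniqueₚ.filter⁺ (_∣? n) (range-unique n)

unique-↭ : ∀ {X : Set} {xs ys : List X} → Unique xs → Unique ys →
           (∀ {x} → x ∈ xs → x ∈ ys) → (∀ {x} → x ∈ ys → x ∈ xs) → xs ↭ ys
unique-↭ uxs uys to from = ∼bag⇒↭ (unique∧set⇒bag uxs uys (mk⇔ to from))

primeDivisors-↭ : ∀ {L} → WF L → primeDivisors (NOf L) ↭ map proj₁ L
primeDivisors-↭ {L} (u , pL) = unique-↭ (primeDivisors-unique (NOf L)) u to from
  where
  to : ∀ {p} → p ∈ primeDivisors (NOf L) → p ∈ map proj₁ L
  to p∈ with ∈-primeDivisors⁻ {n = NOf L} p∈
  ... | pp , p∣N with prime-∣-power rExp pp pL p∣N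
  ...   | s , l∈L , _ = ∈ₚ.∈-map⁺ proj₁ l∈L
  from : ∀ {p} → p ∈ map proj₁ L → p ∈ primeDivisors (NOf L)
  from p∈ with ∈ₚ.∈-map⁻ proj₁ p∈
  ... | (p , s) , l∈L , refl =
    ∈-primeDivisors⁺ {{power≢0 rExp pL}} (All.lookup pL l∈L)
      (∣.∣-trans (p∣p^k p (rExp≢0 s)) (∈⇒∣power rExp l∈L))

prime-divisor : ∀ n → .{{NonZero n}} → n ≢ 1 → ∃ λ p → Prime p × p ∣ n
prime-divisor n n≢1 with Fact.factorise n
... | record { factors = [] ; isFactorisation = eq } = contradiction eq n≢1
... | record { factors = p ∷ ps ; isFactorisation = refl ; factorsPrime = pp ∷ _ } = p , pp , ∣.m∣m*n (product ps)

-- The list may also contain primes that do not divide n; they contribute p ^ 0. This is what allows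
-- d to be expanded over the prime divisors of N.
∏-val : ∀ n → .{{NonZero n}} → ∀ ps → Unique ps → All Prime ps → (∀ {q} → Prime q → q ∣ n → q ∈ ps) →
        n ≡ product (map (λ p → p ^ val p n) ps)
∏-val n [] u pps h with n ≟ 1
... | yes n≡1 = n≡1
... | no  n≢1 with prime-divisor n n≢1
...   | p , pp , p∣n with () ← h pp p∣n
∏-val n (p ∷ ps) (ap ∷ u) (pp ∷ pps) h with val-split {p} {n} pp
... | m , n≡ , p∤m = trans n≡ (cong (p ^ val p n *_)
        (trans (∏-val m {{m≢0}} ps u pps h′) (cong product (Listₚ.map-cong-local (All.tabulate same)))))
  where
  instance m≢0 = ∤⇒≢0 p∤m
  h′ : ∀ {q} → Prime q → q ∣ m → q ∈ ps
  h′ pq q∣m with h pq (subst (_ ∣_) (sym n≡) (∣.∣n⇒∣m*n (p ^ val p n) q∣m))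
  ... | here refl  = contradiction q∣m p∤m
  ... | there q∈ps = q∈ps
  same : ∀ {q} → q ∈ ps → q ^ val q m ≡ q ^ val q n
  same {q} q∈ps = cong (q ^_) (sym (trans (cong (val q) n≡)
    (val-skip pp (All.lookup pps q∈ps) (λ q≡p → All.lookup ap q∈ps (sym q≡p)) (val p n))))

shape : ∀ r f → r ≢ 0 → f ≤ r → ∃ λ s → rExp s ≡ r × fExp s ≡ f
shape zero    _       r≢0 _ = contradiction refl r≢0
shape (suc r) zero    _   _ = absent r , refl , refl
shape (suc r) (suc f) _   f≤r with m≤n⇒m<n∨m≡n f≤r
... | inj₂ refl = full f , refl , refl
... | inj₁ f<r  = mid f (r ∸ suc f) , trans (+-suc (suc f) (r ∸ suc f)) (cong suc (m+[n∸m]≡n (≤-pred f<r))) , refl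

pow∣⇒≤val : ∀ {p n} k → Prime p → .{{NonZero n}} → p ^ k ∣ n → k ≤ val p n
pow∣⇒≤val {p} {n} k pp h with val-split {p} {n} pp
... | m , n≡ , p∤m = pow-∣⇒≤ k (val p n) pp p∤m (subst (p ^ k ∣_) n≡ h)

pow-val-∣ : ∀ {p n} → Prime p → .{{NonZero n}} → p ^ val p n ∣ n
pow-val-∣ {p} {n} pp with val-split {p} {n} pp
... | m , n≡ , p∤m = subst (p ^ val p n ∣_) (sym n≡) (∣.m∣m*n m)

local-data : ∀ N d → .{{NonZero N}} → d ∣ N → ∃ λ L → WF L × N ≡ NOf L × d ≡ dOf L
local-data N d d∣N with build (primeDivisors N) (primeDivisors-unique N) (All.tabulate (∈-primeDivisors⁻ {n = N}))
  where
  instance d≢0 = ≢-nonZero {d} λ d≡0 → ≢-nonZero⁻¹ N (∣.0∣⇒≡0 (subst (_∣ N) d≡0 d∣N))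
  build : ∀ ps → Unique ps → All (λ p → Prime p × p ∣ N) ps → ∃ λ L → map proj₁ L ≡ ps ×
          NOf L ≡ product (map (λ p → p ^ val p N) ps) × dOf L ≡ product (map (λ p → p ^ val p d) ps)
  build [] u h = [] , refl , refl , refl
  build (p ∷ ps) (_ ∷ u) ((pp , p∣N) ∷ h) with build ps u h
    | shape (val p N) (val p d) (λ e → contradiction (pow∣⇒≤val 1 pp (subst (_∣ N) (sym (*-identityʳ p)) p∣N))
        (subst (λ v → ¬ 1 ≤ v) (sym e) λ ()))
        (pow∣⇒≤val (val p d) pp (∣.∣-trans (pow-val-∣ pp) d∣N))
  ... | L , refl , eN , ed | s , er , ef =
    (p , s) ∷ L , refl , cong₂ (λ r x → p ^ r * x) er eN , cong₂ (λ f x → p ^ f * x) ef ed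
... | L , eL , eN , ed =
  L , (subst Unique (sym eL) u , Allₚ.map⁻ (subst (All Prime) (sym eL) pps))
  , trans (∏-val N _ u pps (∈-primeDivisors⁺ {n = N})) (sym eN)
  , trans (∏-val d {{d≢0}} _ u pps (λ pq q∣d → ∈-primeDivisors⁺ {n = N} pq (∣.∣-trans q∣d d∣N))) (sym ed)
  where
  d≢0 = ≢-nonZero {d} λ d≡0 → ≢-nonZero⁻¹ N (∣.0∣⇒≡0 (subst (_∣ N) d≡0 d∣N))
  u = primeDivisors-unique N
  pps = All.map proj₁ (All.tabulate (∈-primeDivisors⁻ {n = N}))

-- Enumeration of the divisors of N by exponents.

block : ℕ → ℕ → List ℕ → List ℕ
block p zero    D = map (p ^ 0 *_) D
block p (suc k) D = map (p ^ suc k *_) D ++ block p k D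

divs : List Loc → List ℕ
divs []            = 1 ∷ []
divs ((p , s) ∷ L) = block p (rExp s) (divs L)

∈-block⁺ : ∀ {p D δ} i k → i ≤ k → δ ∈ D → p ^ i * δ ∈ block p k D
∈-block⁺ {p} {D} zero zero _ δ∈D = ∈ₚ.∈-map⁺ (p ^ 0 *_) δ∈D
∈-block⁺ {p} {D} i (suc k) i≤k δ∈D with m≤n⇒m<n∨m≡n i≤k
... | inj₁ (s≤s i≤k′) = ∈ₚ.∈-++⁺ʳ (map (p ^ suc k *_) D) (∈-block⁺ i k i≤k′ δ∈D)
... | inj₂ refl       = ∈ₚ.∈-++⁺ˡ (∈ₚ.∈-map⁺ (p ^ suc k *_) δ∈D)

∈-block⁻ : ∀ {p D x} k → x ∈ block p k D → ∃ λ i → ∃ λ δ → i ≤ k × δ ∈ D × x ≡ p ^ i * δ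
∈-block⁻ {p} {D} zero x∈ with ∈ₚ.∈-map⁻ (p ^ 0 *_) x∈
... | δ , δ∈D , x≡ = 0 , δ , z≤n , δ∈D , x≡
∈-block⁻ {p} {D} (suc k) x∈ with ∈ₚ.∈-++⁻ (map (p ^ suc k *_) D) x∈
... | inj₁ x∈₁ with ∈ₚ.∈-map⁻ (p ^ suc k *_) x∈₁
...   | δ , δ∈D , x≡ = suc k , δ , ≤-refl , δ∈D , x≡
∈-block⁻ {p} {D} (suc k) x∈ | inj₂ x∈₂ with ∈-block⁻ k x∈₂
... | i , δ , i≤k , δ∈D , x≡ = i , δ , m≤n⇒m≤1+n i≤k , δ∈D , x≡

divs-∣ : ∀ L {δ} → δ ∈ divs L → δ ∣ NOf L
divs-∣ [] (here refl) = ∣.∣-refl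
divs-∣ ((p , s) ∷ L) δ∈ with ∈-block⁻ (rExp s) δ∈
... | i , δ , i≤r , δ∈D , refl = ∣.*-pres-∣ (^-∣ p i≤r) (divs-∣ L δ∈D)

coprime-to-power : ∀ {p m n} k → Prime p → ¬ p ∣ m → m ∣ p ^ k * n → m ∣ n
coprime-to-power {n = n} zero pp p∤m h = subst (_ ∣_) (*-identityˡ n) h
coprime-to-power {p} {m} {n} (suc k) pp p∤m h =
  coprime-to-power k pp p∤m (Coprimality.coprime-divisor {m} {p} coprime (subst (m ∣_) (*-assoc p (p ^ k) n) h))
  where
  coprime : Coprimality.Coprime m p
  coprime (d∣m , d∣p) with prime⇒irreducible pp d∣p
  ... | inj₁ d≡1  = d≡1
  ... | inj₂ refl = contradiction d∣m p∤m

∣-divs : ∀ L {δ} → WF L → δ ∣ NOf L → δ ∈ divs L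
∣-divs [] wf δ∣1 = here (∣.∣1⇒≡1 δ∣1)
∣-divs ((p , s) ∷ L) {δ} wf@(ap ∷ _ , pp ∷ pL) δ∣N with exact-power {p} {δ} pp {{δ≢0}}
  where
  δ≢0 = ≢-nonZero {δ} λ δ≡0 → ≢-nonZero⁻¹ (NOf ((p , s) ∷ L)) {{power≢0 {(p , s) ∷ L} rExp (pp ∷ pL)}}
      (∣.0∣⇒≡0 (subst (_∣ NOf ((p , s) ∷ L)) δ≡0 δ∣N))
... | i , m , refl , p∤m = ∈-block⁺ i (rExp s)
  (pow-∣⇒≤ i (rExp s) pp (∤-power rExp pp ap pL) (∣.m*n∣⇒m∣ (p ^ i) m δ∣N))
  (∣-divs L (WF-tail wf) (coprime-to-power (rExp s) pp p∤m (∣.m*n∣⇒n∣ (p ^ i) m δ∣N)))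

divs-unique : ∀ L → WF L → Unique (divs L)
divs-unique [] wf = [] ∷ []
divs-unique ((p , s) ∷ L) wf@(ap ∷ _ , pp ∷ pL) = go (rExp s)
  where
  D = divs L
  p∤D : ∀ {δ} → δ ∈ D → ¬ p ∣ δ
  p∤D δ∈D p∣δ = ∤-power rExp pp ap pL (∣.∣-trans p∣δ (divs-∣ L δ∈D))
  unique-map : ∀ k → Unique (map (p ^ k *_) D)
  unique-map k = Uniqueₚ.map⁺ (λ {x} {y} → *-cancelˡ-≡ x y (p ^ k) {{^≢0 pp k}}) (divs-unique L (WF-tail wf))
  go : ∀ k → Unique (block p k D)
  go zero    = unique-map 0
  go (suc k) = Uniqueₚ.++⁺ (unique-map (suc k)) (go k) disjoint
    where
    disjoint : ∀ {x} → x ∈ map (p ^ suc k *_) D × x ∈ block p k D → ⊥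
    disjoint (x∈₁ , x∈₂) with ∈ₚ.∈-map⁻ (p ^ suc k *_) x∈₁ | ∈-block⁻ k x∈₂
    ... | δ , _ , refl | i , δ′ , i≤k , δ′∈D , eq =
      <⇒≱ (s≤s i≤k) (pow-∣⇒≤ (suc k) i pp (p∤D δ′∈D) (subst (p ^ suc k ∣_) eq (∣.m∣m*n δ)))

-- `divisors` is a filtered range with no product structure. Both lists are free of repetitions and
-- have the same members, so sums may be taken over `divs`, where they factor.
divisors-↭ : ∀ {L} → WF L → divisors (NOf L) ↭ divs L
divisors-↭ {L} wf = unique-↭ (divisors-unique (NOf L)) (divs-unique L wf)
  (λ δ∈ → ∣-divs L wf (∈-divisors⁻ {n = NOf L} δ∈))
  (λ δ∈ → ∈-divisors⁺ {{power≢0 rExp (proj₂ wf)}} (divs-∣ L δ∈))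

sumℤ-↭ : ∀ {X : Set} (F : X → ℤ) {xs ys} → xs ↭ ys → sumℤ (map F xs) ≡ sumℤ (map F ys)
sumℤ-↭ F Perm.refl = refl
sumℤ-↭ F (prep x π) = cong (λ z → F x ℤ.+ z) (sumℤ-↭ F π)
sumℤ-↭ F {ys = _ ∷ _ ∷ ys} (swap x y π) = trans (cong (λ z → F x ℤ.+ (F y ℤ.+ z)) (sumℤ-↭ F π)) (ℤ+.x∙yz≈y∙xz (F x) (F y) (sumℤ (map F ys)))
sumℤ-↭ F (Perm.trans π ρ) = trans (sumℤ-↭ F π) (sumℤ-↭ F ρ)

productℤ-↭ : ∀ {X : Set} (F : X → ℤ) {xs ys} → xs ↭ ys → productℤ (map F xs) ≡ productℤ (map F ys)
productℤ-↭ F Perm.refl = refl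
productℤ-↭ F (prep x π) = cong (F x ℤ.*_) (productℤ-↭ F π)
productℤ-↭ F {ys = _ ∷ _ ∷ ys} (swap x y π) = trans (cong (λ z → F x ℤ.* (F y ℤ.* z)) (productℤ-↭ F π))
    (ℤ*.x∙yz≈y∙xz (F x) (F y) (productℤ (map F ys)))
productℤ-↭ F (Perm.trans π ρ) = trans (productℤ-↭ F π) (productℤ-↭ F ρ)

sumℤ-++ : ∀ xs ys → sumℤ (xs ++ ys) ≡ sumℤ xs ℤ.+ sumℤ ys
sumℤ-++ [] ys = sym (ℤₚ.+-identityˡ _)
sumℤ-++ (x ∷ xs) ys = trans (cong (λ z → x ℤ.+ z) (sumℤ-++ xs ys)) (sym (ℤₚ.+-assoc x _ _))

sumℤ-scale : ∀ c xs → sumℤ (map (c ℤ.*_) xs) ≡ c ℤ.* sumℤ xs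
sumℤ-scale c [] = sym (ℤₚ.*-zeroʳ c)
sumℤ-scale c (x ∷ xs) = trans (cong (λ z → c ℤ.* x ℤ.+ z) (sumℤ-scale c xs)) (sym (ℤₚ.*-distribˡ-+ c x _))

-- Sums of tensor products over the divisors.

Weights : Set
Weights = ℕ → Shape → ℕ → ℤ

tensor : Weights → List Loc → ℕ → ℤ
tensor u []            δ = 1ℤ
tensor u ((p , s) ∷ L) δ = u p s (val p δ) ℤ.* tensor u L δ

∑[≤_] : ℕ → (ℕ → ℤ) → ℤ
∑[≤ zero ]  f = f 0
∑[≤ suc k ] f = f (suc k) ℤ.+ ∑[≤ k ] f

∏∑ : Weights → List Loc → ℤ
∏∑ u []            = 1ℤ
∏∑ u ((p , s) ∷ L) = ∑[≤ rExp s ] (u p s) ℤ.* ∏∑ u L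

tensor-skip : ∀ u L {p δ} → Prime p → Apart p L → All (Prime ∘ proj₁) L → .{{NonZero δ}} → ∀ i →
              tensor u L (p ^ i * δ) ≡ tensor u L δ
tensor-skip u [] pp ap pL i = refl
tensor-skip u ((q , s) ∷ L) pp (p≢q ∷ ap) (pq ∷ pL) i =
  cong₂ (λ v x → u q s v ℤ.* x) (val-skip pp pq (p≢q ∘ sym) i) (tensor-skip u L pp ap pL i)

divs≢0 : ∀ {L δ} → WF L → δ ∈ divs L → NonZero δ
divs≢0 {L} {δ} wf δ∈ = ≢-nonZero λ { refl → ≢-nonZero⁻¹ (NOf L) {{power≢0 rExp (proj₂ wf)}} (∣.0∣⇒≡0 (divs-∣ L δ∈)) }

tensor-cons : ∀ u {p s L δ} → WF ((p , s) ∷ L) → δ ∈ divs L → ∀ i →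
              tensor u ((p , s) ∷ L) (p ^ i * δ) ≡ u p s i ℤ.* tensor u L δ
tensor-cons u {p} {s} {L} {δ} wf@(ap ∷ _ , pp ∷ pL) δ∈ i =
  cong₂ (λ v x → u p s v ℤ.* x)
    (val-≡ i pp (λ p∣δ → ∤-power rExp pp ap pL (∣.∣-trans p∣δ (divs-∣ L δ∈))))
    (tensor-skip u L pp ap pL {{divs≢0 (WF-tail wf) δ∈}} i)

-- The head weight `g` is kept apart from `u` so that a parity weight can be placed at one prime
-- while the other primes are summed plainly.
sum-cons : ∀ (g : ℕ → ℤ) u {p s L} → WF ((p , s) ∷ L) →
           sumℤ (map (λ δ → g (val p δ) ℤ.* tensor u L δ) (divs ((p , s) ∷ L))) ≡
           ∑[≤ rExp s ] g ℤ.* sumℤ (map (tensor u L) (divs L))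
sum-cons g u {p} {s} {L} wf@(ap ∷ _ , pp ∷ pL) = go (rExp s)
  where
  D = divs L
  S = sumℤ (map (tensor u L) D)
  T = λ δ → g (val p δ) ℤ.* tensor u L δ
  T-cons : ∀ i {δ} → δ ∈ D → T (p ^ i * δ) ≡ g i ℤ.* tensor u L δ
  T-cons i δ∈D = cong₂ (λ v x → g v ℤ.* x)
    (val-≡ i pp (λ p∣δ → ∤-power rExp pp ap pL (∣.∣-trans p∣δ (divs-∣ L δ∈D))))
    (tensor-skip u L pp ap pL {{divs≢0 (WF-tail wf) δ∈D}} i)
  row : ∀ i → sumℤ (map T (map (p ^ i *_) D)) ≡ g i ℤ.* S
  row i = trans (cong sumℤ (trans (sym (Listₚ.map-∘ D))
    (trans (Listₚ.map-cong-local (All.tabulate (T-cons i))) (Listₚ.map-∘ D))))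
    (sumℤ-scale (g i) (map (tensor u L) D))
  go : ∀ k → sumℤ (map T (block p k D)) ≡ ∑[≤ k ] g ℤ.* S
  go zero    = row 0
  go (suc k) = trans (cong sumℤ (Listₚ.map-++ T (map (p ^ suc k *_) D) (block p k D)))
    (trans (sumℤ-++ (map T (map (p ^ suc k *_) D)) _)
      (trans (cong₂ ℤ._+_ (row (suc k)) (go k)) (sym (ℤₚ.*-distribʳ-+ S (g (suc k)) _))))

sum-tensor : ∀ u {L} → WF L → sumℤ (map (tensor u L) (divs L)) ≡ ∏∑ u L
sum-tensor u {[]} wf = refl
sum-tensor u {(p , s) ∷ L} wf = trans (sum-cons (u p s) u wf) (cong (∑[≤ rExp s ] (u p s) ℤ.*_) (sum-tensor u (WF-tail wf)))

Divides⇒∣tensor : ∀ {n} L {x y} → WF L → Divides n L x y →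
                  ∀ {δ} → δ ∈ divs L → + n ∣ᶻ x ℤ.* tensor A L δ ℤ.- y ℤ.* tensor B L δ
Divides⇒∣tensor [] {x} {y} wf h _ = ∣-resp (lemma x y) h
  where
  lemma : ∀ x y → x ℤ.- y ≡ x ℤ.* 1ℤ ℤ.- y ℤ.* 1ℤ
  lemma = solve-∀
Divides⇒∣tensor {n} ((p , s) ∷ L) {x} {y} wf h δ∈ with ∈-block⁻ (rExp s) δ∈
... | i , δ , i≤r , δ∈D , refl =
  subst₂ (λ a b → + n ∣ᶻ x ℤ.* a ℤ.- y ℤ.* b) (sym (tensor-cons A wf δ∈D i)) (sym (tensor-cons B wf δ∈D i))
    (∣-resp (lemma x y (A p s i) (B p s i) _ _) (Divides⇒∣tensor L (WF-tail wf) (h i i≤r) δ∈D))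
  where
  lemma : ∀ x y a b t u → x ℤ.* a ℤ.* t ℤ.- y ℤ.* b ℤ.* u ≡ x ℤ.* (a ℤ.* t) ℤ.- y ℤ.* (b ℤ.* u)
  lemma = solve-∀

∣tensor⇒Divides : ∀ {n} L {x y} → WF L →
                  (∀ {δ} → δ ∈ divs L → + n ∣ᶻ x ℤ.* tensor A L δ ℤ.- y ℤ.* tensor B L δ) → Divides n L x y
∣tensor⇒Divides [] {x} {y} wf h = ∣-resp (lemma x y) (h (here refl))
  where
  lemma : ∀ x y → x ℤ.* 1ℤ ℤ.- y ℤ.* 1ℤ ≡ x ℤ.- y
  lemma = solve-∀
∣tensor⇒Divides {n} ((p , s) ∷ L) {x} {y} wf h i i≤r = ∣tensor⇒Divides L (WF-tail wf) λ {δ} δ∈D →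
  ∣-resp (lemma x y (A p s i) (B p s i) _ _)
    (subst₂ (λ a b → + n ∣ᶻ x ℤ.* a ℤ.- y ℤ.* b) (tensor-cons A wf δ∈D i) (tensor-cons B wf δ∈D i)
      (h (∈-block⁺ i (rExp s) i≤r δ∈D)))
  where
  lemma : ∀ x y a b t u → x ℤ.* (a ℤ.* t) ℤ.- y ℤ.* (b ℤ.* u) ≡ x ℤ.* a ℤ.* t ℤ.- y ℤ.* b ℤ.* u
  lemma = solve-∀

-- Euler's function and z = gcd(d, N/d).

∑ : (ℕ → ℕ) → ℕ → ℕ
∑ f zero    = 0
∑ f (suc n) = f (suc n) + ∑ f n

∑-cong : ∀ {f g} n → (∀ k → f k ≡ g k) → ∑ f n ≡ ∑ g n
∑-cong zero    f≗g = refl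
∑-cong (suc n) f≗g = cong₂ _+_ (f≗g (suc n)) (∑-cong n f≗g)

∑-+ : ∀ f g n → ∑ (λ k → f k + g k) n ≡ ∑ f n + ∑ g n
∑-+ f g zero    = refl
∑-+ f g (suc n) = trans (cong (λ x → f (suc n) + g (suc n) + x) (∑-+ f g n)) (ℕ+.interchange (f (suc n)) (g (suc n)) (∑ f n) (∑ g n))

∑-append : ∀ f i a → ∑ f (i + a) ≡ ∑ (λ k → f (k + a)) i + ∑ f a
∑-append f zero    a = refl
∑-append f (suc i) a = trans (cong (λ x → f (suc i + a) + x) (∑-append f i a)) (sym (+-assoc (f (suc i + a)) _ _))

∑-periodic : ∀ f m → (∀ k → f (k + m) ≡ f k) → ∀ c → ∑ f (c * m) ≡ c * ∑ f m
∑-periodic f m per zero    = refl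
∑-periodic f m per (suc c) = trans (∑-append f m (c * m))
  (cong₂ _+_ (∑-cong m (λ k → per* k c)) (∑-periodic f m per c))
  where
  per* : ∀ k c → f (k + c * m) ≡ f k
  per* k zero    = cong f (+-identityʳ k)
  per* k (suc c) = trans (cong f (lemma k m (c * m))) (trans (per (k + c * m)) (per* k c))
    where
    lemma : ∀ k m x → k + (m + x) ≡ k + x + m
    lemma = ℕR.solve-∀

∑-0 : ∀ f n → (∀ k → k ≤ n → k ≢ 0 → f k ≡ 0) → ∑ f n ≡ 0
∑-0 f zero    h = refl
∑-0 f (suc n) h = cong₂ _+_ (h (suc n) ≤-refl λ ()) (∑-0 f n (λ k k≤n → h k (m≤n⇒m≤1+n k≤n)))

∑-multiples : ∀ f p → .{{NonZero p}} → (∀ k → ¬ p ∣ k → f k ≡ 0) → ∀ m → ∑ f (m * p) ≡ ∑ (λ j → f (j * p)) m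
∑-multiples f p h zero = refl
∑-multiples f p@(suc q) h (suc m) = trans (∑-append f p (m * p))
  (cong₂ _+_ (trans (cong (λ x → f (p + m * p) + x) (∑-0 (λ k → f (k + m * p)) q vanish)) (+-identityʳ _)) (∑-multiples f p h m))
  where
  vanish : ∀ k → k ≤ q → k ≢ 0 → f (k + m * p) ≡ 0
  vanish zero k≤q k≢0 = contradiction refl k≢0
  vanish k@(suc _) k≤q k≢0 = h (k + m * p) λ p∣ →
    ∣.>⇒∤ (s≤s k≤q) (∣.∣m+n∣m⇒∣n (subst (p ∣_) (+-comm k (m * p)) p∣) (∣.n∣m*n m))

indicator : ∀ {X : Set} → Dec X → ℕ
indicator x? = if does x? then 1 else 0

indicator-⇔ : ∀ {X Y : Set} (x? : Dec X) (y? : Dec Y) → (X → Y) → (Y → X) → indicator x? ≡ indicator y?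
indicator-⇔ x? y? to from = cong (λ b → if b then 1 else 0) (does-⇔ (mk⇔ to from) x? y?)

indicator-split : ∀ {X Y Z : Set} (x? : Dec X) (y? : Dec Y) (z? : Dec Z) → (X → ¬ Y) → (Y → Z) → (¬ X → Z → Y) →
                  indicator z? ≡ indicator y? + indicator (x? ×-dec z?)
indicator-split (yes x) (yes y) _       X⇒¬Y Y⇒Z Z⇒Y = contradiction y (X⇒¬Y x)
indicator-split (yes x) (no ¬y) (yes z) X⇒¬Y Y⇒Z Z⇒Y = refl
indicator-split (yes x) (no ¬y) (no ¬z) X⇒¬Y Y⇒Z Z⇒Y = refl
indicator-split (no ¬x) (yes y) (yes z) X⇒¬Y Y⇒Z Z⇒Y = refl
indicator-split (no ¬x) (yes y) (no ¬z) X⇒¬Y Y⇒Z Z⇒Y = contradiction (Y⇒Z y) ¬z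
indicator-split (no ¬x) (no ¬y) (yes z) X⇒¬Y Y⇒Z Z⇒Y = contradiction (Z⇒Y ¬x z) ¬y
indicator-split (no ¬x) (no ¬y) (no ¬z) X⇒¬Y Y⇒Z Z⇒Y = refl

length-filter : ∀ {Q : ℕ → Set} (Q? : ∀ k → Dec (Q k)) n → length (filter Q? (range n)) ≡ ∑ (indicator ∘ Q?) n
length-filter Q? zero    = refl
length-filter Q? (suc n) = trans
  (cong (length ∘ filter Q?) (sym (Listₚ.applyUpTo-∷ʳ suc n)))
  (trans (cong length (Listₚ.filter-++ Q? (range n) (suc n ∷ [])))
    (trans (Listₚ.length-++ (filter Q? (range n)))
      (trans (+-comm (length (filter Q? (range n))) _) (cong₂ _+_ single (length-filter Q? n)))))
  where
  single : length (filter Q? (suc n ∷ [])) ≡ indicator (Q? (suc n))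
  single with Q? (suc n)
  ... | yes _ = refl
  ... | no  _ = refl

coprimeTo : ℕ → ℕ → ℕ
coprimeTo n k = indicator (Coprimality.coprime? k n)

coprimeTo-periodic : ∀ m k → coprimeTo m (k + m) ≡ coprimeTo m k
coprimeTo-periodic m k = indicator-⇔ (Coprimality.coprime? (k + m) m) (Coprimality.coprime? k m)
  (λ c (d∣k , d∣m) → c (∣.∣m∣n⇒∣m+n d∣k d∣m , d∣m))
  (λ c {d} (d∣k+m , d∣m) → c (∣.∣m+n∣m⇒∣n (subst (d ∣_) (+-comm k m) d∣k+m) d∣m , d∣m))

coprime-cancel : ∀ {k m p d} → Coprimality.Coprime k m → d ∣ k → d ∣ p * m → d ∣ p
coprime-cancel {k} {m} {p} {d} c d∣k d∣pm =
  Coprimality.coprime-divisor {d} {m} (λ (e∣d , e∣m) → c (∣.∣-trans e∣d d∣k , e∣m)) (subst (d ∣_) (*-comm p m) d∣pm)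

-- When p ∣ m, coprimality to p m is the same as coprimality to m, which is periodic modulo m; the
-- range up to p m consists of p periods.
φ-∣ : ∀ {p m} → p ∣ m → φ (p * m) ≡ p * φ m
φ-∣ {p} {m} p∣m = trans (length-filter (λ k → Coprimality.coprime? k (p * m)) (p * m))
  (trans (∑-cong (p * m) same)
    (trans (∑-periodic (coprimeTo m) m (coprimeTo-periodic m) p)
      (cong (p *_) (sym (length-filter (λ k → Coprimality.coprime? k m) m)))))
  where
  same : ∀ k → coprimeTo (p * m) k ≡ coprimeTo m k
  same k = indicator-⇔ (Coprimality.coprime? k (p * m)) (Coprimality.coprime? k m)
    (λ c (d∣k , d∣m) → c (d∣k , ∣.∣n⇒∣m*n p d∣m))
    (λ c (d∣k , d∣pm) → c (d∣k , ∣.∣-trans (coprime-cancel {p = p} c d∣k d∣pm) p∣m))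

-- Up to p m there are p φ(m) numbers coprime to m. Those divisible by p are the j p with j coprime
-- to m, hence φ(m) of them, and the rest are coprime to p m.
φ-∤ : ∀ {p m} → Prime p → ¬ p ∣ m → φ (p * m) ≡ (p ∸ 1) * φ m
φ-∤ {p} {m} pp p∤m = trans (sym (m+n∸n≡m _ (φ m))) (trans (cong (_∸ φ m) total)
  (trans (cong (p * φ m ∸_) (sym (*-identityˡ (φ m)))) (sym (*-distribʳ-∸ (φ m) p 1))))
  where
  both? = λ k → (p ∣? k) ×-dec Coprimality.coprime? k m
  split : ∀ k → coprimeTo m k ≡ coprimeTo (p * m) k + indicator (both? k)
  split k = indicator-split (p ∣? k) (Coprimality.coprime? k (p * m)) (Coprimality.coprime? k m)
    (λ p∣k c → ¬prime[1] (subst Prime (c (p∣k , ∣.m∣m*n m)) pp))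
    (λ c (d∣k , d∣m) → c (d∣k , ∣.∣n⇒∣m*n p d∣m))
    coprime
    where
    coprime : ¬ p ∣ k → Coprimality.Coprime k m → Coprimality.Coprime k (p * m)
    coprime p∤k c {d} (d∣k , d∣pm) with prime⇒irreducible pp (coprime-cancel {p = p} c d∣k d∣pm)
    ... | inj₁ d≡1  = d≡1
    ... | inj₂ refl = contradiction d∣k p∤k
  multiples : ∑ (indicator ∘ both?) (p * m) ≡ φ m
  multiples = trans (cong (∑ (indicator ∘ both?)) (*-comm p m))
    (trans (∑-multiples (indicator ∘ both?) p {{prime⇒nonZero pp}} (λ k p∤k → vanish k p∤k) m)
      (trans (∑-cong m same) (sym (length-filter (λ k → Coprimality.coprime? k m) m))))
    where
    vanish : ∀ k → ¬ p ∣ k → indicator (both? k) ≡ 0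
    vanish k p∤k = cong (λ b → if b then 1 else 0) (dec-false (both? k) (p∤k ∘ proj₁))
    same : ∀ j → indicator (both? (j * p)) ≡ coprimeTo m j
    same j = indicator-⇔ (both? (j * p)) (Coprimality.coprime? j m)
      (λ (_ , c) (d∣j , d∣m) → c (∣.∣m⇒∣m*n p d∣j , d∣m))
      (λ c → ∣.n∣m*n j , λ (d∣jp , d∣m) → coprime c d∣jp d∣m)
      where
      coprime : Coprimality.Coprime j m → ∀ {d} → d ∣ j * p → d ∣ m → d ≡ 1
      coprime c {d} d∣jp d∣m with prime⇒irreducible pp
        (coprime-cancel {p = p} (Coprimality.sym c) d∣m (subst (d ∣_) (*-comm j p) d∣jp))
      ... | inj₁ d≡1  = d≡1
      ... | inj₂ refl = contradiction d∣m p∤m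
  total : φ (p * m) + φ m ≡ p * φ m
  total = trans (cong₂ _+_ (length-filter (λ k → Coprimality.coprime? k (p * m)) (p * m)) (sym multiples))
    (trans (sym (∑-+ (coprimeTo (p * m)) (indicator ∘ both?) (p * m)))
      (trans (sym (∑-cong (p * m) split))
        (trans (∑-periodic (coprimeTo m) m (coprimeTo-periodic m) p)
          (cong (p *_) (sym (length-filter (λ k → Coprimality.coprime? k m) m))))))

φ-prime-power : ∀ {p m} → Prime p → ¬ p ∣ m → ∀ k → φ (p ^ suc k * m) ≡ p ^ k * ((p ∸ 1) * φ m)
φ-prime-power {p} {m} pp p∤m zero = trans (cong (λ x → φ (x * m)) (*-identityʳ p))
  (trans (φ-∤ pp p∤m) (sym (*-identityˡ _)))
φ-prime-power {p} {m} pp p∤m (suc k) = trans (cong φ (*-assoc p (p ^ suc k) m))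
  (trans (φ-∣ {p} {p ^ suc k * m} (∣.∣m⇒∣m*n m (∣.m∣m*n (p ^ k))))
    (trans (cong (p *_) (φ-prime-power pp p∤m k)) (sym (*-assoc p (p ^ k) _))))

-- mExp is the exponent of p in z = gcd(d, N/d), and zrExp that in z / rad z.
mExp zrExp : Shape → ℕ
mExp (absent _)   = 0
mExp (full _)     = 0
mExp (mid f′ k)   = suc (f′ ⊓ k)
zrExp (absent _)  = 0
zrExp (full _)    = 0
zrExp (mid f′ k)  = f′ ⊓ k

-- This is φ(rad z), the cofactor of z / rad z in φ(z). It is the source of the factor p - 1 in the
-- `mid` case of `colA`.
totient : List Loc → ℕ
totient []                 = 1
totient ((p , mid _ _) ∷ L) = (p ∸ 1) * totient L
totient ((p , _) ∷ L)       = totient L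

φ-power : ∀ L → WF L → φ (power mExp L) ≡ power zrExp L * totient L
φ-power [] wf = refl
φ-power ((p , absent _) ∷ L) wf = trans (cong φ (*-identityˡ (power mExp L)))
  (trans (φ-power L (WF-tail wf)) (cong (_* totient L) (sym (*-identityˡ (power zrExp L)))))
φ-power ((p , full _) ∷ L) wf = trans (cong φ (*-identityˡ (power mExp L)))
  (trans (φ-power L (WF-tail wf)) (cong (_* totient L) (sym (*-identityˡ (power zrExp L)))))
φ-power ((p , mid f′ k) ∷ L) wf@(ap ∷ _ , pp ∷ pL) =
  trans (φ-prime-power pp (∤-power mExp pp ap pL) (f′ ⊓ k))
    (trans (cong (λ x → p ^ (f′ ⊓ k) * ((p ∸ 1) * x)) (φ-power L (WF-tail wf))) (lemma (p ^ (f′ ⊓ k)) (p ∸ 1) (power zrExp L) (totient L)))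
  where
  lemma : ∀ a b c d → a * (b * (c * d)) ≡ a * c * (b * d)
  lemma = ℕR.solve-∀

coExp : Shape → ℕ
coExp (absent r′) = suc r′
coExp (full r′)   = 0
coExp (mid f′ k)  = suc k

dOf*co : ∀ L → NOf L ≡ dOf L * power coExp L
dOf*co [] = refl
dOf*co ((p , s) ∷ L) = trans (cong₂ _*_ (trans (cong (p ^_) (local s)) (^-distribˡ-+-* p (fExp s) (coExp s))) (dOf*co L))
  (lemma (p ^ fExp s) (p ^ coExp s) (dOf L) (power coExp L))
  where
  local : ∀ s → rExp s ≡ fExp s + coExp s
  local (absent r′) = refl
  local (full r′)   = sym (+-identityʳ (suc r′))
  local (mid f′ k)  = refl
  lemma : ∀ a b c d → a * b * (c * d) ≡ a * c * (b * d)
  lemma = ℕR.solve-∀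

÷-≡ : ∀ m n q → .{{NonZero n}} → m ≡ n * q → m ÷ n ≡ q
÷-≡ _ (suc n) q refl = trans (DM./-congˡ {o = suc n} (*-comm (suc n) q)) (DM.m*n/n≡m q (suc n))

NOf÷dOf : ∀ {L} → WF L → NOf L ÷ dOf L ≡ power coExp L
NOf÷dOf {L} wf = ÷-≡ (NOf L) (dOf L) (power coExp L) {{power≢0 fExp (proj₂ wf)}} (dOf*co L)

gcd-cancel : ∀ {p x} c y → Prime p → ¬ p ∣ x → gcd x (p ^ c * y) ≡ gcd x y
gcd-cancel {p} {x} c y pp p∤x = ∣.∣-antisym
  (gcd-greatest (gcd[m,n]∣m x _)
    (coprime-to-power c pp (λ p∣g → p∤x (∣.∣-trans p∣g (gcd[m,n]∣m x _))) (gcd[m,n]∣n x (p ^ c * y))))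
  (gcd-greatest (gcd[m,n]∣m x y) (∣.∣n⇒∣m*n (p ^ c) (gcd[m,n]∣n x y)))

^-split : ∀ p {a b} → a ≤ b → ∀ y → p ^ b * y ≡ p ^ a * (p ^ (b ∸ a) * y)
^-split p {a} {b} a≤b y = trans (cong (λ e → p ^ e * y) (sym (m+[n∸m]≡n a≤b)))
  (trans (cong (_* y) (^-distribˡ-+-* p a (b ∸ a))) (*-assoc (p ^ a) (p ^ (b ∸ a)) y))

gcd-local : ∀ {p} a b x y → Prime p → ¬ p ∣ x → ¬ p ∣ y → gcd (p ^ a * x) (p ^ b * y) ≡ p ^ (a ⊓ b) * gcd x y
gcd-local {p} a b x y pp p∤x p∤y with ≤-total a b
... | inj₁ a≤b = trans (cong (gcd (p ^ a * x)) (^-split p a≤b y))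
  (trans (sym (c*gcd[m,n]≡gcd[cm,cn] (p ^ a) x _))
    (cong₂ (λ e g → p ^ e * g) (sym (m≤n⇒m⊓n≡m a≤b)) (gcd-cancel (b ∸ a) y pp p∤x)))
... | inj₂ b≤a = trans (gcd-comm (p ^ a * x) (p ^ b * y))
  (trans (cong (gcd (p ^ b * y)) (^-split p b≤a x))
  (trans (sym (c*gcd[m,n]≡gcd[cm,cn] (p ^ b) y _))
    (cong₂ (λ e g → p ^ e * g) (sym (m≥n⇒m⊓n≡n b≤a))
      (trans (gcd-cancel (a ∸ b) x pp p∤y) (gcd-comm y x)))))

gcd-power : ∀ L → WF L → gcd (dOf L) (power coExp L) ≡ power mExp L
gcd-power [] wf = refl
gcd-power ((p , s) ∷ L) wf@(ap ∷ _ , pp ∷ pL) =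
  trans (gcd-local (fExp s) (coExp s) _ _ pp (∤-power fExp pp ap pL) (∤-power coExp pp ap pL))
    (cong₂ (λ e g → p ^ e * g) (local s) (gcd-power L (WF-tail wf)))
  where
  local : ∀ s → fExp s ⊓ coExp s ≡ mExp s
  local (absent r′) = refl
  local (full r′)   = refl
  local (mid f′ k)  = refl

z≡ : ∀ {L} → WF L → gcd (dOf L) (NOf L ÷ dOf L) ≡ power mExp L
z≡ {L} wf = trans (cong (gcd (dOf L)) (NOf÷dOf wf)) (gcd-power L wf)

-- The columns of Υ as tensor products.

-- Stated for an arbitrary exponent function so that column d, with `fExp`, and column 1, with the
-- zero exponent, are both instances.
Υ-tensor : ∀ {L} → WF L → ∀ e δ → Υ (NOf L) δ (power e L) ≡ tensor (λ p s i → υ p (rExp s) i (e s)) L δ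
Υ-tensor {L} wf e δ = trans (productℤ-↭ g (primeDivisors-↭ wf)) (go L (All.tabulate local))
  where
  g = λ p → υ p (val p (NOf L)) (val p δ) (val p (power e L))
  local : ∀ {l} → l ∈ L → g (proj₁ l) ≡ υ (proj₁ l) (rExp (proj₂ l)) (val (proj₁ l) δ) (e (proj₂ l))
  local {p , s} l∈L = cong₂ (λ r j → υ p r (val p δ) j) (val-power rExp wf l∈L) (val-power e wf l∈L)
  go : ∀ L′ → All (λ (p , s) → g p ≡ υ p (rExp s) (val p δ) (e s)) L′ →
       productℤ (map g (map proj₁ L′)) ≡ tensor (λ p s i → υ p (rExp s) i (e s)) L′ δ
  go [] [] = refl
  go (_ ∷ L′) (h ∷ hs) = cong₂ ℤ._*_ h (go L′ hs)

power-0 : ∀ L → power (λ _ → 0) L ≡ 1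
power-0 [] = refl
power-0 (_ ∷ L) = trans (+-identityʳ (power (λ _ → 0) L)) (power-0 L)

colA₀ : ℕ → Column
colA₀ p = (+ p , 0) ∷ (-1ℤ , 1) ∷ []

υ-0 : ∀ p r′ i → υ p (suc r′) i 0 ≡ entry (colA₀ p) i
υ-0 p r′ 0 = lemma (+ p)
  where
  lemma : ∀ p → p ≡ p ℤ.* 1ℤ ℤ.+ 0ℤ
  lemma = solve-∀
υ-0 p r′ 1 = lemma (+ p)
  where
  lemma : ∀ p → -1ℤ ≡ p ℤ.* 0ℤ ℤ.+ -1ℤ
  lemma = solve-∀
υ-0 p r′ (suc (suc i)) = lemma (+ p)
  where
  lemma : ∀ p → 0ℤ ≡ p ℤ.* 0ℤ ℤ.+ (-1ℤ ℤ.* 0ℤ ℤ.+ 0ℤ)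
  lemma = solve-∀

if-yes : ∀ {X Y : Set} (x? : Dec X) {a b : Y} → X → (if does x? then a else b) ≡ a
if-yes x? {a} {b} x = cong (if_then a else b) (dec-true x? x)

if-no : ∀ {X Y : Set} (x? : Dec X) {a b : Y} → ¬ X → (if does x? then a else b) ≡ b
if-no x? {a} {b} ¬x = cong (if_then a else b) (dec-false x? ¬x)

data Position (i j : ℕ) : Set where
  same  : i ≡ j → Position i j
  above : i ≡ suc j → Position i j
  below : j ≡ suc i → Position i j
  far   : i ≢ j → i ≢ suc j → j ≢ suc i → ∣ i - j ∣ ≢ 1 → Position i j

position : ∀ i j → Position i j
position 0 0                         = same refl
position 0 1                         = below refl
position 0 (suc (suc j))             = far (λ ()) (λ ()) (λ ()) (λ ())
position 1 0                         = above refl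
position (suc (suc i)) 0             = far (λ ()) (λ ()) (λ ()) (λ ())
position (suc i) (suc j) with position i j
... | same e    = same (cong suc e)
... | above e   = above (cong suc e)
... | below e   = below (cong suc e)
... | far a b c d = far (a ∘ suc-injective) (b ∘ suc-injective) (c ∘ suc-injective) d

∣-∣≡1ˡ : ∀ j → ∣ suc j - j ∣ ≡ 1
∣-∣≡1ˡ zero    = refl
∣-∣≡1ˡ (suc j) = ∣-∣≡1ˡ j

∣-∣≡1ʳ : ∀ i → ∣ i - suc i ∣ ≡ 1
∣-∣≡1ʳ zero    = refl
∣-∣≡1ʳ (suc i) = ∣-∣≡1ʳ i

υ-full : ∀ p r′ i → i ≤ suc r′ → υ p (suc r′) i (suc r′) ≡ B p (full r′) i
-- At j = r the exponent m is min(r, 0) = 0, so the entry beside the diagonal is -1.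
υ-full p r′ i i≤r rewrite n∸n≡0 r′ with position i (suc r′)
... | same refl rewrite B-full-top p r′ =
  trans (if-yes (r′ ≟ r′) refl) (if-yes (r′ ≟ r′) refl)
... | above refl = contradiction i≤r (<⇒≱ ≤-refl)
... | below refl rewrite B-full-below p r′ =
  trans (if-no (r′ ≟ suc r′) λ ()) (if-yes (∣ r′ - suc r′ ∣ ≟ 1) (∣-∣≡1ʳ r′))
... | far i≢ _ i≢′ ∣i-∣≢1 =
  trans (if-no (i ≟ suc r′) i≢) (trans (if-no (∣ i - suc r′ ∣ ≟ 1) ∣i-∣≢1)
    (sym (trans (cong₂ (λ a b → -1ℤ ℤ.* a ℤ.+ (+ p ℤ.* b ℤ.+ 0ℤ)) (kron-≢ {i} {r′} (λ e → i≢′ (cong suc (sym e)))) (kron-≢ i≢))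
        (lemma (+ p)))))
  where
  lemma : ∀ p → -1ℤ ℤ.* 0ℤ ℤ.+ (p ℤ.* 0ℤ ℤ.+ 0ℤ) ≡ 0ℤ
  lemma = solve-∀

B-mid-below : ∀ p f′ k → B p (mid f′ k) f′ ≡ ℤ.- + p
B-mid-below p f′ k rewrite kron-pred f′ | kron-refl f′ | kron-≢ {f′} {suc (suc f′)} (λ e → m+1+n≢n 1 {f′} (sym e)) = lemma (+ p)
  where
  lemma : ∀ p → (ℤ.- p) ℤ.* 1ℤ ℤ.+ ((p ℤ.* p ℤ.+ 1ℤ) ℤ.* 0ℤ ℤ.+ ((ℤ.- p) ℤ.* 0ℤ ℤ.+ 0ℤ)) ≡ ℤ.- p
  lemma = solve-∀

pos-pow-suc-neg : ∀ p m → ℤ.- (+ (p ^ suc m)) ≡ + (p ^ m) ℤ.* (ℤ.- + p)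
pos-pow-suc-neg p m = trans (cong ℤ.-_ (trans (cong +_ (*-comm p (p ^ m))) (ℤₚ.pos-* (p ^ m) p))) (ℤₚ.neg-distribʳ-* (+ (p ^ m)) (+ p))

υ-mid : ∀ p f′ k i → υ p (suc f′ + suc k) i (suc f′) ≡ + (p ^ (f′ ⊓ k)) ℤ.* B p (mid f′ k) i
-- Here r ∸ j = suc k, so m = suc (f′ ⊓ k), and p ^ (f′ ⊓ k) can be taken out of the diagonal entry
-- and both neighbours.
υ-mid p f′ k i rewrite m+n∸m≡n f′ (suc k) with position i (suc f′)
... | same refl rewrite B-mid-centre p f′ k =
  trans (if-yes (f′ ≟ f′) refl) (trans (cong (if_then + p else (+ (p ^ (f′ ⊓ k) * (p ^ 2 + 1))))
      (dec-false (suc f′ ≟ suc f′ + suc k) (m≢1+m+n (suc f′) ∘ λ e → trans e (+-suc (suc f′) k))))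
    (trans (cong (λ x → + (p ^ (f′ ⊓ k) * (x + 1))) (cong (p *_) (*-identityʳ p)))
      (trans (ℤₚ.pos-* (p ^ (f′ ⊓ k)) (p * p + 1)) (cong (λ x → + (p ^ (f′ ⊓ k)) ℤ.* (x ℤ.+ 1ℤ)) (ℤₚ.pos-* p p)))))
... | above refl rewrite B-mid-above p f′ k =
  trans (if-no (suc (suc f′) ≟ suc f′) λ ()) (trans (if-yes (∣ suc f′ - f′ ∣ ≟ 1) (∣-∣≡1ˡ f′)) (pos-pow-suc-neg p (f′ ⊓ k)))
... | below refl rewrite B-mid-below p f′ k =
  trans (if-no (f′ ≟ suc f′) λ ()) (trans (if-yes (∣ f′ - suc f′ ∣ ≟ 1) (∣-∣≡1ʳ f′)) (pos-pow-suc-neg p (f′ ⊓ k)))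
... | far i≢ i≢+ i≢- ∣i-∣≢1
  rewrite kron-≢ {i} {f′} (λ e → i≢- (cong suc (sym e))) | kron-≢ i≢ | kron-≢ i≢+ =
  trans (if-no (i ≟ suc f′) i≢) (trans (if-no (∣ i - suc f′ ∣ ≟ 1) ∣i-∣≢1) (lemma (+ p) (+ (p ^ (f′ ⊓ k)))))
  where
  lemma : ∀ p z → 0ℤ ≡ z ℤ.* ((ℤ.- p) ℤ.* 0ℤ ℤ.+ ((p ℤ.* p ℤ.+ 1ℤ) ℤ.* 0ℤ ℤ.+ ((ℤ.- p) ℤ.* 0ℤ ℤ.+ 0ℤ)))
  lemma = solve-∀

localTotient : ℕ → Shape → ℤ
localTotient p (mid _ _) = + p ℤ.- 1ℤ
localTotient p _         = 1ℤ

υ-first : ∀ p s i → localTotient p s ℤ.* υ p (rExp s) i 0 ≡ A p s i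
υ-first p (absent r′) i = trans (ℤₚ.*-identityˡ _) (υ-0 p r′ i)
υ-first p (full r′)   i = trans (ℤₚ.*-identityˡ _) (υ-0 p r′ i)
υ-first p (mid f′ k)  i = trans (cong ((+ p ℤ.- 1ℤ) ℤ.*_) (υ-0 p (f′ + suc k) i)) (lemma (+ p) (kron i 0) (kron i 1))
  where
  lemma : ∀ p x y → (p ℤ.- 1ℤ) ℤ.* (p ℤ.* x ℤ.+ (-1ℤ ℤ.* y ℤ.+ 0ℤ)) ≡ (p ℤ.- 1ℤ) ℤ.* p ℤ.* x ℤ.+ ((ℤ.- (p ℤ.- 1ℤ)) ℤ.* y ℤ.+ 0ℤ)
  lemma = solve-∀

υ-second : ∀ p s i → i ≤ rExp s → υ p (rExp s) i (fExp s) ≡ + (p ^ zrExp s) ℤ.* B p s i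
υ-second p (absent r′) i i≤r = trans (υ-0 p r′ i) (sym (ℤₚ.*-identityˡ _))
υ-second p (full r′)   i i≤r = trans (υ-full p r′ i i≤r) (sym (ℤₚ.*-identityˡ _))
υ-second p (mid f′ k)  i i≤r = υ-mid p f′ k i

totient-ℤ : ∀ {p L} s → Prime p → + totient ((p , s) ∷ L) ≡ localTotient p s ℤ.* + totient L
totient-ℤ (absent _) pp = sym (ℤₚ.*-identityˡ _)
totient-ℤ (full _)   pp = sym (ℤₚ.*-identityˡ _)
totient-ℤ {suc p} {L} (mid _ _) pp = ℤₚ.pos-* p (totient L)
totient-ℤ {zero}      (mid _ _) pp = contradiction pp ¬prime[0]

val-∣-≤ : ∀ {L δ p s} → WF L → δ ∣ NOf L → (p , s) ∈ L → val p δ ≤ rExp s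
val-∣-≤ {L} {δ} {p} {s} wf@(_ , pL) δ∣N l∈L = subst (val p δ ≤_) (val-power rExp wf l∈L)
  (pow∣⇒≤val (val p δ) pp {{N≢0}} (∣.∣-trans (pow-val-∣ pp {{δ≢0}}) δ∣N))
  where
  pp = All.lookup pL l∈L
  N≢0 = power≢0 rExp pL
  δ≢0 = ≢-nonZero {δ} λ δ≡0 → ≢-nonZero⁻¹ (NOf L) {{N≢0}} (∣.0∣⇒≡0 (subst (_∣ NOf L) δ≡0 δ∣N))

tensor-A : ∀ {L} δ → All (Prime ∘ proj₁) L → + totient L ℤ.* tensor (λ p s i → υ p (rExp s) i 0) L δ ≡ tensor A L δ
tensor-A δ [] = refl
tensor-A {(p , s) ∷ L} δ (pp ∷ pL) =
  trans (cong (ℤ._* (υ p (rExp s) (val p δ) 0 ℤ.* t)) (totient-ℤ {L = L} s pp))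
    (trans (lemma (localTotient p s) (+ totient L) (υ p (rExp s) (val p δ) 0) t)
      (cong₂ ℤ._*_ (υ-first p s (val p δ)) (tensor-A δ pL)))
  where
  t = tensor (λ p s i → υ p (rExp s) i 0) L δ
  lemma : ∀ a b c d → a ℤ.* b ℤ.* (c ℤ.* d) ≡ a ℤ.* c ℤ.* (b ℤ.* d)
  lemma = solve-∀

-- The bound on valuations is where δ ∣ N enters: one step past position r the formula for `υ` at a
-- full prime gives -1, while the sparse column gives 0.
tensor-B : ∀ {L} δ → All (λ (p , s) → val p δ ≤ rExp s) L →
           tensor (λ p s i → υ p (rExp s) i (fExp s)) L δ ≡ + power zrExp L ℤ.* tensor B L δ
tensor-B δ [] = refl
tensor-B {(p , s) ∷ L} δ (i≤r ∷ h) =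
  trans (cong₂ ℤ._*_ (υ-second p s (val p δ) i≤r) (tensor-B δ h))
    (trans (ℤ*.interchange (+ (p ^ zrExp s)) (B p s (val p δ)) (+ power zrExp L) (tensor B L δ))
      (cong (ℤ._* (B p s (val p δ) ℤ.* tensor B L δ)) (sym (ℤₚ.pos-* (p ^ zrExp s) (power zrExp L)))))

sum-P-∉ : ∀ (F : ℕ → ℤ) {a} xs → All (a ≢_) xs → sumℤ (map (λ x → F x ℤ.* P a x) xs) ≡ 0ℤ
sum-P-∉ F [] [] = refl
sum-P-∉ F {a} (x ∷ xs) (a≢x ∷ h) = cong₂ ℤ._+_
  (trans (cong (F x ℤ.*_) (if-no (a ≟ x) a≢x)) (ℤₚ.*-zeroʳ (F x))) (sum-P-∉ F xs h)

sum-P : ∀ (F : ℕ → ℤ) {a} xs → Unique xs → a ∈ xs → sumℤ (map (λ x → F x ℤ.* P a x) xs) ≡ F a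
sum-P F {a} (x ∷ xs) (h ∷ u) (here refl) = trans (cong₂ ℤ._+_
  (trans (cong (F x ℤ.*_) (if-yes (a ≟ a) refl)) (ℤₚ.*-identityʳ (F x))) (sum-P-∉ F xs h)) (ℤₚ.+-identityʳ (F x))
sum-P F {a} (x ∷ xs) (h ∷ u) (there a∈) = trans (cong₂ ℤ._+_
  (trans (cong (F x ℤ.*_) (if-no (a ≟ x) (λ a≡x → All.lookup h a∈ (sym a≡x)))) (ℤₚ.*-zeroʳ (F x))) (sum-P F xs u a∈)) (ℤₚ.+-identityˡ (F a))

sum-⊖ : ∀ (F : ℕ → ℤ) c (f g : ℕ → ℤ) xs → sumℤ (map (λ x → F x ℤ.* (c ℤ.* f x ℤ.- g x)) xs) ≡
        c ℤ.* sumℤ (map (λ x → F x ℤ.* f x) xs) ℤ.- sumℤ (map (λ x → F x ℤ.* g x) xs)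
sum-⊖ F c f g [] = lemma c
  where
  lemma : ∀ c → 0ℤ ≡ c ℤ.* 0ℤ ℤ.- 0ℤ
  lemma = solve-∀
sum-⊖ F c f g (x ∷ xs) = trans (cong (λ z → F x ℤ.* (c ℤ.* f x ℤ.- g x) ℤ.+ z) (sum-⊖ F c f g xs))
  (lemma (F x) c (f x) (g x) _ _)
  where
  lemma : ∀ F c f g s t → F ℤ.* (c ℤ.* f ℤ.- g) ℤ.+ (c ℤ.* s ℤ.- t) ≡ c ℤ.* (F ℤ.* f ℤ.+ s) ℤ.- (F ℤ.* g ℤ.+ t)
  lemma = solve-∀

V-tensor : ∀ {L} → WF L → ∀ {δ} → δ ∣ NOf L →
           V (NOf L) (C (NOf L) (dOf L)) δ ≡ + power zrExp L ℤ.* (tensor A L δ ℤ.- tensor B L δ)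
V-tensor {L} wf@(_ , pL) {δ} δ∣N =
  trans (sum-⊖ F (+ φ z) (P 1) (P d) (divisors N))
    (trans (cong₂ (λ a b → + φ z ℤ.* a ℤ.- b)
        (trans (sum-P F (divisors N) (divisors-unique N) (∈-divisors⁺ {{N≢0}} (∣.1∣ N))) firstCol)
        (trans (sum-P F (divisors N) (divisors-unique N) (∈-divisors⁺ {{N≢0}} d∣N)) secondCol))
      (trans (cong (λ c → c ℤ.* t₁ ℤ.- + power zrExp L ℤ.* tensor B L δ) φz)
        (trans (lemma (+ power zrExp L) (+ totient L) t₁ (tensor B L δ))
          (cong (λ a → + power zrExp L ℤ.* (a ℤ.- tensor B L δ)) (tensor-A δ pL)))))
  where
  N = NOf L
  d = dOf L
  z = gcd d (N ÷ d)
  F = Υ N δ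
  N≢0 = power≢0 rExp pL
  d∣N : d ∣ N
  d∣N = subst (d ∣_) (sym (dOf*co L)) (∣.m∣m*n (power coExp L))
  t₁ = tensor (λ p s i → υ p (rExp s) i 0) L δ
  firstCol : F 1 ≡ t₁
  firstCol = trans (cong (Υ N δ) (sym (power-0 L))) (Υ-tensor wf (λ _ → 0) δ)
  secondCol : F d ≡ + power zrExp L ℤ.* tensor B L δ
  secondCol = trans (Υ-tensor wf fExp δ) (tensor-B δ (All.tabulate (λ l∈L → val-∣-≤ wf δ∣N l∈L)))
  φz : + φ z ≡ + power zrExp L ℤ.* + totient L
  φz = trans (cong (λ z → + φ z) (z≡ wf)) (trans (cong +_ (φ-power L wf)) (ℤₚ.pos-* (power zrExp L) (totient L)))
  lemma : ∀ z t a b → z ℤ.* t ℤ.* a ℤ.- z ℤ.* b ≡ z ℤ.* (t ℤ.* a ℤ.- b)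
  lemma = solve-∀

-- GCD and the normalised vector.

∣-foldr-gcd : ∀ {n e} {f : ℕ → ℕ} xs → n ∣ e → (∀ {x} → x ∈ xs → n ∣ f x) → n ∣ foldr gcd e (map f xs)
∣-foldr-gcd []       n∣e h = n∣e
∣-foldr-gcd (x ∷ xs) n∣e h = gcd-greatest (h (here refl)) (∣-foldr-gcd xs n∣e (h ∘ there))

foldr-gcd-∣ : ∀ {e} {f : ℕ → ℕ} {xs x} → x ∈ xs → foldr gcd e (map f xs) ∣ f x
foldr-gcd-∣ {e} {f} {y ∷ xs} (here refl) = gcd[m,n]∣m (f y) _
foldr-gcd-∣ {e} {f} {y ∷ xs} (there x∈) = ∣.∣-trans (gcd[m,n]∣n (f y) _) (foldr-gcd-∣ x∈)

foldr-gcd-∣-init : ∀ {e} {f : ℕ → ℕ} xs → foldr gcd e (map f xs) ∣ e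
foldr-gcd-∣-init []           = ∣.∣-refl
foldr-gcd-∣-init {f = f} (x ∷ xs) = ∣.∣-trans (gcd[m,n]∣n (f x) _) (foldr-gcd-∣-init xs)

foldr-gcd-scale : ∀ c xs → foldr gcd 0 (map (c *_) xs) ≡ c * foldr gcd 0 xs
foldr-gcd-scale c []       = sym (*-zeroʳ c)
foldr-gcd-scale c (x ∷ xs) = trans (cong (gcd (c * x)) (foldr-gcd-scale c xs)) (sym (c*gcd[m,n]≡gcd[cm,cn] c x _))

-- V = (z / rad z) W
W : List Loc → ℕ → ℤ
W L δ = tensor A L δ ℤ.- tensor B L δ

G : List Loc → ℕ
G L = foldr gcd 0 (map (λ δ → ∣ W L δ ∣) (divisors (NOf L)))

GCD-cusp : ∀ {L} → WF L → GCD (NOf L) (C (NOf L) (dOf L)) ≡ power zrExp L * G L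
GCD-cusp {L} wf = trans
  (cong (foldr gcd 0) (trans (Listₚ.map-cong-local (All.tabulate λ δ∈ →
      trans (cong ∣_∣ (V-tensor wf (∈-divisors⁻ {n = NOf L} δ∈))) (ℤₚ.abs-* (+ power zrExp L) (W L _))))
    (Listₚ.map-∘ (divisors (NOf L)))))
  (foldr-gcd-scale (power zrExp L) (map (λ δ → ∣ W L δ ∣) (divisors (NOf L))))

Divides⇒∣G : ∀ {n L} → WF L → Divides n L 1ℤ 1ℤ → n ∣ G L
Divides⇒∣G {n} {L} wf h = ∣-foldr-gcd (divisors (NOf L)) (n ∣.∣0) λ {δ} δ∈ →
  ∣⇒∣ᵤ (∣-resp (lemma (tensor A L δ) (tensor B L δ)) (Divides⇒∣tensor L wf h (∣-divs L wf (∈-divisors⁻ {n = NOf L} δ∈))))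
  where
  lemma : ∀ a b → 1ℤ ℤ.* a ℤ.- 1ℤ ℤ.* b ≡ a ℤ.- b
  lemma = solve-∀

∣G⇒Divides : ∀ {n L} → WF L → n ∣ G L → Divides n L 1ℤ 1ℤ
∣G⇒Divides {n} {L} wf@(_ , pL) h = ∣tensor⇒Divides L wf λ {δ} δ∈ →
  ∣-resp (lemma (tensor A L δ) (tensor B L δ)) (∣ᵤ⇒∣ {+ n} {W L δ} (∣.∣-trans h
    (foldr-gcd-∣ {f = λ δ → ∣ W L δ ∣} (∈-divisors⁺ {{power≢0 rExp pL}} (divs-∣ L δ∈)))))
  where
  lemma : ∀ a b → a ℤ.- b ≡ 1ℤ ℤ.* a ℤ.- 1ℤ ℤ.* b
  lemma = solve-∀

-- For g = 0 divisibility forces i = 0, so the identity also holds for the default value of the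
-- totalised quotient.
÷ℤ-exact : ∀ {g i} → + g ∣ᶻ i → + g ℤ.* (i ÷ℤ g) ≡ i
÷ℤ-exact {zero}  {i} g∣i = sym (ℤ∣.0∣⇒≡0 g∣i)
÷ℤ-exact {suc g} {i} g∣i = trans (ℤₚ.*-comm (+ suc g) q)
  (sym (trans (ℤDM.a≡a%ℕn+[a/ℕn]*n i (suc g)) (trans (cong (λ r → + r ℤ.+ q ℤ.* + suc g) r≡0) (ℤₚ.+-identityˡ _))))
  where
  q = i ℤ./ℕ suc g
  r = i ℤ.%ℕ suc g
  lemma : ∀ r x → (r ℤ.+ x) ℤ.+ -1ℤ ℤ.* x ≡ r
  lemma = solve-∀
  n∣r : suc g ∣ r
  n∣r = ∣⇒∣ᵤ (∣-resp (lemma (+ r) (q ℤ.* + suc g)) (ℤ∣.∣m∣n⇒∣m+n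
    (∣-resp (ℤDM.a≡a%ℕn+[a/ℕn]*n i (suc g)) g∣i) (ℤ∣.∣n⇒∣m*n -1ℤ (ℤ∣.∣n⇒∣m*n q ℤ∣.∣-refl))))
  r≡0 : r ≡ 0
  r≡0 with r in eq
  ... | zero  = refl
  ... | suc k = contradiction (∣.∣⇒≤ (subst (suc g ∣_) eq n∣r)) (<⇒≱ (subst (_< suc g) eq (ℤDM.n%ℕd<d i (suc g))))

-- The factor z / rad z occurs both in `GCD` and in `V` and cancels.
𝕍-W : ∀ {L δ} → WF L → δ ∣ NOf L → + G L ℤ.* 𝕍 (NOf L) (C (NOf L) (dOf L)) δ ≡ W L δ
𝕍-W {L} {δ} wf@(_ , pL) δ∣N = ℤₚ.*-cancelˡ-≡ (+ zr) _ _ {{ℤ.≢-nonZero λ e → ≢-nonZero⁻¹ zr {{power≢0 zrExp pL}} (ℤₚ.+-injective e)}}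
  (trans (sym (ℤₚ.*-assoc (+ zr) (+ G L) _)) (trans (cong (ℤ._* v) (sym (ℤₚ.pos-* zr (G L))))
    (trans (cong (λ g → + g ℤ.* v) (sym (GCD-cusp wf)))
      (trans (÷ℤ-exact (∣ᵤ⇒∣ {+ GCD (NOf L) (C (NOf L) (dOf L))} {V (NOf L) (C (NOf L) (dOf L)) δ}
          (foldr-gcd-∣ {f = λ δ → ∣ V (NOf L) (C (NOf L) (dOf L)) δ ∣} (∈-divisors⁺ {{power≢0 rExp pL}} δ∣N))))
        (V-tensor wf δ∣N)))))
  where
  zr = power zrExp L
  v = 𝕍 (NOf L) (C (NOf L) (dOf L)) δ

-- Sums over odd exponents and the gap G · Pw.

-- The indicator of odd numbers in the form 1 - (previous value), so that weighted column sums
-- become identities for the ring solver with one indeterminate for the parity.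
parity : ℕ → ℤ
parity zero    = 0ℤ
parity (suc n) = 1ℤ ℤ.- parity n

parity-% : ∀ n → parity n ≡ (if does (n % 2 ≟ 1) then 1ℤ else 0ℤ)
parity-% 0 = refl
parity-% 1 = refl
parity-% (suc (suc n)) = trans (lemma (parity n)) (parity-% n)
  where
  lemma : ∀ x → 1ℤ ℤ.- (1ℤ ℤ.- x) ≡ x
  lemma = solve-∀

sum-filter : ∀ {Q : ℕ → Set} (Q? : ∀ x → Dec (Q x)) (F : ℕ → ℤ) xs →
             sumℤ (map F (filter Q? xs)) ≡ sumℤ (map (λ x → (if does (Q? x) then 1ℤ else 0ℤ) ℤ.* F x) xs)
sum-filter Q? F [] = refl
sum-filter Q? F (x ∷ xs) with Q? x
... | yes _ = cong₂ ℤ._+_ (sym (ℤₚ.*-identityˡ (F x))) (sum-filter Q? F xs)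
... | no  _ = trans (sum-filter Q? F xs) (sym (ℤₚ.+-identityˡ _))

columnSum : (ℕ → ℤ) → Column → ℤ
columnSum w []            = 0ℤ
columnSum w ((a , j) ∷ c) = a ℤ.* w j ℤ.+ columnSum w c

∑≤-cong : ∀ k {f g : ℕ → ℤ} → (∀ i → f i ≡ g i) → ∑[≤ k ] f ≡ ∑[≤ k ] g
∑≤-cong zero    f≗g = f≗g 0
∑≤-cong (suc k) f≗g = cong₂ ℤ._+_ (f≗g (suc k)) (∑≤-cong k f≗g)

∑≤-lin : ∀ k a (f g : ℕ → ℤ) → ∑[≤ k ] (λ i → a ℤ.* f i ℤ.+ g i) ≡ a ℤ.* ∑[≤ k ] f ℤ.+ ∑[≤ k ] g
∑≤-lin zero    a f g = refl
∑≤-lin (suc k) a f g = trans (cong (λ x → a ℤ.* f (suc k) ℤ.+ g (suc k) ℤ.+ x) (∑≤-lin k a f g))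
  (lemma a (f (suc k)) (g (suc k)) _ _)
  where
  lemma : ∀ a f g s t → a ℤ.* f ℤ.+ g ℤ.+ (a ℤ.* s ℤ.+ t) ≡ a ℤ.* (f ℤ.+ s) ℤ.+ (g ℤ.+ t)
  lemma = solve-∀

∑≤-0 : ∀ k (f : ℕ → ℤ) → (∀ i → i ≤ k → f i ≡ 0ℤ) → ∑[≤ k ] f ≡ 0ℤ
∑≤-0 zero    f h = h 0 z≤n
∑≤-0 (suc k) f h = cong₂ ℤ._+_ (h (suc k) ≤-refl) (∑≤-0 k f (λ i i≤k → h i (m≤n⇒m≤1+n i≤k)))

∑≤-kron : ∀ k (w : ℕ → ℤ) {j} → j ≤ k → ∑[≤ k ] (λ i → w i ℤ.* kron i j) ≡ w j
∑≤-kron zero    w z≤n = ℤₚ.*-identityʳ (w 0)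
∑≤-kron (suc k) w {j} j≤k with m≤n⇒m<n∨m≡n j≤k
... | inj₁ (s≤s j≤k′) = trans (cong₂ ℤ._+_ (trans (cong (w (suc k) ℤ.*_) (kron-≢ {suc k} (λ e → <⇒≢ (s≤s j≤k′) (sym e))))
    (ℤₚ.*-zeroʳ (w (suc k)))) (∑≤-kron k w j≤k′)) (ℤₚ.+-identityˡ (w j))
... | inj₂ refl = trans (cong₂ ℤ._+_ (trans (cong (w (suc k) ℤ.*_) (kron-refl k)) (ℤₚ.*-identityʳ (w (suc k))))
  (∑≤-0 k (λ i → w i ℤ.* kron i (suc k)) (λ i i≤k → trans (cong (w i ℤ.*_) (kron-≢ (λ e → <⇒≢ (s≤s i≤k) e))) (ℤₚ.*-zeroʳ (w i)))))
      (ℤₚ.+-identityʳ (w (suc k)))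

-- A sum over all positions collapses to the two or three listed ones, provided they lie in the
-- summation range.
∑≤-entry : ∀ k w c → All (λ (_ , j) → j ≤ k) c → ∑[≤ k ] (λ i → w i ℤ.* entry c i) ≡ columnSum w c
∑≤-entry k w [] [] = ∑≤-0 k _ (λ i _ → ℤₚ.*-zeroʳ (w i))
∑≤-entry k w ((a , j) ∷ c) (j≤k ∷ h) = trans (∑≤-cong k (λ i → lemma (w i) a (kron i j) (entry c i)))
  (trans (∑≤-lin k a (λ i → w i ℤ.* kron i j) (λ i → w i ℤ.* entry c i))
    (cong₂ (λ x y → a ℤ.* x ℤ.+ y) (∑≤-kron k w j≤k) (∑≤-entry k w c h)))
  where
  lemma : ∀ w a k e → w ℤ.* (a ℤ.* k ℤ.+ e) ≡ a ℤ.* (w ℤ.* k) ℤ.+ w ℤ.* e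
  lemma = solve-∀

colA-bound : ∀ p s → All (λ (_ , j) → j ≤ rExp s) (colA p s)
colA-bound p (absent r′) = z≤n ∷ s≤s z≤n ∷ []
colA-bound p (full r′)   = z≤n ∷ s≤s z≤n ∷ []
colA-bound p (mid f′ k)  = z≤n ∷ s≤s z≤n ∷ []

colB-bound : ∀ p s → All (λ (_ , j) → j ≤ rExp s) (colB p s)
colB-bound p (absent r′) = z≤n ∷ s≤s z≤n ∷ []
colB-bound p (full r′)   = n≤1+n r′ ∷ ≤-refl ∷ []
colB-bound p (mid f′ k)  = ≤-trans (n≤1+n f′) (m≤m+n (suc f′) (suc k)) ∷ m≤m+n (suc f′) (suc k)
  ∷ s≤s (≤-trans (m≤m+n (suc f′) k) (≤-reflexive (sym (+-suc f′ k)))) ∷ []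

total : ℕ → Shape → ℤ
total p (mid _ _) = (+ p ℤ.- 1ℤ) ℤ.* (+ p ℤ.- 1ℤ)
total p _         = + p ℤ.- 1ℤ

∏total : List Loc → ℤ
∏total []            = 1ℤ
∏total ((p , s) ∷ L) = total p s ℤ.* ∏total L

private
  columnSum₁ : ∀ k c → All (λ (_ , j) → j ≤ k) c → ∑[≤ k ] (entry c) ≡ columnSum (λ _ → 1ℤ) c
  columnSum₁ k c h = trans (∑≤-cong k (λ i → sym (ℤₚ.*-identityˡ (entry c i)))) (∑≤-entry k (λ _ → 1ℤ) c h)

  total₁ : ∀ p → p ℤ.* 1ℤ ℤ.+ (-1ℤ ℤ.* 1ℤ ℤ.+ 0ℤ) ≡ p ℤ.- 1ℤ
  total₁ = solve-∀

total-A : ∀ p s → ∑[≤ rExp s ] (A p s) ≡ total p s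
total-A p s@(absent _) = trans (columnSum₁ (rExp s) (colA p s) (colA-bound p s)) (total₁ (+ p))
total-A p s@(full _)   = trans (columnSum₁ (rExp s) (colA p s) (colA-bound p s)) (total₁ (+ p))
total-A p s@(mid _ _)  = trans (columnSum₁ (rExp s) (colA p s) (colA-bound p s)) (lemma (+ p))
  where
  lemma : ∀ p → (p ℤ.- 1ℤ) ℤ.* p ℤ.* 1ℤ ℤ.+ ((ℤ.- (p ℤ.- 1ℤ)) ℤ.* 1ℤ ℤ.+ 0ℤ) ≡ (p ℤ.- 1ℤ) ℤ.* (p ℤ.- 1ℤ)
  lemma = solve-∀

total-B : ∀ p s → ∑[≤ rExp s ] (B p s) ≡ total p s
total-B p s@(absent _) = trans (columnSum₁ (rExp s) (colB p s) (colB-bound p s)) (total₁ (+ p))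
total-B p s@(full _)   = trans (columnSum₁ (rExp s) (colB p s) (colB-bound p s)) (lemma (+ p))
  where
  lemma : ∀ p → -1ℤ ℤ.* 1ℤ ℤ.+ (p ℤ.* 1ℤ ℤ.+ 0ℤ) ≡ p ℤ.- 1ℤ
  lemma = solve-∀
total-B p s@(mid _ _)  = trans (columnSum₁ (rExp s) (colB p s) (colB-bound p s)) (lemma (+ p))
  where
  lemma : ∀ p → (ℤ.- p) ℤ.* 1ℤ ℤ.+ ((p ℤ.* p ℤ.+ 1ℤ) ℤ.* 1ℤ ℤ.+ ((ℤ.- p) ℤ.* 1ℤ ℤ.+ 0ℤ)) ≡ (p ℤ.- 1ℤ) ℤ.* (p ℤ.- 1ℤ)
  lemma = solve-∀

∏∑-total : ∀ u → (∀ p s → ∑[≤ rExp s ] (u p s) ≡ total p s) → ∀ L → ∏∑ u L ≡ ∏total L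
∏∑-total u h []            = refl
∏∑-total u h ((p , s) ∷ L) = cong₂ ℤ._*_ (h p s) (∏∑-total u h L)

-- The sum of A_p(i) − B_p(i) over odd i.
oddGap : ℕ → Shape → ℤ
oddGap p (absent _)  = 0ℤ
oddGap p (full r′)   = (ℤ.- parity (suc r′)) ℤ.* (+ p ℤ.+ 1ℤ)
oddGap p (mid f′ _)  = (1ℤ ℤ.- parity (suc f′) ℤ.* (+ p ℤ.+ 1ℤ)) ℤ.* (+ p ℤ.+ 1ℤ)

oddGap-≡ : ∀ p s → ∑[≤ rExp s ] (λ i → parity i ℤ.* A p s i) ℤ.- ∑[≤ rExp s ] (λ i → parity i ℤ.* B p s i) ≡ oddGap p s
oddGap-≡ p s = trans (cong₂ ℤ._-_ (∑≤-entry (rExp s) parity (colA p s) (colA-bound p s))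
    (∑≤-entry (rExp s) parity (colB p s) (colB-bound p s))) (go s)
  where
  go : ∀ s → columnSum parity (colA p s) ℤ.- columnSum parity (colB p s) ≡ oddGap p s
  go (absent r′) = ℤₚ.+-inverseʳ (columnSum parity (colA p (absent r′)))
  go (full r′)   = lemma (+ p) (parity r′)
    where
    lemma : ∀ p e → (p ℤ.* 0ℤ ℤ.+ (-1ℤ ℤ.* 1ℤ ℤ.+ 0ℤ)) ℤ.- (-1ℤ ℤ.* e ℤ.+ (p ℤ.* (1ℤ ℤ.- e) ℤ.+ 0ℤ)) ≡ (ℤ.- (1ℤ ℤ.- e)) ℤ.* (p ℤ.+ 1ℤ)
    lemma = solve-∀
  go (mid f′ k)  = lemma (+ p) (parity f′)
    where
    lemma : ∀ p e → ((p ℤ.- 1ℤ) ℤ.* p ℤ.* 0ℤ ℤ.+ ((ℤ.- (p ℤ.- 1ℤ)) ℤ.* 1ℤ ℤ.+ 0ℤ)) ℤ.-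
      ((ℤ.- p) ℤ.* e ℤ.+ ((p ℤ.* p ℤ.+ 1ℤ) ℤ.* (1ℤ ℤ.- e) ℤ.+ ((ℤ.- p) ℤ.* (1ℤ ℤ.- (1ℤ ℤ.- e)) ℤ.+ 0ℤ))) ≡
      (1ℤ ℤ.- (1ℤ ℤ.- e) ℤ.* (p ℤ.+ 1ℤ)) ℤ.* (p ℤ.+ 1ℤ)
    lemma = solve-∀

sumℤ-minus : ∀ {X : Set} (f g : X → ℤ) xs → sumℤ (map (λ x → f x ℤ.- g x) xs) ≡ sumℤ (map f xs) ℤ.- sumℤ (map g xs)
sumℤ-minus f g [] = refl
sumℤ-minus f g (x ∷ xs) = trans (cong (λ z → f x ℤ.- g x ℤ.+ z) (sumℤ-minus f g xs)) (lemma (f x) (g x) _ _)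
  where
  lemma : ∀ a b s t → a ℤ.- b ℤ.+ (s ℤ.- t) ≡ a ℤ.+ s ℤ.- (b ℤ.+ t)
  lemma = solve-∀

gap : ℕ → Shape → List Loc → ℤ
gap p s L = oddGap p s ℤ.* ∏total L

Pw-gap : ∀ {p s L} → WF ((p , s) ∷ L) → let L⁺ = (p , s) ∷ L in
         + G L⁺ ℤ.* Pw p (NOf L⁺) (C (NOf L⁺) (dOf L⁺)) ≡ gap p s L
Pw-gap {p} {s} {L} wf = begin
  + g ℤ.* Pw p N (C (NOf L⁺) (dOf L⁺))                                           ≡⟨ sym
      (sumℤ-scale (+ g) (map (𝕍 N (C (NOf L⁺) (dOf L⁺))) odds)) ⟩
  sumℤ (map (+ g ℤ.*_) (map (𝕍 N (C (NOf L⁺) (dOf L⁺))) odds))                    ≡⟨ cong sumℤ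
      (trans (sym (Listₚ.map-∘ odds)) (Listₚ.map-cong-local (All.tabulate onDivisors))) ⟩
  sumℤ (map (W L⁺) odds)                                             ≡⟨ sum-filter odd? (W L⁺) (divisors N) ⟩
  sumℤ (map (λ δ → w δ ℤ.* W L⁺ δ) (divisors N))                      ≡⟨ sumℤ-↭ _ (divisors-↭ wf) ⟩
  sumℤ (map (λ δ → w δ ℤ.* W L⁺ δ) (divs L⁺))                         ≡⟨ cong sumℤ (Listₚ.map-cong expand (divs L⁺)) ⟩
  sumℤ (map (λ δ → wt A δ ℤ.- wt B δ) (divs L⁺))                      ≡⟨ sumℤ-minus (wt A) (wt B) (divs L⁺) ⟩
  sumℤ (map (wt A) (divs L⁺)) ℤ.- sumℤ (map (wt B) (divs L⁺))         ≡⟨ cong₂ ℤ._-_ (weighted A total-A) (weighted B total-B) ⟩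
  odd A ℤ.* ∏total L ℤ.- odd B ℤ.* ∏total L                          ≡⟨ lemma (odd A) (odd B) (∏total L) ⟩
  (odd A ℤ.- odd B) ℤ.* ∏total L                                     ≡⟨ cong (ℤ._* ∏total L) (oddGap-≡ p s) ⟩
  gap p s L                                                          ∎
  where
  open ≡-Reasoning
  L⁺ = (p , s) ∷ L
  N = NOf L⁺
  g = G L⁺
  odd? = λ δ → val p δ % 2 ≟ 1
  odds = filter odd? (divisors N)
  w = λ δ → if does (odd? δ) then 1ℤ else 0ℤ
  odd : Weights → ℤ
  odd u = ∑[≤ rExp s ] (λ i → parity i ℤ.* u p s i)
  wt : Weights → ℕ → ℤ
  wt u δ = parity (val p δ) ℤ.* u p s (val p δ) ℤ.* tensor u L δ
  onDivisors : ∀ {δ} → δ ∈ odds → + g ℤ.* 𝕍 N (C (NOf L⁺) (dOf L⁺)) δ ≡ W L⁺ δ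
  onDivisors δ∈ = 𝕍-W wf (∈-divisors⁻ {n = N} (proj₁ (∈ₚ.∈-filter⁻ odd? {xs = divisors N} δ∈)))
  distrib : ∀ c a t b u → c ℤ.* (a ℤ.* t ℤ.- b ℤ.* u) ≡ c ℤ.* a ℤ.* t ℤ.- c ℤ.* b ℤ.* u
  distrib = solve-∀
  expand : ∀ δ → w δ ℤ.* W L⁺ δ ≡ wt A δ ℤ.- wt B δ
  expand δ = trans (cong (ℤ._* W L⁺ δ) (sym (parity-% (val p δ))))
    (distrib (parity (val p δ)) (A p s (val p δ)) (tensor A L δ) (B p s (val p δ)) (tensor B L δ))
  weighted : ∀ u → (∀ p s → ∑[≤ rExp s ] (u p s) ≡ total p s) → sumℤ (map (wt u) (divs L⁺)) ≡ odd u ℤ.* ∏total L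
  weighted u h = trans (sum-cons (λ i → parity i ℤ.* u p s i) u wf)
    (cong (odd u ℤ.*_) (trans (sum-tensor u (WF-tail wf)) (∏∑-total u h L)))
  lemma : ∀ a b t → a ℤ.* t ℤ.- b ℤ.* t ≡ (a ℤ.- b) ℤ.* t
  lemma = solve-∀

-- Evaluation of 𝔤.

≡-by-divisors : ∀ {a b} → (∀ {n} → n ∣ a → n ∣ b) → (∀ {n} → n ∣ b → n ∣ a) → a ≡ b
≡-by-divisors a⇒b b⇒a = ∣.∣-antisym (a⇒b ∣.∣-refl) (b⇒a ∣.∣-refl)

square-∤⇒squarefree : ∀ {n} → .{{NonZero n}} → (∀ {p} → Prime p → ¬ p * p ∣ n) → Squarefree n
square-∤⇒squarefree {n} h zero    k²∣n = contradiction (∣.0∣⇒≡0 k²∣n) (≢-nonZero⁻¹ n)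
square-∤⇒squarefree {n} h k@(suc _) k²∣n with k ≟ 1
... | yes k≡1 = k≡1
... | no  k≢1 with prime-divisor k k≢1
...   | p , pp , p∣k = contradiction (∣.∣-trans (∣.*-pres-∣ p∣k p∣k) k²∣n) (h pp)

prime≢1 : ∀ {p} → Prime p → p ≢ 1
prime≢1 pp refl = ¬prime[1] pp

p*p≡p^2 : ∀ p → p * p ≡ p ^ 2
p*p≡p^2 p = cong (p *_) (sym (*-identityʳ p))

-- `𝔤` takes its prime from whichever witness the search returns. If p differed from q, then p²
-- would divide the squarefree M′.
PST-unique-prime : ∀ {M q M′ p} → PrimeSquareTimes M q M′ → Prime p → p * p ∣ M → p ≡ q
PST-unique-prime {M} {q} {M′} {p} (refl , pq , _ , sf) pp p²∣M with p ≟ q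
... | yes p≡q = p≡q
... | no  p≢q = contradiction (sf p (coprime-to-power 2 pq q∤p²
        (subst (p * p ∣_) (trans (*-comm M′ (q * q)) (cong (_* M′) (p*p≡p^2 q))) p²∣M))) (prime≢1 pp)
  where
  q∤p² : ¬ q ∣ p * p
  q∤p² = ∤-* pq (p≢q ∘ sym ∘ prime-∣⇒≡ pq pp) (p≢q ∘ sym ∘ prime-∣⇒≡ pq pp)

𝔤-of-squarefree : ∀ {M} → Squarefree M → 𝔤 M ≡ 𝔤-squarefree M
𝔤-of-squarefree {M} sf with squarefree? M | primeSquareTimes? M
... | yes _  | _ = refl
... | no ¬sf | _ = contradiction sf ¬sf

𝔤-of-PST : ∀ {M p M′} → PrimeSquareTimes M p M′ → 𝔤 M ≡ gcd p (𝔤-squarefree M′)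
𝔤-of-PST {M} {p} {M′} pst@(refl , pp , _) with squarefree? M | primeSquareTimes? M
... | yes sf | _ = contradiction (sf p (∣.n∣m*n M′)) (prime≢1 pp)
... | no _ | no ¬pst = contradiction (p , M′ , pst) ¬pst
... | no _ | yes (q , M″ , pst′@(eq , _)) with PST-unique-prime pst′ pp (∣.n∣m*n M′)
...   | refl = cong (gcd p ∘ 𝔤-squarefree) (sym (*-cancelʳ-≡ M′ M″ (p * p) {{m*n≢0 p p {{prime⇒nonZero pp}} {{prime⇒nonZero pp}}}} eq))

𝔤-square-∣ : ∀ {M p} → Prime p → p * p ∣ M → 𝔤 M ∣ p
𝔤-square-∣ {M} {p} pp p²∣M with squarefree? M | primeSquareTimes? M
... | yes sf | _ = contradiction (sf p p²∣M) (prime≢1 pp)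
... | no _ | no _ = ∣.1∣ p
... | no _ | yes (q , M′ , pst) with PST-unique-prime pst pp p²∣M
...   | refl = gcd[m,n]∣m p (𝔤-squarefree M′)

𝔤-cube : ∀ {M p} → Prime p → p ^ 3 ∣ M → 𝔤 M ≡ 1
𝔤-cube {M} {p} pp p³∣M with squarefree? M | primeSquareTimes? M
... | no _ | no _ = refl
... | yes sf | _ = contradiction (sf p (∣.∣-trans (subst (_∣ p ^ 3) (sym (p*p≡p^2 p)) (∣.n∣m*n p)) p³∣M)) (prime≢1 pp)
... | no _ | yes (q , M′ , pst@(refl , pq , M′⊥q , _))
  with PST-unique-prime pst pp (∣.∣-trans (subst (_∣ p ^ 3) (sym (p*p≡p^2 p)) (∣.n∣m*n p)) p³∣M)
...   | refl = contradiction (subst Prime (Coprimality.gcd≡1⇒coprime M′⊥q (p∣M′ , ∣.∣-refl)) pp) ¬prime[1]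
  where
  p∣M′ : p ∣ M′
  p∣M′ = ∣.*-cancelʳ-∣ (p * p) {{m*n≢0 p p {{prime⇒nonZero pp}} {{prime⇒nonZero pp}}}}
    (subst (_∣ M′ * (p * p)) (cong (λ x → p * (p * x)) (*-identityʳ p)) p³∣M)

-- Prime supports and the radical of z.

consIf : ℕ → ℕ → List ℕ → List ℕ
consIf zero    p ps = ps
consIf (suc _) p ps = p ∷ ps

support : (Shape → ℕ) → List Loc → List ℕ
support e []            = []
support e ((p , s) ∷ L) = consIf (e s) p (support e L)

∈-support⁻ : ∀ {q} e L → q ∈ support e L → ∃ λ s → (q , s) ∈ L × e s ≢ 0
∈-support⁻ e ((p , s) ∷ L) q∈ with e s in eq
... | zero = map₂ (λ (h , ≢0) → there h , ≢0) (∈-support⁻ e L q∈)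
∈-support⁻ e ((p , s) ∷ L) (here refl) | suc _ = s , here refl , λ e≡0 → contradiction (trans (sym eq) e≡0) λ ()
∈-support⁻ e ((p , s) ∷ L) (there q∈)  | suc _ = map₂ (λ (h , ≢0) → there h , ≢0) (∈-support⁻ e L q∈)

∈-support⁺ : ∀ {q t L} e → (q , t) ∈ L → e t ≢ 0 → q ∈ support e L
∈-support⁺ {t = t} e (here refl) ≢0 with e t
... | zero  = contradiction refl ≢0
... | suc _ = here refl
∈-support⁺ {L = (p , s) ∷ L} e (there h) ≢0 with e s
... | zero  = ∈-support⁺ e h ≢0
... | suc _ = there (∈-support⁺ e h ≢0)

support-unique : ∀ e L → Unique (map proj₁ L) → Unique (support e L)
support-unique e [] u = []
support-unique e ((p , s) ∷ L) (h ∷ u) with e s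
... | zero  = support-unique e L u
... | suc _ = All.tabulate (λ q∈ → All.lookup h (∈ₚ.∈-map⁺ proj₁ (proj₁ (proj₂ (∈-support⁻ e L q∈))))) ∷ support-unique e L u

primeDivisors-power : ∀ {L} e → WF L → primeDivisors (power e L) ↭ support e L
primeDivisors-power {L} e (u , pL) = unique-↭ (primeDivisors-unique (power e L)) (support-unique e L u) to from
  where
  to : ∀ {p} → p ∈ primeDivisors (power e L) → p ∈ support e L
  to p∈ with ∈-primeDivisors⁻ {n = power e L} p∈
  ... | pp , p∣n with prime-∣-power e pp pL p∣n
  ...   | s , l∈L , ≢0 = ∈-support⁺ e l∈L ≢0
  from : ∀ {p} → p ∈ support e L → p ∈ primeDivisors (power e L)
  from {p} p∈ with ∈-support⁻ e L p∈
  ... | s , l∈L , ≢0 = ∈-primeDivisors⁺ {{power≢0 e pL}} (All.lookup pL l∈L) (∣.∣-trans (p∣p^k p ≢0) (∈⇒∣power e l∈L))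

support-zr : ∀ L → product (support mExp L) * power zrExp L ≡ power mExp L
support-zr [] = refl
support-zr ((p , mid f′ k) ∷ L) = trans (ℕ*.interchange p (product (support mExp L)) (p ^ (f′ ⊓ k)) (power zrExp L))
  (cong (p * p ^ (f′ ⊓ k) *_) (support-zr L))
support-zr ((p , absent _) ∷ L) = trans (cong (product (support mExp L) *_) (*-identityˡ (power zrExp L)))
  (trans (support-zr L) (sym (*-identityˡ (power mExp L))))
support-zr ((p , full _) ∷ L) = trans (cong (product (support mExp L) *_) (*-identityˡ (power zrExp L)))
  (trans (support-zr L) (sym (*-identityˡ (power mExp L))))

rad*zr : ∀ {L} → WF L → rad (power mExp L) * power zrExp L ≡ power mExp L
rad*zr {L} wf = trans (cong (_* power zrExp L) (LAₚ.product-↭ (primeDivisors-power mExp wf))) (support-zr L)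


-- Comparison of G with 𝔤(N, d): degenerate lists.

d≡N⇒gcd≡1 : ∀ N d → .{{NonZero N}} → d ≡ N → gcd d (N ÷ d) ≡ 1
d≡N⇒gcd≡1 N d refl = trans (cong (gcd N) (÷-≡ N N 1 (sym (*-identityʳ N)))) (gcd-zeroʳ N)

-- The branch d = N is served by the case z = 1. The factor z / rad z is 1 in every branch but the
-- last, and there the other factor `g` is 1.
𝔤₂-by-cases : ∀ N d z zr g → .{{NonZero N}} → gcd d (N ÷ d) ≡ z →
  (z ≡ 1 → zr ≡ 1) → (Prime z → zr ≡ 1) → z ÷ rad z ≡ zr →
  (z ≡ 1 → g ≡ 𝔤 d) → (Prime z → val z d ≡ 1 → g ≡ gcd z (𝔤 (d ÷ z))) →
  (z ≢ 1 → ¬ (Prime z × val z d ≡ 1) → g ≡ 1) → zr * g ≡ 𝔤₂ N d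
𝔤₂-by-cases N d z zr g refl z≡1⇒ pz⇒ z÷rad≡ h₁ h₂ h₃ = go (d ≟ N) (z ≟ 1) (prime? z ×-dec (val z d ≟ 1))
  where
  scale₁ : ∀ {x} → zr ≡ 1 → g ≡ x → zr * g ≡ x
  scale₁ zr≡1 g≡x = trans (cong (_* g) zr≡1) (trans (*-identityˡ g) g≡x)
  go : Dec (d ≡ N) → Dec (z ≡ 1) → Dec (Prime z × val z d ≡ 1) → zr * g ≡ 𝔤₂ N d
  go (yes d≡N) _ _ = trans (scale₁ (z≡1⇒ z≡1) (h₁ z≡1)) (trans (cong 𝔤 d≡N) (sym (if-yes (d ≟ N) d≡N)))
    where
    z≡1 = d≡N⇒gcd≡1 N d d≡N
  go (no d≢N) (yes z≡1) _ = trans (scale₁ (z≡1⇒ z≡1) (h₁ z≡1)) (sym (trans (if-no (d ≟ N) d≢N) (if-yes (z ≟ 1) z≡1)))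
  go (no d≢N) (no z≢1) (yes h@(pz , v≡1)) = trans (scale₁ (pz⇒ pz) (h₂ pz v≡1))
    (sym (trans (if-no (d ≟ N) d≢N) (trans (if-no (z ≟ 1) z≢1) (if-yes (prime? z ×-dec (val z d ≟ 1)) h))))
  go (no d≢N) (no z≢1) (no ¬h) = trans (cong (zr *_) (h₃ z≢1 ¬h)) (trans (*-identityʳ zr)
    (sym (trans (if-no (d ≟ N) d≢N) (trans (if-no (z ≟ 1) z≢1) (trans (if-no (prime? z ×-dec (val z d ≟ 1)) ¬h) z÷rad≡)))))

Case₁ Case₂ Case₃ : List Loc → Set
Case₁ L = power mExp L ≡ 1 → G L ≡ 𝔤 (dOf L)
Case₂ L = Prime (power mExp L) → val (power mExp L) (dOf L) ≡ 1 → G L ≡ gcd (power mExp L) (𝔤 (dOf L ÷ power mExp L))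
Case₃ L = power mExp L ≢ 1 → ¬ (Prime (power mExp L) × val (power mExp L) (dOf L) ≡ 1) → G L ≡ 1

module _ {L : List Loc} (wf : WF L) where
  private
    instance
      N≢0 : NonZero (NOf L)
      N≢0 = power≢0 rExp (proj₂ wf)
      z≢0 : NonZero (power mExp L)
      z≢0 = power≢0 mExp (proj₂ wf)

  z÷rad : power mExp L ÷ rad (power mExp L) ≡ power zrExp L
  z÷rad = ÷-≡ (power mExp L) (rad (power mExp L)) (power zrExp L)
      {{≢-nonZero λ e → ≢-nonZero⁻¹ (power mExp L) (trans (sym (rad*zr {L} wf)) (cong (_* (power zrExp L)) e))}} (sym (rad*zr {L} wf))

  z≡1⇒zr≡1 : power mExp L ≡ 1 → power zrExp L ≡ 1
  z≡1⇒zr≡1 z≡1 = m*n≡1⇒n≡1 (rad (power mExp L)) (power zrExp L) (trans (rad*zr {L} wf) z≡1)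

  z-prime⇒zr≡1 : Prime (power mExp L) → power zrExp L ≡ 1
  z-prime⇒zr≡1 pz with prime⇒irreducible pz (subst (power zrExp L ∣_) (rad*zr {L} wf) (∣.n∣m*n (rad (power mExp L))))
  ... | inj₁ zr≡1 = zr≡1
  ... | inj₂ zr≡z = contradiction (∣.∣1⇒≡1 (subst (power mExp L ∣_) rad≡1
      (LAₚ.∈⇒∣product (∈-primeDivisors⁺ pz (∣.∣-refl {power mExp L}))))) (prime≢1 pz)
    where
    rad≡1 : rad (power mExp L) ≡ 1
    rad≡1 = *-cancelʳ-≡ (rad (power mExp L)) 1 (power mExp L)
        (trans (subst (λ x → rad (power mExp L) * x ≡ power mExp L) zr≡z (rad*zr {L} wf)) (sym (*-identityˡ (power mExp L))))

  GCD-by-cases : Case₁ L → Case₂ L → Case₃ L → GCD (NOf L) (C (NOf L) (dOf L)) ≡ 𝔤₂ (NOf L) (dOf L)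
  GCD-by-cases h₁ h₂ h₃ = trans (GCD-cusp {L} wf)
    (𝔤₂-by-cases (NOf L) (dOf L) (power mExp L) (power zrExp L) (G L) (z≡ {L} wf) z≡1⇒zr≡1 z-prime⇒zr≡1 z÷rad h₁ h₂ h₃)

  G≡1 : Degenerate L → G L ≡ 1
  G≡1 dg = Divides-degenerate wf dg (∣G⇒Divides wf ∣.∣-refl)

  mid⇒∣z : ∀ {p f′ k} → (p , mid f′ k) ∈ L → p ∣ power mExp L
  mid⇒∣z {p} {f′} {k} l∈L = ∣.∣-trans (∣.m∣m*n (p ^ (f′ ⊓ k))) (∈⇒∣power mExp l∈L)

  mid⇒z≢1 : ∀ {p f′ k} → (p , mid f′ k) ∈ L → power mExp L ≢ 1
  mid⇒z≢1 {p} l∈L z≡1 = prime≢1 (All.lookup (proj₂ wf) l∈L) (∣.∣1⇒≡1 (subst (p ∣_) z≡1 (mid⇒∣z l∈L)))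

  mid⇒z≡p : ∀ {p f′ k} → (p , mid f′ k) ∈ L → Prime (power mExp L) → p ≡ power mExp L
  mid⇒z≡p l∈L pz = prime-∣⇒≡ (All.lookup (proj₂ wf) l∈L) pz (mid⇒∣z l∈L)

  -- The exponent of the prime z in d is 1 while that of p is not, so z differs from p and dividing
  -- by z leaves p ^ k intact.
  square-∣-quotient : ∀ {p s} k → (p , s) ∈ L → fExp s ≢ 1 → p ^ k ∣ dOf L → Prime (power mExp L) → val (power mExp L) (dOf L) ≡ 1 →
      p ^ k ∣ dOf L ÷ power mExp L
  square-∣-quotient {p} {s} k l∈L f≢1 h pz v≡1 with val-split {power mExp L} {dOf L} pz {{power≢0 fExp (proj₂ wf)}}
  ... | m , d≡ , z∤m = subst (p ^ k ∣_) (sym (÷-≡ (dOf L) (power mExp L) m d≡zm))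
      (coprime-to-power 1 pz z∤p^k (subst (p ^ k ∣_) (trans d≡zm (cong (_* m) (sym (*-identityʳ (power mExp L))))) h))
    where
    d≡zm : dOf L ≡ power mExp L * m
    d≡zm = trans d≡ (cong (_* m) (trans (cong ((power mExp L) ^_) v≡1) (*-identityʳ (power mExp L))))
    z∤p^k : ¬ power mExp L ∣ p ^ k
    z∤p^k = ∤-^ pz (All.lookup (proj₂ wf) l∈L) (λ z≡p → f≢1 (trans (sym (val-power fExp wf l∈L))
        (trans (cong (λ q → val q (dOf L)) (sym z≡p)) v≡1))) k

  -- p ∣ z excludes z = 1, and a prime z must be p. Then gcd(z, 𝔤(d/z)) divides p, and it divides q
  -- because q² still divides d/z.
  mid-full : ∀ {p q k L′} → L ↭ (p , mid 0 k) ∷ (q , full 1) ∷ L′ → GCD (NOf L) (C (NOf L) (dOf L)) ≡ 𝔤₂ (NOf L) (dOf L)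
  mid-full {p} {q} {k} {L′} π = GCD-by-cases
    (λ z≡1 → contradiction z≡1 (mid⇒z≢1 pl∈L))
    (λ pz v≡1 → trans (G≡1 dg) (sym (distinct-primes-coprime pp pq p≢q
      ( subst (gcd (power mExp L) (𝔤 (dOf L ÷ power mExp L)) ∣_) (sym (mid⇒z≡p pl∈L pz)) (gcd[m,n]∣m (power mExp L) _)
      , ∣.∣-trans (gcd[m,n]∣n (power mExp L) _) (𝔤-square-∣ pq
          (subst (_∣ dOf L ÷ power mExp L) (sym (p*p≡p^2 q)) (square-∣-quotient 2 ql∈L (λ ()) (∈⇒∣power fExp ql∈L) pz v≡1)))))))
    (λ _ _ → G≡1 dg)
    where
    dg : Degenerate L
    dg = two π mid full
    pl∈L = ↭ₚ.∈-resp-↭ (↭-sym π) (here refl)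
    ql∈L = ↭ₚ.∈-resp-↭ (↭-sym π) (there (here refl))
    pp = All.lookup (proj₂ wf) pl∈L
    pq = All.lookup (proj₂ wf) ql∈L
    p≢q = heads-distinct wf π

  -- G = 1 is already known, so each branch either computes 𝔤 to be 1 as well or refutes its
  -- hypotheses on z. For a fat `mid` prime, z prime would mean z = p, whose exponent in d is at
  -- least 2.
  GCD-degenerate : Degenerate L → GCD (NOf L) (C (NOf L) (dOf L)) ≡ 𝔤₂ (NOf L) (dOf L)
  GCD-degenerate dg@(fat {p} π (full {r″})) = GCD-by-cases
    (λ _ → trans (G≡1 dg) (sym (𝔤-cube pp p³∣d)))
    (λ pz v≡1 → trans (G≡1 dg) (sym (trans (cong (gcd (power mExp L)) (𝔤-cube pp (square-∣-quotient 3 l∈L (λ ()) p³∣d pz v≡1)))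
        (gcd-zeroʳ (power mExp L)))))
    (λ _ _ → G≡1 dg)
    where
    l∈L = ↭ₚ.∈-resp-↭ (↭-sym π) (here refl)
    pp = All.lookup (proj₂ wf) l∈L
    p³∣d : p ^ 3 ∣ dOf L
    p³∣d = ∣.∣-trans (^-∣ p (m≤m+n 3 r″)) (∈⇒∣power fExp l∈L)
  GCD-degenerate dg@(fat {p} π (mid {f″} {k})) = GCD-by-cases
    (λ z≡1 → contradiction z≡1 (mid⇒z≢1 l∈L))
    (λ pz v≡1 → contradiction (trans (sym (val-power fExp wf l∈L)) (trans (cong (λ q → val q (dOf L)) (mid⇒z≡p l∈L pz)) v≡1)) λ ())
    (λ _ _ → G≡1 dg)
    where
    l∈L = ↭ₚ.∈-resp-↭ (↭-sym π) (here refl)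
  GCD-degenerate dg@(two {p} {_} {q} π full full) = GCD-by-cases
    (λ _ → trans (G≡1 dg) (sym (𝔤≡1 (square pl∈L) (square ql∈L))))
    (λ pz v≡1 → trans (G≡1 dg) (sym (trans (cong (gcd (power mExp L))
      (𝔤≡1 (quotient pl∈L pz v≡1) (quotient ql∈L pz v≡1))) (gcd-zeroʳ (power mExp L)))))
    (λ _ _ → G≡1 dg)
    where
    pl∈L = ↭ₚ.∈-resp-↭ (↭-sym π) (here refl)
    ql∈L = ↭ₚ.∈-resp-↭ (↭-sym π) (there (here refl))
    pp = All.lookup (proj₂ wf) pl∈L
    pq = All.lookup (proj₂ wf) ql∈L
    p≢q = heads-distinct wf π
    square : ∀ {p} → (p , full 1) ∈ L → p * p ∣ dOf L
    square {p} l∈L = subst (_∣ dOf L) (sym (p*p≡p^2 p)) (∈⇒∣power fExp l∈L)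
    quotient : ∀ {p} → (p , full 1) ∈ L → Prime (power mExp L) → val (power mExp L) (dOf L) ≡ 1 → p * p ∣ dOf L ÷ power mExp L
    quotient {p} l∈L pz v≡1 = subst (_∣ dOf L ÷ power mExp L) (sym (p*p≡p^2 p)) (square-∣-quotient 2 l∈L (λ ()) (∈⇒∣power fExp l∈L) pz v≡1)
    𝔤≡1 : ∀ {M} → p * p ∣ M → q * q ∣ M → 𝔤 M ≡ 1
    𝔤≡1 hp hq = distinct-primes-coprime pp pq p≢q (𝔤-square-∣ pp hp , 𝔤-square-∣ pq hq)
  GCD-degenerate (two π mid full) = mid-full π
  GCD-degenerate (two π full mid) = mid-full (↭-trans π (swap _ _ ↭-refl))
  GCD-degenerate dg@(two {p} {_} {q} π mid mid) = GCD-by-cases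
    (λ z≡1 → contradiction z≡1 (mid⇒z≢1 pl∈L))
    (λ pz _ → contradiction (trans (mid⇒z≡p pl∈L pz) (sym (mid⇒z≡p ql∈L pz))) p≢q)
    (λ _ _ → G≡1 dg)
    where
    pl∈L = ↭ₚ.∈-resp-↭ (↭-sym π) (here refl)
    ql∈L = ↭ₚ.∈-resp-↭ (↭-sym π) (there (here refl))
    p≢q = heads-distinct wf π

-- Comparison of G with 𝔤(N, d): thin lists and one special prime.

ThinList : List Loc → Set
ThinList = All (Thin ∘ proj₂)

∈-support-thin : ∀ {p} L → ThinList L → p ∈ support fExp L → (p , full 0) ∈ L
∈-support-thin L th p∈ with ∈-support⁻ fExp L p∈
... | s , l∈L , ≢0 with All.lookup th l∈L
...   | absent = contradiction refl ≢0
...   | full   = l∈L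

sgn-length : ∀ {L} → ThinList L → sgn L ≡ -1ℤ ℤ.^ length (support fExp L)
sgn-length [] = refl
sgn-length {(p , _) ∷ L} (absent ∷ th) = sgn-length th
sgn-length {(p , _) ∷ L} (full ∷ th) = trans (cong ℤ.-_ (sgn-length th)) (sym (ℤₚ.-1*i≡-i _))

thin-mExp : ∀ {L} → ThinList L → power mExp L ≡ 1
thin-mExp [] = refl
thin-mExp {(p , _) ∷ L} (absent ∷ th) = trans (*-identityˡ (power mExp L)) (thin-mExp th)
thin-mExp {(p , _) ∷ L} (full ∷ th)   = trans (*-identityˡ (power mExp L)) (thin-mExp th)

thin-squarefree : ∀ {L} → WF L → ThinList L → Squarefree (dOf L)
thin-squarefree {L} wf@(_ , pL) th = square-∤⇒squarefree {{power≢0 fExp pL}} λ {p} pp p²∣d → absurd p pp p²∣d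
  where
  absurd : ∀ p → Prime p → ¬ p * p ∣ dOf L
  absurd p pp p²∣d with prime-∣-power fExp pp pL (∣.∣-trans (∣.m∣m*n p) p²∣d)
  ... | s , l∈L , f≢0 = go (All.lookup th l∈L) (subst (2 ≤_) (val-power fExp wf l∈L)
        (pow∣⇒≤val 2 pp {{power≢0 fExp pL}} (subst (_∣ dOf L) (p*p≡p^2 p) p²∣d))) 
    where
    go : Thin s → ¬ 2 ≤ fExp s
    go absent ()
    go full (s≤s ())

𝔤-squarefree-≢1 : ∀ M → M ≢ 1 → 𝔤-squarefree M ≡
  foldr gcd ∣ + M ℤ.+ -1ℤ ℤ.^ (length (primeDivisors M) ∸ 1) ∣ (map (λ p → p ^ 2 ∸ 1) (primeDivisors M))
𝔤-squarefree-≢1 0             M≢1 = refl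
𝔤-squarefree-≢1 1             M≢1 = contradiction refl M≢1
𝔤-squarefree-≢1 (suc (suc M)) M≢1 = refl

pos-square-∸1 : ∀ p → .{{NonZero p}} → + (p ^ 2 ∸ 1) ≡ + p ℤ.* + p ℤ.- 1ℤ
pos-square-∸1 p@(suc q) = trans (cong (λ x → + (x ∸ 1)) (sym (p*p≡p^2 p)))
  (trans (sym (ℤₚ.⊖-≥ {p * p} {1} (s≤s z≤n))) (cong (ℤ._- 1ℤ) (ℤₚ.pos-* p p)))

-- This is -(-1)^t = (-1)^(t-1). For t = 0 the truncated exponent t ∸ 1 would give the wrong sign,
-- whence the nonempty support.
product-condition : ∀ {L} → ThinList L → support fExp L ≢ [] →
  1ℤ ℤ.* + dOf L ℤ.- 1ℤ ℤ.* sgn L ≡ + dOf L ℤ.+ -1ℤ ℤ.^ (length (support fExp L) ∸ 1)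
product-condition {L} th ne with support fExp L | sgn-length th
... | []     | _  = contradiction refl ne
... | p ∷ ps | eq = trans (cong (λ s → 1ℤ ℤ.* + dOf L ℤ.- 1ℤ ℤ.* s) eq) (lemma (+ dOf L) (-1ℤ ℤ.^ length ps))
  where
  lemma : ∀ d e → 1ℤ ℤ.* d ℤ.- 1ℤ ℤ.* (-1ℤ ℤ.* e) ≡ d ℤ.+ e
  lemma = solve-∀

no-full⇒d≡1 : ∀ {L} → ThinList L → support fExp L ≡ [] → dOf L ≡ 1
no-full⇒d≡1 [] _ = refl
no-full⇒d≡1 {(p , _) ∷ L} (absent ∷ th) e = trans (*-identityˡ (dOf L)) (no-full⇒d≡1 th e)

no-full⇒Divides : ∀ {n L x} → ThinList L → support fExp L ≡ [] → Divides n L x x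
no-full⇒Divides {n} {x = x} [] _ = ∣-resp (sym (ℤₚ.+-inverseʳ x)) (∣-0 (+ n))
no-full⇒Divides (absent ∷ th) e i _ = no-full⇒Divides th e

squares⇒ : ∀ {n L} → ThinList L → (∀ {p} → p ∈ support fExp L → + n ∣ᶻ + p ℤ.* + p ℤ.- 1ℤ) → All (SquareIsOne n 1ℤ) L
squares⇒ {n} {L} th h = All.tabulate go
  where
  go : ∀ {l} → l ∈ L → SquareIsOne n 1ℤ l
  go {p , absent _} l∈ = tt
  go {p , full _}   l∈ = ∣-resp (sym (ℤₚ.*-identityʳ _)) (h (∈-support⁺ fExp l∈ λ ()))
  go {p , mid _ _}  l∈ = tt

∣𝔤-squarefree : ∀ {n L} → WF L → ThinList L → Divides n L 1ℤ 1ℤ → n ∣ 𝔤-squarefree (dOf L)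
∣𝔤-squarefree {n} {L} wf@(_ , pL) th h with dOf L ≟ 1
... | yes d≡1 = subst (λ d → n ∣ 𝔤-squarefree d) (sym d≡1) (n ∣.∣0)
... | no  d≢1 = subst (n ∣_) (sym (𝔤-squarefree-≢1 (dOf L) d≢1))
  (∣-foldr-gcd (primeDivisors (dOf L)) initial (λ {p} p∈ → square p p∈))
  where
  π = primeDivisors-power fExp wf
  start = + dOf L ℤ.+ -1ℤ ℤ.^ (length (primeDivisors (dOf L)) ∸ 1)
  initial : n ∣ (∣ start ∣)
  initial = ∣⇒∣ᵤ (∣-resp (trans (product-condition th (λ e → d≢1 (no-full⇒d≡1 th e)))
    (cong (λ t → + dOf L ℤ.+ -1ℤ ℤ.^ (t ∸ 1)) (sym (↭ₚ.↭-length π)))) (Divides⇒product th h))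
  square : ∀ p → p ∈ primeDivisors (dOf L) → n ∣ p ^ 2 ∸ 1
  square p p∈ with ∈-support-thin L th (↭ₚ.∈-resp-↭ π p∈)
  ... | l∈L = ∣⇒∣ᵤ (∣-resp (trans (ℤₚ.*-identityʳ _) (sym (pos-square-∸1 p {{prime⇒nonZero (All.lookup pL l∈L)}})))
    (All.lookup (Divides⇒squares th h) l∈L))

𝔤-squarefree⇒Divides : ∀ {n L} → WF L → ThinList L → n ∣ 𝔤-squarefree (dOf L) → Divides n L 1ℤ 1ℤ
𝔤-squarefree⇒Divides {n} {L} wf@(_ , pL) th h with support fExp L in eq
... | [] = no-full⇒Divides th eq
... | q ∷ qs = product⇒Divides th (squares⇒ th square) (∣-resp (sym (trans (product-condition th ne)
    (cong (λ t → + dOf L ℤ.+ -1ℤ ℤ.^ (t ∸ 1)) (sym (↭ₚ.↭-length π)))))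
    (∣ᵤ⇒∣ {+ n} {start} (∣.∣-trans h′ (foldr-gcd-∣-init (primeDivisors (dOf L))))))
  where
  π = primeDivisors-power fExp wf
  ne : support fExp L ≢ []
  ne e with () ← trans (sym eq) e
  d≢1 : dOf L ≢ 1
  d≢1 d≡1 with ∈-support-thin {q} L th (subst (q ∈_) (sym eq) (here refl))
  ... | l∈L = prime≢1 (All.lookup pL l∈L) (∣.∣1⇒≡1 (subst (q ∣_) d≡1 (∣.∣-trans (∣.m∣m*n 1) (∈⇒∣power fExp l∈L))))
  start = + dOf L ℤ.+ -1ℤ ℤ.^ (length (primeDivisors (dOf L)) ∸ 1)
  h′ : n ∣ foldr gcd (∣ start ∣) (map (λ p → p ^ 2 ∸ 1) (primeDivisors (dOf L)))
  h′ = subst (n ∣_) (𝔤-squarefree-≢1 (dOf L) d≢1) h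
  square : ∀ {p} → p ∈ support fExp L → + n ∣ᶻ + p ℤ.* + p ℤ.- 1ℤ
  square {p} p∈ = ∣-resp (pos-square-∸1 p {{prime⇒nonZero (All.lookup pL (∈-support-thin L th p∈))}})
    (∣ᵤ⇒∣ {+ n} {+ (p ^ 2 ∸ 1)} (∣.∣-trans h′ (foldr-gcd-∣ {f = λ p → p ^ 2 ∸ 1} (↭ₚ.∈-resp-↭ (↭-sym π) p∈))))

G-thin : ∀ {L} → WF L → ThinList L → G L ≡ 𝔤-squarefree (dOf L)
G-thin wf th = ≡-by-divisors (∣𝔤-squarefree wf th ∘ ∣G⇒Divides wf) (Divides⇒∣G wf ∘ 𝔤-squarefree⇒Divides wf th)

G-one : ∀ {p s L} → WF ((p , s) ∷ L) → Special s → ThinList L → G ((p , s) ∷ L) ≡ gcd p (𝔤-squarefree (dOf L))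
G-one {p} {s} {L} wf sp th = ≡-by-divisors to from
  where
  to : ∀ {n} → n ∣ G ((p , s) ∷ L) → n ∣ gcd p (𝔤-squarefree (dOf L))
  to h = gcd-greatest (Divides-special {L = L} sp h′) (∣𝔤-squarefree (WF-tail wf) th (Divides-tail {p = p} sp h′))
    where
    h′ = ∣G⇒Divides wf h
  from : ∀ {n} → n ∣ gcd p (𝔤-squarefree (dOf L)) → n ∣ G ((p , s) ∷ L)
  from h = Divides⇒∣G wf (Divides-cons sp (∣.∣-trans h (gcd[m,n]∣m p _))
    (𝔤-squarefree⇒Divides (WF-tail wf) th (∣.∣-trans h (gcd[m,n]∣n p _))))

GCD-thin : ∀ {L} → WF L → ThinList L → GCD (NOf L) (C (NOf L) (dOf L)) ≡ 𝔤₂ (NOf L) (dOf L)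
GCD-thin {L} wf th = GCD-by-cases {L} wf case₁ case₂ case₃
  where
  case₁ : Case₁ L
  case₁ _ = trans (G-thin {L} wf th) (sym (𝔤-of-squarefree {dOf L} (thin-squarefree {L} wf th)))
  case₂ : Case₂ L
  case₂ pz _ = contradiction (thin-mExp th) (prime≢1 pz)
  case₃ : Case₃ L
  case₃ z≢1 _ = contradiction (thin-mExp th) z≢1

GCD-full : ∀ {p L} → WF ((p , full 1) ∷ L) → ThinList L → 
           GCD (NOf ((p , full 1) ∷ L)) (C (NOf ((p , full 1) ∷ L)) (dOf ((p , full 1) ∷ L))) ≡ 𝔤₂ (NOf ((p , full 1) ∷ L))
               (dOf ((p , full 1) ∷ L))
GCD-full {p} {L} wf@(ap ∷ _ , pp ∷ pL) th = GCD-by-cases {(p , full 1) ∷ L} wf case₁ case₂ case₃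
  where
  z≡1 : power mExp ((p , full 1) ∷ L) ≡ 1
  z≡1 = trans (*-identityˡ (power mExp L)) (thin-mExp th)
  coprime : Coprimality.Coprime (dOf L) p
  coprime (e∣d , e∣p) with prime⇒irreducible pp e∣p
  ... | inj₁ e≡1  = e≡1
  ... | inj₂ refl = contradiction e∣d (∤-power fExp pp ap pL)
  pst : PrimeSquareTimes (dOf ((p , full 1) ∷ L)) p (dOf L)
  pst = trans (*-comm (p ^ 2) (dOf L)) (cong (dOf L *_) (sym (p*p≡p^2 p)))
      , pp , Coprimality.coprime⇒gcd≡1 coprime , thin-squarefree (WF-tail wf) th
  case₁ : Case₁ ((p , full 1) ∷ L)
  case₁ _ = trans (G-one {p} {full 1} {L} wf full th) (sym (𝔤-of-PST {dOf ((p , full 1) ∷ L)} {p} {dOf L} pst))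
  case₂ : Case₂ ((p , full 1) ∷ L)
  case₂ pz _ = contradiction z≡1 (prime≢1 pz)
  case₃ : Case₃ ((p , full 1) ∷ L)
  case₃ z≢1 _ = contradiction z≡1 z≢1

GCD-mid : ∀ {p k L} → WF ((p , mid 0 k) ∷ L) → ThinList L → 
          GCD (NOf ((p , mid 0 k) ∷ L)) (C (NOf ((p , mid 0 k) ∷ L)) (dOf ((p , mid 0 k) ∷ L))) ≡ 𝔤₂ (NOf ((p , mid 0 k) ∷ L))
              (dOf ((p , mid 0 k) ∷ L))
GCD-mid {p} {k} {L} wf@(ap ∷ _ , pp ∷ pL) th = GCD-by-cases {(p , mid 0 k) ∷ L} wf case₁ case₂ case₃
  where
  z≡p : power mExp ((p , mid 0 k) ∷ L) ≡ p
  z≡p = trans (cong (p ^ 1 *_) (thin-mExp th)) (trans (*-identityʳ (p ^ 1)) (*-identityʳ p))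
  d÷p : dOf ((p , mid 0 k) ∷ L) ÷ p ≡ dOf L
  d÷p = ÷-≡ (dOf ((p , mid 0 k) ∷ L)) p (dOf L) {{prime⇒nonZero pp}} (cong (_* dOf L) (*-identityʳ p))
  G≡ : ∀ z → z ≡ p → G ((p , mid 0 k) ∷ L) ≡ gcd z (𝔤 (dOf ((p , mid 0 k) ∷ L) ÷ z))
  G≡ z refl = trans (G-one {p} {mid 0 k} {L} wf mid th)
    (cong (gcd p) (sym (trans (cong 𝔤 d÷p) (𝔤-of-squarefree {dOf L} (thin-squarefree {L} (WF-tail wf) th)))))
  case₁ : Case₁ ((p , mid 0 k) ∷ L)
  case₁ z≡1 = contradiction (trans (sym z≡p) z≡1) (prime≢1 pp)
  case₂ : Case₂ ((p , mid 0 k) ∷ L)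
  case₂ _ _ = G≡ (power mExp ((p , mid 0 k) ∷ L)) z≡p
  case₃ : Case₃ ((p , mid 0 k) ∷ L)
  case₃ _ h = contradiction (subst Prime (sym z≡p) pp , trans (cong (λ z → val z (dOf ((p , mid 0 k) ∷ L))) z≡p)
      (val-power fExp wf (here refl))) h

GCD-one : ∀ {p s L} → WF ((p , s) ∷ L) → Special s → ThinList L →
          GCD (NOf ((p , s) ∷ L)) (C (NOf ((p , s) ∷ L)) (dOf ((p , s) ∷ L))) ≡ 𝔤₂ (NOf ((p , s) ∷ L)) (dOf ((p , s) ∷ L))
GCD-one {p} {_} {L} wf full      th = GCD-full {p} {L} wf th
GCD-one {p} {_} {L} wf (mid {k}) th = GCD-mid {p} {k} {L} wf th

transfer : ∀ (Q : ℕ → ℕ → Set) N N′ d d′ → N ≡ N′ → d ≡ d′ → Q N′ d′ → Q N d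
transfer Q N N′ d d′ refl refl h = h

GCD-theorem : ∀ L → WF L → GCD (NOf L) (C (NOf L) (dOf L)) ≡ 𝔤₂ (NOf L) (dOf L)
GCD-theorem L wf = go (classify L)
  where
  go : Class L → GCD (NOf L) (C (NOf L) (dOf L)) ≡ 𝔤₂ (NOf L) (dOf L)
  go (thin th)       = GCD-thin {L} wf th
  go (degenerate dg) = GCD-degenerate {L} wf dg
  go (one {p} {s} {L′} π sp th) = transfer (λ N d → GCD N (C N d) ≡ 𝔤₂ N d) (NOf L) (NOf ((p , s) ∷ L′)) (dOf L) (dOf ((p , s) ∷ L′))
    (power-↭ rExp π) (power-↭ fExp π) (GCD-one {p} {s} {L′} (WF-↭ π wf) sp th)

-- Divisibility by 0 is equality: G = 0 would force p = 0 at a special prime, or p² = 1 at a prime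
-- of d in the thin case. For d = 1 the divisor is zero and so is G.
G≢0 : ∀ {L} → WF L → dOf L ≢ 1 → G L ≢ 0
G≢0 {L} wf@(_ , pL) d≢1 G≡0 with classify L
... | degenerate dg = contradiction (trans (sym (G≡1 wf dg)) G≡0) λ ()
... | one {p} {s} {L′} π sp th with WF-↭ π wf
...   | _ , pp ∷ _ = contradiction (∣.0∣⇒≡0 (Divides-special {p = p} {L = L′} sp (Divides-↭ π h))) (≢-nonZero⁻¹ p {{prime⇒nonZero pp}})
  where
  h : Divides 0 L 1ℤ 1ℤ
  h = ∣G⇒Divides wf (subst (0 ∣_) (sym G≡0) ∣.∣-refl)
G≢0 {L} wf@(_ , pL) d≢1 G≡0 | thin th with support fExp L in eq
... | [] = d≢1 (no-full⇒d≡1 th eq)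
... | p ∷ _ with ∈-support-thin {p} L th (subst (p ∈_) (sym eq) (here refl))
...   | l∈L = prime≢1 pp (m*n≡1⇒m≡1 p p (ℤₚ.+-injective (trans (ℤₚ.pos-* p p) (ℤₚ.i-j≡0⇒i≡j _ _
        (ℤ∣.0∣⇒≡0 (∣-resp (ℤₚ.*-identityʳ _) (All.lookup (Divides⇒squares th h) l∈L)))))))
  where
  pp = All.lookup pL l∈L
  h : Divides 0 L 1ℤ 1ℤ
  h = ∣G⇒Divides wf (subst (0 ∣_) (sym G≡0) ∣.∣-refl)

-- Parity of integers and odd primes modulo 4.

Even : ℤ → Set
Even x = + 2 ∣ᶻ x

even? : ∀ x → Dec (Even x)
even? x = + 2 ℤ∣.∣? x

even-* : ∀ a b → Even (a ℤ.* b) → Even a ⊎ Even b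
even-* a b h with euclidsLemma ∣ a ∣ ∣ b ∣ prime[2] (subst (2 ∣_) (ℤₚ.abs-* a b) (∣⇒∣ᵤ h))
... | inj₁ h′ = inj₁ (∣ᵤ⇒∣ {+ 2} {a} h′)
... | inj₂ h′ = inj₂ (∣ᵤ⇒∣ {+ 2} {b} h′)

odd-* : ∀ a b → ¬ Even a → ¬ Even b → ¬ Even (a ℤ.* b)
odd-* a b ¬a ¬b h with even-* a b h
... | inj₁ h′ = ¬a h′
... | inj₂ h′ = ¬b h′

¬even-1 : ¬ Even 1ℤ
¬even-1 h with () ← ∣.∣1⇒≡1 (∣⇒∣ᵤ h)

∣-*-mono : ∀ {a b c d} → a ∣ᶻ b → c ∣ᶻ d → a ℤ.* c ∣ᶻ b ℤ.* d
∣-*-mono {a} {b} {c} {d} a∣b c∣d = ℤ∣.∣-trans (ℤ∣.*-monoˡ-∣ c a∣b) (ℤ∣.*-monoʳ-∣ b c∣d)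

-- Write X = k g, o c = v g and X = u (2 c). Then o k g = o X = 2 u o c = 2 u v g, and cancelling g
-- shows that o k, hence k, is even.
double-lift : ∀ {g X} o c → g ≢ 0 → + g ∣ᶻ X → + g ∣ᶻ o ℤ.* c → ¬ Even o → + 2 ℤ.* c ∣ᶻ X → + (2 * g) ∣ᶻ X
double-lift {g} {X} o c g≢0 (divides k X≡) (divides v oc≡) odd (divides u X≡′) =
  ∣-resp (sym X≡) (subst (_∣ᶻ k ℤ.* + g) (sym (ℤₚ.pos-* 2 g)) (ℤ∣.*-monoˡ-∣ (+ g) even-k))
  where
  instance g-nonZero = ℤ.≢-nonZero {+ g} (g≢0 ∘ ℤₚ.+-injective)
  lemma₁ : ∀ o k g → o ℤ.* k ℤ.* g ≡ o ℤ.* (k ℤ.* g)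
  lemma₁ = solve-∀
  lemma₂ : ∀ o u c → o ℤ.* (u ℤ.* (+ 2 ℤ.* c)) ≡ + 2 ℤ.* u ℤ.* (o ℤ.* c)
  lemma₂ = solve-∀
  lemma₃ : ∀ u v g → + 2 ℤ.* u ℤ.* (v ℤ.* g) ≡ u ℤ.* v ℤ.* + 2 ℤ.* g
  lemma₃ = solve-∀
  ok≡ : o ℤ.* k ≡ u ℤ.* v ℤ.* + 2
  ok≡ = ℤₚ.*-cancelʳ-≡ (o ℤ.* k) (u ℤ.* v ℤ.* + 2) (+ g) (trans (lemma₁ o k (+ g)) (trans (cong (o ℤ.*_) (trans (sym X≡) X≡′))
    (trans (lemma₂ o u c) (trans (cong (+ 2 ℤ.* u ℤ.*_) oc≡) (lemma₃ u v (+ g))))))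
  even-k : Even k
  even-k with even-* o k (divides (u ℤ.* v) ok≡)
  ... | inj₁ h = contradiction h odd
  ... | inj₂ h = h

double-lift-odd : ∀ {g X} → g ≢ 0 → + g ∣ᶻ X → ¬ Even (+ g) → Even X → + (2 * g) ∣ᶻ X
double-lift-odd {g} {X} g≢0 h odd even = double-lift (+ g) 1ℤ g≢0 h (∣-resp (sym (ℤₚ.*-identityʳ (+ g))) ℤ∣.∣-refl) odd even

data Residue (p : ℕ) : Set where
  one   : ∀ k → p % 4 ≡ 1 → + p ≡ + 1 ℤ.+ k ℤ.* + 4 → Residue p
  three : ∀ k → + p ≡ + 3 ℤ.+ k ℤ.* + 4 → Residue p

four-∣-suc : ∀ {p} k → + p ≡ + 3 ℤ.+ k ℤ.* + 4 → + 4 ∣ᶻ + p ℤ.+ 1ℤ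
four-∣-suc k e = divides (1ℤ ℤ.+ k) (trans (cong (ℤ._+ 1ℤ) e) (lemma k))
  where
  lemma : ∀ k → + 3 ℤ.+ k ℤ.* + 4 ℤ.+ 1ℤ ≡ (1ℤ ℤ.+ k) ℤ.* + 4
  lemma = solve-∀

odd-prime : ∀ {p} → Prime p → p ≢ 2 → ¬ 2 ∣ p
odd-prime pp p≢2 2∣p = p≢2 (sym (prime-∣⇒≡ prime[2] pp 2∣p))

residue : ∀ {p} → ¬ 2 ∣ p → Residue p
residue {p} 2∤p = go (p % 4) refl (DM.m%n<n p 4)
  where
  p≡ : ∀ {r} → p % 4 ≡ r → p ≡ r + (p / 4) * 4
  p≡ e = trans (DM.m≡m%n+[m/n]*n p 4) (cong (_+ (p / 4) * 4) e)
  p≡ᶻ : ∀ {r} → p % 4 ≡ r → + p ≡ + r ℤ.+ + (p / 4) ℤ.* + 4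
  p≡ᶻ {r} e = trans (cong +_ (p≡ e)) (cong (λ x → + r ℤ.+ x) (ℤₚ.pos-* (p / 4) 4))
  2∣4q : 2 ∣ (p / 4) * 4
  2∣4q = ∣.∣n⇒∣m*n (p / 4) (divides 2 refl)
  go : ∀ r → p % 4 ≡ r → r < 4 → Residue p
  go 0 e _ = contradiction (subst (2 ∣_) (sym (p≡ e)) 2∣4q) 2∤p
  go 1 e _ = one (+ (p / 4)) e (p≡ᶻ e)
  go 2 e _ = contradiction (subst (2 ∣_) (sym (p≡ e)) (∣.∣m∣n⇒∣m+n ∣.∣-refl 2∣4q)) 2∤p
  go 3 e _ = three (+ (p / 4)) (p≡ᶻ e)
  go (suc (suc (suc (suc r)))) e (s≤s (s≤s (s≤s (s≤s ()))))

odd-form : ∀ {p} → ¬ 2 ∣ p → ∃ λ k → + p ≡ + 1 ℤ.+ k ℤ.* + 2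
odd-form {p} 2∤p with residue 2∤p
... | one k _ e   = k ℤ.* + 2 , trans e (lemma k)
  where
  lemma : ∀ k → + 1 ℤ.+ k ℤ.* + 4 ≡ + 1 ℤ.+ k ℤ.* + 2 ℤ.* + 2
  lemma = solve-∀
... | three k e = + 1 ℤ.+ k ℤ.* + 2 , trans e (lemma k)
  where
  lemma : ∀ k → + 3 ℤ.+ k ℤ.* + 4 ≡ + 1 ℤ.+ (+ 1 ℤ.+ k ℤ.* + 2) ℤ.* + 2
  lemma = solve-∀

even-pred : ∀ {p} → ¬ 2 ∣ p → Even (+ p ℤ.- 1ℤ)
even-pred 2∤p with odd-form 2∤p
... | k , e = divides k (trans (cong (ℤ._- 1ℤ) e) (lemma k))
  where
  lemma : ∀ k → + 1 ℤ.+ k ℤ.* + 2 ℤ.- 1ℤ ≡ k ℤ.* + 2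
  lemma = solve-∀

even-suc : ∀ {p} → ¬ 2 ∣ p → Even (+ p ℤ.+ 1ℤ)
even-suc 2∤p with odd-form 2∤p
... | k , e = divides (1ℤ ℤ.+ k) (trans (cong (ℤ._+ 1ℤ) e) (lemma k))
  where
  lemma : ∀ k → + 1 ℤ.+ k ℤ.* + 2 ℤ.+ 1ℤ ≡ (1ℤ ℤ.+ k) ℤ.* + 2
  lemma = solve-∀

¬even-1+2k : ∀ k → ¬ Even (1ℤ ℤ.+ k ℤ.* + 2)
¬even-1+2k k h = ¬even-1 (∣-resp (lemma k) (ℤ∣.∣m∣n⇒∣m+n h (ℤ∣.∣n⇒∣m*n (ℤ.- k) ℤ∣.∣-refl)))
  where
  lemma : ∀ k → 1ℤ ℤ.+ k ℤ.* + 2 ℤ.+ (ℤ.- k) ℤ.* + 2 ≡ 1ℤ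
  lemma = solve-∀

∏total-↭ : ∀ {L L′} → L ↭ L′ → ∏total L ≡ ∏total L′
∏total-↭ Perm.refl = refl
∏total-↭ (prep (p , s) π) = cong (total p s ℤ.*_) (∏total-↭ π)
∏total-↭ {L′ = _ ∷ _ ∷ L′} (swap (p , s) (q , t) π) =
  trans (cong (λ x → total p s ℤ.* (total q t ℤ.* x)) (∏total-↭ π)) (ℤ*.x∙yz≈y∙xz (total p s) (total q t) (∏total L′))
∏total-↭ (Perm.trans π ρ) = trans (∏total-↭ π) (∏total-↭ ρ)

even-total : ∀ {p} s → ¬ 2 ∣ p → Even (total p s)
even-total (absent _) 2∤p = even-pred 2∤p
even-total (full _)   2∤p = even-pred 2∤p
even-total {p} (mid _ _)  2∤p = ℤ∣.∣m⇒∣m*n (+ p ℤ.- 1ℤ) (even-pred 2∤p)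

odd-∏total : ∀ {L} → All (Prime ∘ proj₁) L → ¬ Even (∏total L) → All (λ l → proj₁ l ≡ 2) L
odd-∏total [] odd = []
odd-∏total {(p , s) ∷ L} (pp ∷ pL) odd = p≡2 ∷ odd-∏total pL (λ h → odd (ℤ∣.∣n⇒∣m*n (total p s) h))
  where
  p≡2 : p ≡ 2
  p≡2 with p ≟ 2
  ... | yes e = e
  ... | no  p≢2 = contradiction (ℤ∣.∣m⇒∣m*n (∏total L) (even-total s (odd-prime pp p≢2))) odd

-- Every odd prime contributes an even coordinate sum, so all primes of L would equal 2, which is
-- already taken by p.
odd-∏total-apart : ∀ {p L} → p ≡ 2 → Apart p L → All (Prime ∘ proj₁) L → ¬ Even (∏total L) → L ≡ []
odd-∏total-apart {L = []}    p≡2 ap pL odd = refl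
odd-∏total-apart {L = _ ∷ _} p≡2 (p≢q ∷ _) pL odd = contradiction (trans p≡2 (sym (All.head (odd-∏total pL odd)))) p≢q

even-oddGap : ∀ {p} s → ¬ 2 ∣ p → Even (oddGap p s)
even-oddGap (absent _)  2∤p = ∣-0 (+ 2)
even-oddGap (full r′)   2∤p = ℤ∣.∣n⇒∣m*n (ℤ.- parity (suc r′)) (even-suc 2∤p)
even-oddGap {p} (mid f′ _) 2∤p = ℤ∣.∣n⇒∣m*n (1ℤ ℤ.- parity (suc f′) ℤ.* (+ p ℤ.+ 1ℤ)) (even-suc 2∤p)

-- Exceptional lists, odd G, and the special prime 2.

-- Among primes not dividing d only 2 has an odd coordinate sum, namely 2 - 1 = 1, so it may
-- accompany an exceptional d without changing the gap at an odd prime.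
data AtMostTwo : List Loc → Set where
  none : AtMostTwo []
  two  : ∀ {r′} → AtMostTwo ((2 , absent r′) ∷ [])

-- The lists of local data for which 𝔥 takes the value 2.
data Exceptional : List Loc → Set where
  power-full : ∀ {r′} → suc r′ % 2 ≡ 1 → Exceptional ((2 , full r′) ∷ [])
  power-two  : ∀ {k} → Exceptional ((2 , mid 0 k) ∷ [])
  power-mid  : ∀ {f′ k} → suc f′ % 2 ≡ 0 → Exceptional ((2 , mid f′ k) ∷ [])
  two-prime  : ∀ {p k} → p % 4 ≡ 1 → Exceptional ((p , full 0) ∷ (2 , mid 0 k) ∷ [])
  four-prime : ∀ {p} → p % 4 ≡ 1 → Exceptional ((p , full 0) ∷ (2 , full 1) ∷ [])
  odd-one    : ∀ {p E} → OddPrime p → AtMostTwo E → Exceptional ((p , full 0) ∷ E)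
  odd-two    : ∀ {p q E} → BalancedPrimes p q → AtMostTwo E → Exceptional ((p , full 0) ∷ (q , full 0) ∷ E)

-- The left alternative means that Pw at p is even. The right one is a property of the whole list,
-- and the two can hold together: an exceptional list may have an even Pw at some of its primes.
Outcome : ℕ → Shape → List Loc → Set
Outcome p s L = + (2 * G ((p , s) ∷ L)) ∣ᶻ gap p s L ⊎ ∃ λ L′ → ((p , s) ∷ L) ↭ L′ × Exceptional L′

parity-cases : ∀ n → (n % 2 ≡ 1 × parity n ≡ 1ℤ) ⊎ (n % 2 ≡ 0 × parity n ≡ 0ℤ)
parity-cases 0 = inj₂ (refl , refl)
parity-cases 1 = inj₁ (refl , refl)
parity-cases (suc (suc n)) with parity-cases n
... | inj₁ (a , b) = inj₁ (a , cong (λ x → 1ℤ ℤ.- (1ℤ ℤ.- x)) b)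
... | inj₂ (a , b) = inj₂ (a , cong (λ x → 1ℤ ℤ.- (1ℤ ℤ.- x)) b)

-- For odd p the factor p + 1 makes `oddGap` even, so p = 2. An odd product of coordinate sums then
-- leaves no other prime, and the parity of the exponent in d decides between the powers of 2.
odd-gap : ∀ {p s L} → WF ((p , s) ∷ L) → ¬ Even (gap p s L) → Exceptional ((p , s) ∷ L)
odd-gap {p} {s} {L} (ap ∷ _ , pp ∷ pL) odd = finish (p ≟ 2)
  where
  odd-∏ : ¬ Even (∏total L)
  odd-∏ h = odd (ℤ∣.∣n⇒∣m*n (oddGap p s) h)
  odd-g : ¬ Even (oddGap p s)
  odd-g h = odd (ℤ∣.∣m⇒∣m*n (∏total L) h)
  go : ∀ s → ¬ Even (oddGap 2 s) → Exceptional ((2 , s) ∷ [])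
  go (absent _) odd = contradiction (∣-0 (+ 2)) odd
  go (full r′) odd with parity-cases (suc r′)
  ... | inj₁ (a , _) = power-full a
  ... | inj₂ (_ , b) = contradiction (subst (λ x → Even ((ℤ.- x) ℤ.* + 3)) (sym b) (∣-0 (+ 2))) odd
  go (mid f′ k) odd with parity-cases (suc f′)
  ... | inj₂ (a , _) = power-mid a
  ... | inj₁ (_ , b) = contradiction (subst (λ x → Even ((1ℤ ℤ.- x ℤ.* + 3) ℤ.* + 3)) (sym b) (divides (ℤ.- + 3) refl)) odd
  finish : Dec (p ≡ 2) → Exceptional ((p , s) ∷ L)
  finish (no p≢2) = contradiction (even-oddGap s (odd-prime pp p≢2)) odd-g
  finish (yes refl) with odd-∏total-apart refl ap pL odd-∏
  ... | refl = go s odd-g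

G∣gap : ∀ {p s L} → WF ((p , s) ∷ L) → + G ((p , s) ∷ L) ∣ᶻ gap p s L
G∣gap {p} {s} {L} wf = divides (Pw p (NOf L⁺) (C (NOf L⁺) (dOf L⁺)))
  (trans (sym (Pw-gap {p} {s} {L} wf)) (ℤₚ.*-comm (+ G L⁺) (Pw p (NOf L⁺) (C (NOf L⁺) (dOf L⁺)))))
  where
  L⁺ = (p , s) ∷ L

outcome-odd : ∀ {p s L} → WF ((p , s) ∷ L) → G ((p , s) ∷ L) ≢ 0 → ¬ Even (+ G ((p , s) ∷ L)) → Outcome p s L
outcome-odd {p} {s} {L} wf g≢0 odd with even? (gap p s L)
... | yes even = inj₁ (double-lift-odd g≢0 (G∣gap {p} {s} {L} wf) odd even)
... | no  odd′ = inj₂ (_ , ↭-refl , odd-gap wf odd′)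

four-lift : ∀ {g X} → g ∣ 2 → + 4 ∣ᶻ X → + (2 * g) ∣ᶻ X
four-lift {g} g∣2 = ℤ∣.∣-trans (∣ᵤ⇒∣ {+ (2 * g)} {+ 4} (∣.*-monoʳ-∣ 2 g∣2))

∣-0* : ∀ n {a} x → a ≡ 0ℤ → n ∣ᶻ a ℤ.* x
∣-0* n x refl = ∣-resp (sym (ℤₚ.*-zeroˡ x)) (∣-0 n)

outcome-special-two : ∀ {s L} → WF ((2 , s) ∷ L) → Special s → G ((2 , s) ∷ L) ∣ 2 → Outcome 2 s L
-- The exponent of 2 in d is 2, and `parity 2` is 0, so `oddGap` vanishes.
outcome-special-two {_} {L} wf full g∣2 = inj₁ (∣-0* _ (∏total L) refl)
outcome-special-two {_} {L} wf@(ap ∷ _ , _ ∷ pL) mid g∣2 with even? (∏total L)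
-- The constant -6 is (1 - 3) · 3, the value of `oddGap` at 2 for exponent 1 in d.
... | yes even = inj₁ (four-lift g∣2 (∣-*-mono {+ 2} {ℤ.- + 6} (divides (ℤ.- + 3) refl) even))
... | no  odd with odd-∏total-apart refl ap pL odd
...   | refl = inj₂ (_ , ↭-refl , power-two)

-- As G ∣ 2, it suffices that 4 divides the gap -(p + 1) · `∏total L`. The factor p + 1 gives one 2,
-- and two of them if p is 3 modulo 4; a further odd prime gives another. What escapes is p
-- congruent to 1 modulo 4 with only 2 beside it.
outcome-beside-two : ∀ {p s u L L″} → WF ((p , s) ∷ L) → L ↭ (2 , u) ∷ L″ → Thin s → Special u →
                     G ((p , s) ∷ L) ∣ 2 → Outcome p s L
outcome-beside-two {L = L} wf π absent sp g∣2 = inj₁ (∣-0* _ (∏total L) refl)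
outcome-beside-two {p} {_} {u} {L} {L″} wf@(_ , pp ∷ _) π full sp g∣2 = go (even? (∏total L″)) (residue 2∤p)
  where
  2∤p : ¬ 2 ∣ p
  2∤p = odd-prime pp (heads-distinct wf (prep _ π))
  even-∏ : Even (∏total L″) → Even (∏total L)
  even-∏ h = ∣-resp (sym (∏total-↭ π)) (ℤ∣.∣n⇒∣m*n (total 2 u) h)
  exceptional : ∀ {u} → p % 4 ≡ 1 → Special u → Exceptional ((p , full 0) ∷ (2 , u) ∷ [])
  exceptional r full = four-prime r
  exceptional r mid  = two-prime r
  go : Dec (Even (∏total L″)) → Residue p → Outcome p (full 0) L
  go (yes even) _ = inj₁ (four-lift g∣2 (∣-*-mono {+ 2} {oddGap p (full 0)} (even-oddGap (full 0) 2∤p) (even-∏ even)))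
  go (no odd) (three k e) = inj₁ (four-lift g∣2 (ℤ∣.∣m⇒∣m*n (∏total L) (ℤ∣.∣n⇒∣m*n -1ℤ (four-∣-suc k e))))
  go (no odd) (one k r e) with WF-↭ π (WF-tail wf)
  ... | ap ∷ _ , _ ∷ pL″ with odd-∏total-apart refl ap pL″ odd
  ...   | refl = inj₂ (_ , prep _ π , exceptional r sp)

-- G divides the special prime t, so it is odd unless t = 2. In that case it matters whether Pw is
-- taken at 2 itself or at a thin prime beside it.
outcome-one : ∀ {p s t u L L′} → WF ((p , s) ∷ L) → G ((p , s) ∷ L) ≢ 0 →
              ((p , s) ∷ L) ↭ (t , u) ∷ L′ → Special u → ThinList L′ → Outcome p s L
outcome-one {p} {s} {t} {u} {L} {L′} wf g≢0 π sp th = go (t ≟ 2)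
  where
  G∣t : G ((p , s) ∷ L) ∣ t
  G∣t = Divides-special {L = L′} sp (Divides-↭ {x = 1ℤ} {1ℤ} π (∣G⇒Divides {L = (p , s) ∷ L} wf ∣.∣-refl))
  pt : Prime t
  pt with WF-↭ π wf
  ... | _ , pt ∷ _ = pt
  thin-head : p ≢ 2 → (p , s) ∈ (2 , u) ∷ L′ → Thin s
  thin-head p≢2 (here refl) = contradiction refl p≢2
  thin-head p≢2 (there h)   = All.lookup th h
  go : Dec (t ≡ 2) → Outcome p s L
  go (no t≢2) = outcome-odd wf g≢0 λ even → odd-prime pt t≢2 (∣.∣-trans (∣⇒∣ᵤ even) G∣t)
  go (yes refl) with ↭ₚ.∈-resp-↭ (↭-sym π) (here refl)
  ... | here refl = outcome-special-two wf sp G∣t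
  ... | there h with ∈⇒↭ h
  ...   | L″ , ρ = outcome-beside-two wf ρ (thin-head (heads-distinct wf (prep _ ρ)) (↭ₚ.∈-resp-↭ π (here refl))) sp G∣t

-- Two odd primes with unequal 2-adic valuations.

private
  ∣-power-split : ∀ a c → a ≢ c → (∃ λ k → c ≡ a + suc k) ⊎ (∃ λ k → a ≡ c + suc k)
  ∣-power-split zero    zero    a≢c = contradiction refl a≢c
  ∣-power-split zero    (suc c) a≢c = inj₁ (c , refl)
  ∣-power-split (suc a) zero    a≢c = inj₂ (a , refl)
  ∣-power-split (suc a) (suc c) a≢c with ∣-power-split a c (a≢c ∘ cong suc)
  ... | inj₁ (k , e) = inj₁ (k , cong suc e)
  ... | inj₂ (k , e) = inj₂ (k , cong suc e)

private
  smaller-valuation : ∀ {p q x y α γ} a k → ¬ Even q → x ≡ + (2 ^ a) ℤ.* α → y ≡ + (2 ^ (a + suc k)) ℤ.* γ → ¬ Even α →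
    ∃ λ o → ∃ λ m → p ℤ.* y ℤ.+ q ℤ.* x ≡ o ℤ.* m × ¬ Even o × m ∣ᶻ x × m ∣ᶻ y
  smaller-valuation {p} {q} {x} {y} {α} {γ} a k 2∤q x≡ y≡ 2∤α =
    p ℤ.* (K ℤ.* γ) ℤ.* + 2 ℤ.+ q ℤ.* α , M ,
    trans (cong₂ (λ y x → p ℤ.* y ℤ.+ q ℤ.* x) y≡′ x≡) (lemma M K p q α γ) ,
    (λ h → odd-* q α 2∤q 2∤α (ℤ∣.∣m+n∣m⇒∣n h (ℤ∣.∣n⇒∣m*n (p ℤ.* (K ℤ.* γ)) ℤ∣.∣-refl))) ,
    divides α (trans x≡ (ℤₚ.*-comm M α)) ,
    divides (+ 2 ℤ.* K ℤ.* γ) (trans y≡′ (lemma′ M K γ))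
    where
    M = + (2 ^ a)
    K = + (2 ^ k)
    y≡′ : y ≡ M ℤ.* (+ 2 ℤ.* K) ℤ.* γ
    y≡′ = trans y≡ (cong (ℤ._* γ) (trans (cong +_ (^-distribˡ-+-* 2 a (suc k)))
      (trans (ℤₚ.pos-* (2 ^ a) (2 ^ suc k)) (cong (M ℤ.*_) (ℤₚ.pos-* 2 (2 ^ k))))))
    lemma : ∀ M K p q α γ → p ℤ.* (M ℤ.* (+ 2 ℤ.* K) ℤ.* γ) ℤ.+ q ℤ.* (M ℤ.* α) ≡ (p ℤ.* (K ℤ.* γ) ℤ.* + 2 ℤ.+ q ℤ.* α) ℤ.* M
    lemma = solve-∀
    lemma′ : ∀ M K γ → M ℤ.* (+ 2 ℤ.* K) ℤ.* γ ≡ + 2 ℤ.* K ℤ.* γ ℤ.* M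
    lemma′ = solve-∀

-- If the 2-adic valuations of x and y differ, that of p y + q x is their minimum.
unequal-valuations : ∀ {p q x y α γ} a c → ¬ Even p → ¬ Even q → x ≡ + (2 ^ a) ℤ.* α → y ≡ + (2 ^ c) ℤ.* γ →
  ¬ Even α → ¬ Even γ → a ≢ c → ∃ λ o → ∃ λ m → p ℤ.* y ℤ.+ q ℤ.* x ≡ o ℤ.* m × ¬ Even o × m ∣ᶻ x × m ∣ᶻ y
unequal-valuations {p} {q} {x} {y} {α} {γ} a c 2∤p 2∤q x≡ y≡ 2∤α 2∤γ a≢c with ∣-power-split a c a≢c
... | inj₁ (k , refl) = smaller-valuation {p} {q} {x} {y} {α} {γ} a k 2∤q x≡ y≡ 2∤α
... | inj₂ (k , refl) with smaller-valuation {q} {p} {y} {x} {γ} {α} c k 2∤p y≡ x≡ 2∤γ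
...   | o , m , e , odd , m∣y , m∣x = o , m , trans (ℤₚ.+-comm (p ℤ.* y) (q ℤ.* x)) e , odd , m∣x , m∣y

pos-pred : ∀ {p} → Prime p → + (p ∸ 1) ≡ + p ℤ.- 1ℤ
pos-pred {zero}  pp = contradiction pp ¬prime[0]
pos-pred {suc p} pp = refl

pred≢0 : ∀ {p} → Prime p → NonZero (p ∸ 1)
pred≢0 {0} pp = contradiction pp ¬prime[0]
pred≢0 {1} pp = contradiction pp ¬prime[1]
pred≢0 {suc (suc p)} pp = _

val-2-split : ∀ n → .{{NonZero n}} → ∃ λ α → + n ≡ + (2 ^ val 2 n) ℤ.* α × ¬ Even α
val-2-split n with val-split {2} {n} prime[2]
... | m , n≡ , 2∤m = + m , trans (cong +_ n≡) (ℤₚ.pos-* (2 ^ val 2 n) m) , 2∤m ∘ ∣⇒∣ᵤ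

record TwoAdic (p : ℕ) : Set where
  field
    α β    : ℤ
    pred-≡ : + p ℤ.- 1ℤ ≡ + (2 ^ val 2 (p ∸ 1)) ℤ.* α
    suc-≡  : + p ℤ.+ 1ℤ ≡ + (2 ^ val 2 (p + 1)) ℤ.* β
    odd-α  : ¬ Even α
    odd-β  : ¬ Even β

twoAdic : ∀ {p} → Prime p → TwoAdic p
twoAdic {p} pp with val-2-split (p ∸ 1) {{pred≢0 pp}} | val-2-split (p + 1) {{≢-nonZero λ e → 1+n≢0 (trans (+-comm 1 p) e)}}
... | α , e , 2∤α | β , e′ , 2∤β = record
  { α = α ; β = β ; pred-≡ = trans (sym (pos-pred pp)) e ; suc-≡ = e′ ; odd-α = 2∤α ; odd-β = 2∤β }

-- p q − 1 = p (q − 1) + (p − 1) = p (q + 1) − (p + 1)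
two-primes-unbalanced : ∀ {g p q X} → g ≢ 0 → TwoAdic p → TwoAdic q → ¬ 2 ∣ p → ¬ 2 ∣ q →
  val 2 (p ∸ 1) ≢ val 2 (q ∸ 1) ⊎ val 2 (p + 1) ≢ val 2 (q + 1) →
  + g ∣ᶻ X → + g ∣ᶻ + p ℤ.* + q ℤ.- 1ℤ → (+ p ℤ.+ 1ℤ) ℤ.* (+ q ℤ.- 1ℤ) ∣ᶻ X → + (2 * g) ∣ᶻ X
two-primes-unbalanced {g} {p} {q} {X} g≢0 P Q 2∤p 2∤q h g∣X g∣pq-1 hX = go h
  where
  module P = TwoAdic P
  module Q = TwoAdic Q
  odd-p : ¬ Even (+ p)
  odd-p = 2∤p ∘ ∣⇒∣ᵤ
  lemma₁ : ∀ p q → p ℤ.* q ℤ.- 1ℤ ≡ p ℤ.* (q ℤ.- 1ℤ) ℤ.+ 1ℤ ℤ.* (p ℤ.- 1ℤ)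
  lemma₁ = solve-∀
  lemma₂ : ∀ p q → p ℤ.* q ℤ.- 1ℤ ≡ p ℤ.* (q ℤ.+ 1ℤ) ℤ.+ -1ℤ ℤ.* (p ℤ.+ 1ℤ)
  lemma₂ = solve-∀
  go : val 2 (p ∸ 1) ≢ val 2 (q ∸ 1) ⊎ val 2 (p + 1) ≢ val 2 (q + 1) → + (2 * g) ∣ᶻ X
  go (inj₁ a≢c) with unequal-valuations {+ p} {1ℤ} {+ p ℤ.- 1ℤ} {+ q ℤ.- 1ℤ} {P.α} {Q.α} (val 2 (p ∸ 1)) (val 2 (q ∸ 1)) odd-p ¬even-1 P.pred-≡
      Q.pred-≡ P.odd-α Q.odd-α a≢c
  ... | o , m , e , odd-o , _ , m∣q-1 = double-lift {g} {X} o m g≢0 g∣X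
    (∣-resp (trans (lemma₁ (+ p) (+ q)) e) g∣pq-1) odd-o (ℤ∣.∣-trans (∣-*-mono {+ 2} {+ p ℤ.+ 1ℤ} {m} {+ q ℤ.- 1ℤ} (even-suc 2∤p) m∣q-1) hX)
  go (inj₂ b≢e) with unequal-valuations {+ p} { -1ℤ} {+ p ℤ.+ 1ℤ} {+ q ℤ.+ 1ℤ} {P.β} {Q.β} (val 2 (p + 1)) (val 2 (q + 1))
      odd-p (¬even-1 ∘ ℤ∣.∣m⇒∣-m) P.suc-≡ Q.suc-≡ P.odd-β Q.odd-β b≢e
  ... | o , m , e , odd-o , m∣p+1 , _ = double-lift {g} {X} o m g≢0 g∣X
    (∣-resp (trans (lemma₂ (+ p) (+ q)) e) g∣pq-1) odd-o
    (ℤ∣.∣-trans (subst (_∣ᶻ (+ p ℤ.+ 1ℤ) ℤ.* (+ q ℤ.- 1ℤ)) (ℤₚ.*-comm m (+ 2))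
      (∣-*-mono {m} {+ p ℤ.+ 1ℤ} {+ 2} {+ q ℤ.- 1ℤ} m∣p+1 (even-pred 2∤q))) hX)

-- Thin lists with even G.

data Absent : Shape → Set where
  absent : ∀ {r′} → Absent (absent r′)

FullIn OddAbsentIn : List Loc → Set
FullIn L      = ∃ λ q → ∃ λ L₁ → L ↭ (q , full 0) ∷ L₁ × ThinList L₁
OddAbsentIn L = ∃ λ q → ∃ λ r′ → ∃ λ L₀ → L ↭ (q , absent r′) ∷ L₀ × ¬ 2 ∣ q

findFull : ∀ {L} → ThinList L → FullIn L ⊎ All (Absent ∘ proj₂) L
findFull [] = inj₂ []
findFull (_∷_ {p , _} full th) = inj₁ (p , _ , ↭-refl , th)
findFull (absent ∷ th) with findFull th
... | inj₁ (q , L₁ , π , th₁) = inj₁ (q , _ , swap-head π , absent ∷ th₁)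
... | inj₂ abs                = inj₂ (absent ∷ abs)

-- Of two distinct primes at least one is odd, so two entries suffice to find an odd absent prime.
absentView : ∀ {L} → WF L → All (Absent ∘ proj₂) L →
             AtMostTwo L ⊎ OddAbsentIn L
absentView wf [] = inj₁ none
absentView {(q , _) ∷ L} wf@(_ , pq ∷ _) (absent {r′} ∷ abs) with q ≟ 2
... | no q≢2 = inj₂ (q , r′ , L , ↭-refl , odd-prime pq q≢2)
absentView {(q , _) ∷ []} wf (absent ∷ []) | yes refl = inj₁ two
absentView {(q , _) ∷ (q′ , _) ∷ L} ((q≢q′ ∷ _) ∷ _ , _ ∷ pq′ ∷ _) (absent {r′} ∷ absent {r″} ∷ abs) | yes refl =
  inj₂ (q′ , r″ , (q , absent r′) ∷ L , swap _ _ ↭-refl , odd-prime pq′ (q≢q′ ∘ sym))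

Divides-drop-absent : ∀ {n q r′ L} → Divides n ((q , absent r′) ∷ L) 1ℤ 1ℤ → Divides n L 1ℤ 1ℤ
Divides-drop-absent {n} {q} {r′} {L} h = Divides-≡ L (lemma (+ q)) (lemma (+ q)) (Divides-scale L -1ℤ (h 1 (s≤s z≤n)))
  where
  lemma : ∀ q → -1ℤ ℤ.* (1ℤ ℤ.* (q ℤ.* 0ℤ ℤ.+ -1ℤ)) ≡ 1ℤ
  lemma = solve-∀

-- Removing q can only enlarge G in the sense of divisibility, and G of the shorter list divides the
-- shorter gap. Restoring q multiplies the gap by the even number q - 1.
outcome-odd-absent : ∀ {p s q r′ L L₀} → WF ((p , s) ∷ L) → L ↭ (q , absent r′) ∷ L₀ → ¬ 2 ∣ q → Outcome p s L
outcome-odd-absent {p} {s} {q} {r′} {L} {L₀} wf π 2∤q = inj₁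
  (subst₂ _∣ᶻ_ (sym (ℤₚ.pos-* 2 g)) (sym gap≡) (∣-*-mono {+ 2} {+ q ℤ.- 1ℤ} {+ g} {gap p s L₀} (even-pred 2∤q) g∣gap₀))
  where
  g = G ((p , s) ∷ L)
  ρ : (p , s) ∷ L ↭ (q , absent r′) ∷ (p , s) ∷ L₀
  ρ = swap-head π
  wf₀ : WF ((p , s) ∷ L₀)
  wf₀ = WF-tail (WF-↭ ρ wf)
  g∣G₀ : g ∣ G ((p , s) ∷ L₀)
  g∣G₀ = Divides⇒∣G {g} {(p , s) ∷ L₀} wf₀ (Divides-drop-absent {g} {q} {r′} {(p , s) ∷ L₀}
    (Divides-↭ {x = 1ℤ} {1ℤ} ρ (∣G⇒Divides {g} {(p , s) ∷ L} wf ∣.∣-refl)))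
  g∣gap₀ : + g ∣ᶻ gap p s L₀
  g∣gap₀ = ℤ∣.∣-trans (∣ᵤ⇒∣ {+ g} {+ G ((p , s) ∷ L₀)} g∣G₀) (G∣gap {p} {s} {L₀} wf₀)
  lemma : ∀ a b c → a ℤ.* (b ℤ.* c) ≡ b ℤ.* (a ℤ.* c)
  lemma = solve-∀
  gap≡ : gap p s L ≡ (+ q ℤ.- 1ℤ) ℤ.* gap p s L₀
  gap≡ = trans (cong (oddGap p s ℤ.*_) (∏total-↭ π)) (lemma (oddGap p s) (+ q ℤ.- 1ℤ) (∏total L₀))

square-even⇒odd : ∀ {q} → Even ((+ q ℤ.* + q ℤ.- 1ℤ) ℤ.* 1ℤ) → ¬ 2 ∣ q
square-even⇒odd {q} h 2∣q = ¬even-1 (∣-resp (lemma (+ q)) (ℤ∣.∣m∣n⇒∣m+n (ℤ∣.∣n⇒∣m*n (+ q) (∣ᵤ⇒∣ {+ 2} {+ q} 2∣q)) (ℤ∣.∣n⇒∣m*n -1ℤ h)))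
  where
  lemma : ∀ q → q ℤ.* q ℤ.+ -1ℤ ℤ.* ((q ℤ.* q ℤ.- 1ℤ) ℤ.* 1ℤ) ≡ 1ℤ
  lemma = solve-∀

AtMostTwo-d : ∀ {L} → AtMostTwo L → dOf L ≡ 1
AtMostTwo-d none = refl
AtMostTwo-d two  = refl

AtMostTwo-sgn : ∀ {L} → AtMostTwo L → sgn L ≡ 1ℤ
AtMostTwo-sgn none = refl
AtMostTwo-sgn two  = refl

AtMostTwo-total : ∀ {L} → AtMostTwo L → ∏total L ≡ 1ℤ
AtMostTwo-total none = refl
AtMostTwo-total two  = refl

AtMostTwo-thin : ∀ {L} → AtMostTwo L → ThinList L
AtMostTwo-thin none = []
AtMostTwo-thin two  = absent ∷ []

Three : Loc → Set
Three (q , full _) = + 4 ∣ᶻ + q ℤ.+ 1ℤ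
Three _            = ⊤

OddFull : Loc → Set
OddFull (q , full _) = ¬ 2 ∣ q
OddFull _            = ⊤

OneIn : List Loc → Set
OneIn L = ∃ λ c → ∃ λ k → ∃ λ M → L ↭ (c , full 0) ∷ M × + c ≡ + 1 ℤ.+ k ℤ.* + 4

findOne : ∀ {L} → ThinList L → All OddFull L → All Three L ⊎ OneIn L
findOne [] [] = inj₁ []
findOne (absent ∷ th) (_ ∷ od) with findOne th od
... | inj₁ h = inj₁ (tt ∷ h)
... | inj₂ (c , k , M , π , e) = inj₂ (c , k , _ , swap-head π , e)
findOne (_∷_ {c , _} full th) (2∤c ∷ od) with residue 2∤c
... | one k _ e = inj₂ (c , k , _ , ↭-refl , e)
... | three k e with findOne th od
...   | inj₂ (c , k , M , π , e) = inj₂ (c , k , _ , swap-head π , e)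
...   | inj₁ h = inj₁ (four-∣-suc k e ∷ h)

-- Every prime of d is -1 modulo 4, so d is congruent to (-1)^t.
four-∣-d-sgn : ∀ {L} → ThinList L → All Three L → + 4 ∣ᶻ + dOf L ℤ.- sgn L
four-∣-d-sgn [] [] = ∣-0 (+ 4)
four-∣-d-sgn {(q , _) ∷ L} (absent ∷ th) (_ ∷ h) = subst (λ d → + 4 ∣ᶻ + d ℤ.- sgn L) (sym (*-identityˡ (dOf L))) (four-∣-d-sgn th h)
four-∣-d-sgn {(q , _) ∷ L} (full ∷ th) (h₀ ∷ h) =
  subst (λ d → + 4 ∣ᶻ d ℤ.- (ℤ.- sgn L)) (sym (+[p*m] q (dOf L)))
    (∣-resp (lemma (+ q) (+ dOf L) (sgn L)) (∣-lin (+ dOf L) -1ℤ h₀ (four-∣-d-sgn th h)))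
  where
  lemma : ∀ q d s → d ℤ.* (q ℤ.+ 1ℤ) ℤ.+ -1ℤ ℤ.* (d ℤ.- s) ≡ q ℤ.* d ℤ.- (ℤ.- s)
  lemma = solve-∀

odd-sgn : ∀ {L} → ThinList L → ¬ Even (sgn L)
odd-sgn [] = ¬even-1
odd-sgn (absent ∷ th) = odd-sgn th
odd-sgn {(q , _) ∷ L} (full ∷ th) h = odd-sgn th (∣-resp (ℤₚ.neg-involutive (sgn L)) (ℤ∣.∣m⇒∣-m h))

-- Here g stands for G and X for the gap; p is the head and L the remaining local data.
module _ {p : ℕ} {L : List Loc} {g : ℕ} (g≢0 : g ≢ 0)
         (D : Divides g ((p , full 0) ∷ L) 1ℤ 1ℤ)
         (g∣X : + g ∣ᶻ gap p (full 0) L) where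

  private
    square : ∀ {q M} → ThinList M → (p , full 0) ∷ L ↭ (q , full 0) ∷ M → + g ∣ᶻ (+ q ℤ.* + q ℤ.- 1ℤ) ℤ.* 1ℤ
    square {q} {M} th π with Divides⇒squares {g} {(q , full 0) ∷ M} {1ℤ} {1ℤ} (full ∷ th)
        (Divides-↭ {g} {(p , full 0) ∷ L} {(q , full 0) ∷ M} {1ℤ} {1ℤ} π D)
    ... | h ∷ _ = h

  -- G divides p² - 1 = ((p - 1)/2) · 2 (p + 1), where (p - 1)/2 = 1 + 2 k is odd. The gap contains
  -- p + 1 times a multiple of 4.
  lift-three-head : ∀ k → ThinList L → + p ≡ + 3 ℤ.+ k ℤ.* + 4 → + 4 ∣ᶻ ∏total L → + (2 * g) ∣ᶻ gap p (full 0) L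
  lift-three-head k th e 4∣∏ = double-lift {g} (1ℤ ℤ.+ k ℤ.* + 2) (+ 2 ℤ.* (+ p ℤ.+ 1ℤ)) g≢0 g∣X
    (∣-resp (trans (cong (λ q → (q ℤ.* q ℤ.- 1ℤ) ℤ.* 1ℤ) e) (trans (lemma k)
        (cong (λ q → (1ℤ ℤ.+ k ℤ.* + 2) ℤ.* (+ 2 ℤ.* (q ℤ.+ 1ℤ))) (sym e)))) (square th ↭-refl))
    (¬even-1+2k k)
    (∣-resp (lemma′ (+ p) (∏total L)) (ℤ∣.∣n⇒∣m*n -1ℤ (subst (_∣ᶻ (+ p ℤ.+ 1ℤ) ℤ.* ∏total L) (lemma″ (+ p))
        (∣-*-mono {+ p ℤ.+ 1ℤ} {+ p ℤ.+ 1ℤ} {+ 4} {∏total L} ℤ∣.∣-refl 4∣∏))))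
    where
    lemma : ∀ k → ((+ 3 ℤ.+ k ℤ.* + 4) ℤ.* (+ 3 ℤ.+ k ℤ.* + 4) ℤ.- 1ℤ) ℤ.* 1ℤ ≡ (1ℤ ℤ.+ k ℤ.* + 2) ℤ.* (+ 2 ℤ.* (+ 3 ℤ.+ k ℤ.* + 4 ℤ.+ 1ℤ))
    lemma = solve-∀
    lemma′ : ∀ p t → -1ℤ ℤ.* ((p ℤ.+ 1ℤ) ℤ.* t) ≡ -1ℤ ℤ.* (p ℤ.+ 1ℤ) ℤ.* t
    lemma′ = solve-∀
    lemma″ : ∀ p → (p ℤ.+ 1ℤ) ℤ.* + 4 ≡ + 2 ℤ.* (+ 2 ℤ.* (p ℤ.+ 1ℤ))
    lemma″ = solve-∀

  -- G divides c² - 1 = ((c + 1)/2) · 2 (c - 1), where (c + 1)/2 = 1 + 2 k is odd. The gap contains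
  -- c - 1, the even p + 1 and one more even factor from M.
  lift-one-tail : ∀ {c M} k → ¬ 2 ∣ p → ThinList M → + c ≡ + 1 ℤ.+ k ℤ.* + 4 → L ↭ (c , full 0) ∷ M → Even (∏total M) →
                  + (2 * g) ∣ᶻ gap p (full 0) L
  lift-one-tail {c} {M} k 2∤p th e π 2∣∏ = double-lift {g} (1ℤ ℤ.+ k ℤ.* + 2) (+ 2 ℤ.* (+ c ℤ.- 1ℤ)) g≢0 g∣X
    (∣-resp (trans (cong (λ q → (q ℤ.* q ℤ.- 1ℤ) ℤ.* 1ℤ) e) (trans (lemma k)
        (cong (λ q → (1ℤ ℤ.+ k ℤ.* + 2) ℤ.* (+ 2 ℤ.* (q ℤ.- 1ℤ))) (sym e)))) (square {c} (full ∷ th) (swap-head π)))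
    (¬even-1+2k k)
    (∣-resp (sym gap≡) (ℤ∣.∣n⇒∣m*n -1ℤ (∣-*-mono {+ 2} {+ p ℤ.+ 1ℤ} (even-suc 2∤p) (∣-*-mono {+ 2} {∏total M} {+ c ℤ.- 1ℤ} 2∣∏ ℤ∣.∣-refl))))
    where
    lemma : ∀ k → ((+ 1 ℤ.+ k ℤ.* + 4) ℤ.* (+ 1 ℤ.+ k ℤ.* + 4) ℤ.- 1ℤ) ℤ.* 1ℤ ≡ (1ℤ ℤ.+ k ℤ.* + 2) ℤ.* (+ 2 ℤ.* (+ 1 ℤ.+ k ℤ.* + 4 ℤ.- 1ℤ))
    lemma = solve-∀
    lemma′ : ∀ p c t → -1ℤ ℤ.* (p ℤ.+ 1ℤ) ℤ.* ((c ℤ.- 1ℤ) ℤ.* t) ≡ -1ℤ ℤ.* ((p ℤ.+ 1ℤ) ℤ.* (t ℤ.* (c ℤ.- 1ℤ)))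
    lemma′ = solve-∀
    gap≡ : gap p (full 0) L ≡ -1ℤ ℤ.* ((+ p ℤ.+ 1ℤ) ℤ.* (∏total M ℤ.* (+ c ℤ.- 1ℤ)))
    gap≡ = trans (cong (oddGap p (full 0) ℤ.*_) (∏total-↭ π)) (lemma′ (+ p) (+ c) (∏total M))

  -- With p congruent to 1 and all other primes of d to 3 modulo 4, d - (-1)^t is congruent to 2 ·
  -- `sgn M` modulo 4, so it is 2 times an odd number, and 4 divides the gap.
  lift-three-tail : ∀ {M} k → ThinList M → + p ≡ + 1 ℤ.+ k ℤ.* + 4 → L ↭ M → All Three M → + 4 ∣ᶻ ∏total L →
                    + (2 * g) ∣ᶻ gap p (full 0) L
  lift-three-tail {M} k th e π ≡3 4∣∏ with four-∣-d-sgn th ≡3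
  ... | divides m d-s≡ = double-lift {g} (sgn M ℤ.+ (k ℤ.* + 2 ℤ.* + dOf M ℤ.+ m ℤ.* + 2)) (+ 2) g≢0 g∣X
    (∣-resp (trans (cong (λ d → 1ℤ ℤ.* d ℤ.- 1ℤ ℤ.* (ℤ.- sgn M)) (trans (+[p*m] p (dOf M)) (cong (ℤ._* + dOf M) e)))
      (trans (lemma k (+ dOf M) (sgn M)) (trans (cong (λ x → k ℤ.* + 4 ℤ.* + dOf M ℤ.+ x ℤ.+ + 2 ℤ.* sgn M) d-s≡)
          (lemma′ k m (+ dOf M) (sgn M)))))
      (Divides⇒product {g} {(p , full 0) ∷ M} {1ℤ} {1ℤ} (full ∷ th)
          (Divides-↭ {g} {(p , full 0) ∷ L} {(p , full 0) ∷ M} {1ℤ} {1ℤ} (prep (p , full 0) π) D)))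
    (λ h → odd-sgn th (ℤ∣.∣m+n∣n⇒∣m h (divides (k ℤ.* + dOf M ℤ.+ m) (lemma″ k m (+ dOf M)))))
    (ℤ∣.∣n⇒∣m*n (oddGap p (full 0)) 4∣∏)
    where
    lemma : ∀ k d s → 1ℤ ℤ.* ((+ 1 ℤ.+ k ℤ.* + 4) ℤ.* d) ℤ.- 1ℤ ℤ.* (ℤ.- s) ≡ k ℤ.* + 4 ℤ.* d ℤ.+ (d ℤ.- s) ℤ.+ + 2 ℤ.* s
    lemma = solve-∀
    lemma′ : ∀ k m d s → k ℤ.* + 4 ℤ.* d ℤ.+ m ℤ.* + 4 ℤ.+ + 2 ℤ.* s ≡ (s ℤ.+ (k ℤ.* + 2 ℤ.* d ℤ.+ m ℤ.* + 2)) ℤ.* + 2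
    lemma′ = solve-∀
    lemma″ : ∀ k m d → k ℤ.* + 2 ℤ.* d ℤ.+ m ℤ.* + 2 ≡ (k ℤ.* d ℤ.+ m) ℤ.* + 2
    lemma″ = solve-∀

  -- Two primes of d besides p make 4 divide the product of coordinate sums. The multiple of G is
  -- then p² - 1 if p is 3 modulo 4, c² - 1 if some other prime c of d is 1 modulo 4, and d - (-1)^t
  -- in the remaining case.
  lift-three-primes : ∀ {a b L₁ L₂} → ThinList L → ThinList L₁ → ThinList L₂ → L ↭ (a , full 0) ∷ L₁ → L₁ ↭ (b , full 0) ∷ L₂ →
                      ¬ 2 ∣ p → ¬ 2 ∣ a → ¬ 2 ∣ b → All OddFull L₂ → + (2 * g) ∣ᶻ gap p (full 0) L
  lift-three-primes {a} {b} {L₁} {L₂} th th₁ th₂ π₁ π₂ 2∤p 2∤a 2∤b od = go (residue 2∤p) (residue 2∤a) (residue 2∤b) (findOne th₂ od)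
    where
    even-b : Even (∏total L₁)
    even-b = ∣-resp (sym (∏total-↭ π₂)) (ℤ∣.∣m⇒∣m*n (∏total L₂) (even-pred 2∤b))
    4∣∏ : + 4 ∣ᶻ ∏total L
    4∣∏ = ∣-resp (sym (∏total-↭ π₁)) (∣-*-mono {+ 2} {+ a ℤ.- 1ℤ} (even-pred 2∤a) even-b)
    π : L ↭ (a , full 0) ∷ (b , full 0) ∷ L₂
    π = ↭-trans π₁ (prep _ π₂)
    go : Residue p → Residue a → Residue b → All Three L₂ ⊎ OneIn L₂ →
         + (2 * g) ∣ᶻ gap p (full 0) L
    go (three k e) _ _ _ = lift-three-head k th e 4∣∏
    go (one _ _ _) (one k _ e) _ _ = lift-one-tail k 2∤p th₁ e π₁ even-b
    go (one _ _ _) (three _ _) (one k _ e) _ = lift-one-tail k 2∤p (full ∷ th₂) e (↭-trans π (swap _ _ ↭-refl))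
      (ℤ∣.∣m⇒∣m*n (∏total L₂) (even-pred 2∤a))
    go (one _ _ _) (three _ _) (three _ _) (inj₂ (c , k , M , ρ , e)) with ↭ₚ.All-resp-↭ ρ th₂
    ... | _ ∷ thM = lift-one-tail k 2∤p (full ∷ full ∷ thM) e
      (↭-trans π (↭-trans (prep _ (swap-head ρ)) (swap _ _ ↭-refl)))
      (ℤ∣.∣m⇒∣m*n (total b (full 0) ℤ.* ∏total M) (even-pred 2∤a))
    go (one k _ e) (three ka ea) (three kb eb) (inj₁ h) =
      lift-three-tail k (full ∷ full ∷ th₂) e π (four-∣-suc ka ea ∷ four-∣-suc kb eb ∷ h) 4∣∏

dOf-pair : ∀ {p q E} → AtMostTwo E → + dOf ((p , full 0) ∷ (q , full 0) ∷ E) ≡ + p ℤ.* + q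
dOf-pair {p} {q} {E} two≥ = trans (+[p*m] p (dOf ((q , full 0) ∷ E))) (cong (+ p ℤ.*_)
  (trans (+[p*m] q (dOf E)) (trans (cong (λ d → + q ℤ.* + d) (AtMostTwo-d two≥)) (ℤₚ.*-identityʳ (+ q)))))

pair-condition : ∀ {g p q E} → AtMostTwo E → Divides g ((p , full 0) ∷ (q , full 0) ∷ E) 1ℤ 1ℤ → + g ∣ᶻ + p ℤ.* + q ℤ.- 1ℤ
pair-condition {g} {p} {q} {E} two≥ D = ∣-resp (trans (cong₂ (λ d s → 1ℤ ℤ.* d ℤ.- 1ℤ ℤ.* (ℤ.- (ℤ.- s))) (dOf-pair {p} {q} two≥) (AtMostTwo-sgn two≥))
    (lemma (+ p) (+ q)))
  (Divides⇒product {g} {(p , full 0) ∷ (q , full 0) ∷ E} {1ℤ} {1ℤ} (full ∷ full ∷ AtMostTwo-thin two≥) D)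
  where
  lemma : ∀ p q → 1ℤ ℤ.* (p ℤ.* q) ℤ.- 1ℤ ℤ.* (ℤ.- (ℤ.- 1ℤ)) ≡ p ℤ.* q ℤ.- 1ℤ
  lemma = solve-∀

unbalanced : ∀ {p q} → OddPrime p → OddPrime q → p ≢ q → ¬ BalancedPrimes p q →
             val 2 (p ∸ 1) ≢ val 2 (q ∸ 1) ⊎ val 2 (p + 1) ≢ val 2 (q + 1)
unbalanced {p} {q} op oq p≢q ¬b with val 2 (p ∸ 1) ≟ val 2 (q ∸ 1) | val 2 (p + 1) ≟ val 2 (q + 1)
... | no ≢  | _     = inj₁ ≢
... | yes _ | no ≢  = inj₂ ≢
... | yes e | yes f = contradiction (op , oq , p≢q , e , f) ¬b

outcome-two-primes : ∀ {p q L E} → WF ((p , full 0) ∷ L) → G ((p , full 0) ∷ L) ≢ 0 → L ↭ (q , full 0) ∷ E → AtMostTwo E →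
                     ¬ 2 ∣ p → ¬ 2 ∣ q → Outcome p (full 0) L
outcome-two-primes {p} {q} {L} {E} wf g≢0 π two≥ 2∤p 2∤q = go (WF-↭ (prep (p , full 0) π) wf) (balancedPrimes? p q)
  where
  g = G ((p , full 0) ∷ L)
  odd⇒ : ∀ {q} → Prime q → ¬ 2 ∣ q → OddPrime q
  odd⇒ pq 2∤q = pq , λ { refl → 2∤q ∣.∣-refl }
  gap≡ : gap p (full 0) L ≡ -1ℤ ℤ.* ((+ p ℤ.+ 1ℤ) ℤ.* (+ q ℤ.- 1ℤ))
  gap≡ = trans (cong (oddGap p (full 0) ℤ.*_) (trans (∏total-↭ π)
      (trans (cong ((+ q ℤ.- 1ℤ) ℤ.*_) (AtMostTwo-total two≥)) (ℤₚ.*-identityʳ _))))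
    (ℤₚ.*-assoc -1ℤ (+ p ℤ.+ 1ℤ) (+ q ℤ.- 1ℤ))
  go : WF ((p , full 0) ∷ (q , full 0) ∷ E) → Dec (BalancedPrimes p q) → Outcome p (full 0) L
  go _ (yes b) = inj₂ (_ , prep (p , full 0) π , odd-two b two≥)
  go ((p≢q ∷ _) ∷ _ , pp ∷ pq ∷ _) (no ¬b) = inj₁ (two-primes-unbalanced {g} {p} {q} {gap p (full 0) L} g≢0 (twoAdic pp)
      (twoAdic pq) 2∤p 2∤q
    (unbalanced (odd⇒ pp 2∤p) (odd⇒ pq 2∤q) p≢q ¬b) (G∣gap {p} {full 0} {L} wf)
    (pair-condition {g} {p} {q} {E} two≥ (Divides-↭ {g} {(p , full 0) ∷ L} {(p , full 0) ∷ (q , full 0) ∷ E} {1ℤ} {1ℤ} (prep (p , full 0) π)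
      (∣G⇒Divides {g} {(p , full 0) ∷ L} wf ∣.∣-refl)))
    (subst ((+ p ℤ.+ 1ℤ) ℤ.* (+ q ℤ.- 1ℤ) ∣ᶻ_) (sym gap≡) (ℤ∣.∣n⇒∣m*n -1ℤ ℤ∣.∣-refl)))

-- An even G divides q² - 1 for every prime q of d, so all of these are odd. The split is then by
-- whether d has zero, one or at least two primes besides p.
outcome-thin : ∀ {p s L} → WF ((p , s) ∷ L) → G ((p , s) ∷ L) ≢ 0 → Thin s → ThinList L → Outcome p s L
outcome-thin {L = L} wf g≢0 absent th = inj₁ (∣-0* _ (∏total L) refl)
outcome-thin {p} {_} {L} wf@(_ , pp ∷ pL) g≢0 full th = go (even? (+ g))
  where
  g = G ((p , full 0) ∷ L)
  D : Divides g ((p , full 0) ∷ L) 1ℤ 1ℤ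
  D = ∣G⇒Divides {g} {(p , full 0) ∷ L} wf ∣.∣-refl
  odd-full : Even (+ g) → ∀ {l} → SquareIsOne g 1ℤ l → OddFull l
  odd-full 2∣g {q , absent _} h = tt
  odd-full 2∣g {q , full _}   h = square-even⇒odd (ℤ∣.∣-trans 2∣g h)
  odd-full 2∣g {q , mid _ _}  h = tt
  fulls : Even (+ g) → All OddFull ((p , full 0) ∷ L)
  fulls 2∣g = All.map (λ {l} → odd-full 2∣g {l}) (Divides⇒squares {g} {(p , full 0) ∷ L} {1ℤ} {1ℤ} (full ∷ th) D)
  no-other : ¬ 2 ∣ p → AtMostTwo L ⊎ OddAbsentIn L → Outcome p (full 0) L
  no-other 2∤p (inj₁ two≥) = inj₂ (_ , ↭-refl , odd-one (pp , λ p≡2 → 2∤p (subst (2 ∣_) (sym p≡2) ∣.∣-refl)) two≥)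
  no-other 2∤p (inj₂ (q , r′ , L₀ , π , 2∤q)) = outcome-odd-absent {p} {full 0} {q} {r′} {L} {L₀} wf π 2∤q
  one-other : ∀ q L₁ → L ↭ (q , full 0) ∷ L₁ → ¬ 2 ∣ p → ¬ 2 ∣ q →
              AtMostTwo L₁ ⊎ OddAbsentIn L₁ → Outcome p (full 0) L
  one-other q L₁ π 2∤p 2∤q (inj₁ two≥) = outcome-two-primes {p} {q} {L} {L₁} wf g≢0 π two≥ 2∤p 2∤q
  one-other q L₁ π 2∤p 2∤q (inj₂ (q′ , r′ , L₀ , ρ , 2∤q′)) =
    outcome-odd-absent {p} {full 0} {q′} {r′} {L} {(q , full 0) ∷ L₀} wf (↭-trans π (swap-head ρ)) 2∤q′
  two-others : ∀ q L₁ → L ↭ (q , full 0) ∷ L₁ → ThinList L₁ → ¬ 2 ∣ p → All OddFull ((q , full 0) ∷ L₁) →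
               FullIn L₁ ⊎ All (Absent ∘ proj₂) L₁ → Outcome p (full 0) L
  two-others q L₁ π th₁ 2∤p (2∤q ∷ od₁) (inj₂ abs) = one-other q L₁ π 2∤p 2∤q (absentView (WF-tail (WF-↭ π (WF-tail wf))) abs)
  two-others q L₁ π th₁ 2∤p (2∤q ∷ od₁) (inj₁ (b , L₂ , ρ , th₂)) = lift (↭ₚ.All-resp-↭ ρ od₁)
    where
    lift : All OddFull ((b , full 0) ∷ L₂) → Outcome p (full 0) L
    lift (2∤b ∷ od₂) = inj₁ (lift-three-primes {p} {L} {g} g≢0 D (G∣gap {p} {full 0} {L} wf) {q} {b} {L₁} {L₂} th th₁ th₂ π ρ 2∤p
        2∤q 2∤b od₂)
  split : All OddFull ((p , full 0) ∷ L) → FullIn L ⊎ All (Absent ∘ proj₂) L → Outcome p (full 0) L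
  split (2∤p ∷ od) (inj₂ abs) = no-other 2∤p (absentView (WF-tail wf) abs)
  split (2∤p ∷ od) (inj₁ (q , L₁ , π , th₁)) = two-others q L₁ π th₁ 2∤p (↭ₚ.All-resp-↭ π od) (findFull th₁)
  go : Dec (Even (+ g)) → Outcome p (full 0) L
  go (no odd)  = outcome-odd {p} {full 0} {L} wf g≢0 odd
  go (yes 2∣g) = split (fulls 2∣g) (findFull th)

-- Outside the exceptional lists every Pw is even.

outcome : ∀ p s L → WF ((p , s) ∷ L) → dOf ((p , s) ∷ L) ≢ 1 → Outcome p s L
outcome p s L wf d≢1 = go (classify ((p , s) ∷ L))
  where
  g≢0 : G ((p , s) ∷ L) ≢ 0
  g≢0 = G≢0 {(p , s) ∷ L} wf d≢1
  go : Class ((p , s) ∷ L) → Outcome p s L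
  go (thin (h ∷ th)) = outcome-thin {p} {s} {L} wf g≢0 h th
  go (one π sp th)   = outcome-one {p} {s} wf g≢0 π sp th
  go (degenerate dg) = outcome-odd {p} {s} {L} wf g≢0 λ even → ¬even-1 (subst (λ g → Even (+ g)) (G≡1 {(p , s) ∷ L} wf dg) even)

Pw-even⇒ : ∀ {p s L} → WF ((p , s) ∷ L) → 2 ∣ ∣ Pw p (NOf ((p , s) ∷ L)) (C (NOf ((p , s) ∷ L)) (dOf ((p , s) ∷ L))) ∣ →
           + (2 * G ((p , s) ∷ L)) ∣ᶻ gap p s L
Pw-even⇒ {p} {s} {L} wf h = lemma (G ((p , s) ∷ L)) (Pw p (NOf ((p , s) ∷ L)) (C (NOf ((p , s) ∷ L)) (dOf ((p , s) ∷ L))))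
    (Pw-gap {p} {s} {L} wf) h
  where
  lemma : ∀ g w {x} → + g ℤ.* w ≡ x → 2 ∣ ∣ w ∣ → + (2 * g) ∣ᶻ x
  lemma g w refl h = subst₂ _∣ᶻ_ (sym (ℤₚ.pos-* 2 g)) (ℤₚ.*-comm w (+ g)) (ℤ∣.*-monoˡ-∣ (+ g) (∣ᵤ⇒∣ {+ 2} {w} h))

⇒Pw-even : ∀ {p s L} → WF ((p , s) ∷ L) → G ((p , s) ∷ L) ≢ 0 → + (2 * G ((p , s) ∷ L)) ∣ᶻ gap p s L →
           2 ∣ ∣ Pw p (NOf ((p , s) ∷ L)) (C (NOf ((p , s) ∷ L)) (dOf ((p , s) ∷ L))) ∣
⇒Pw-even {p} {s} {L} wf g≢0 h = lemma (G ((p , s) ∷ L)) (Pw p (NOf ((p , s) ∷ L)) (C (NOf ((p , s) ∷ L)) (dOf ((p , s) ∷ L)))) g≢0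
    (Pw-gap {p} {s} {L} wf) h
  where
  lemma : ∀ g w {x} → g ≢ 0 → + g ℤ.* w ≡ x → + (2 * g) ∣ᶻ x → 2 ∣ ∣ w ∣
  lemma g w g≢0 refl h = ∣⇒∣ᵤ (ℤ∣.*-cancelʳ-∣ (+ g) {+ 2} {w} {{ℤ.≢-nonZero {+ g} (g≢0 ∘ ℤₚ.+-injective)}}
    (subst₂ _∣ᶻ_ (ℤₚ.pos-* 2 g) (ℤₚ.*-comm (+ g) w) h))

Pw-absent : ∀ p N c → .{{NonZero N}} → Prime p → ¬ p ∣ N → Pw p N c ≡ 0ℤ
Pw-absent p N c pp p∤N = cong (λ l → sumℤ (map (𝕍 N c) l)) (Listₚ.filter-none (λ δ → val p δ % 2 ≟ 1) (All.tabulate even))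
  where
  even : ∀ {δ} → δ ∈ divisors N → ¬ val p δ % 2 ≡ 1
  even {δ} δ∈ h with trans (sym (cong (_% 2) (trans (cong (val p) (sym (*-identityˡ δ)))
      (val-≡ 0 pp (λ p∣δ → p∤N (∣.∣-trans p∣δ (∈-divisors⁻ {n = N} δ∈))))))) h
  ... | ()

all-even : ∀ L → WF L → dOf L ≢ 1 → ¬ (∃ λ L′ → L ↭ L′ × Exceptional L′) → AllPwEven (NOf L) (C (NOf L) (dOf L))
all-even L wf d≢1 ¬exc p pp with p ∣? NOf L
... | no  p∤N = subst (λ w → 2 ∣ ∣ w ∣) (sym (Pw-absent p (NOf L) (C (NOf L) (dOf L)) {{power≢0 rExp (proj₂ wf)}} pp p∤N)) (2 ∣.∣0)
... | yes p∣N with prime-∣-power rExp pp (proj₂ wf) p∣N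
...   | s , l∈L , _ with ∈⇒↭ l∈L
...     | L′ , π = transfer (λ N d → 2 ∣ ∣ Pw p N (C N d) ∣) (NOf L) (NOf ((p , s) ∷ L′)) (dOf L) (dOf ((p , s) ∷ L′)) (power-↭ rExp π) (power-↭ fExp π)
  (go (outcome p s L′ (WF-↭ π wf) (d≢1 ∘ trans (power-↭ fExp π))))
  where
  go : Outcome p s L′ → 2 ∣ ∣ Pw p (NOf ((p , s) ∷ L′)) (C (NOf ((p , s) ∷ L′)) (dOf ((p , s) ∷ L′))) ∣
  go (inj₁ h) = ⇒Pw-even {p} {s} {L′} (WF-↭ π wf) (G≢0 {(p , s) ∷ L′} (WF-↭ π wf) (d≢1 ∘ trans (power-↭ fExp π))) h
  go (inj₂ (L″ , ρ , exc)) = contradiction (L″ , ↭-trans π ρ , exc) ¬exc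

-- Every exceptional list has an odd Pw.

odd-ℤ : ∀ x → ¬ Even x → ∃ λ k → x ≡ 1ℤ ℤ.+ k ℤ.* + 2
odd-ℤ x odd = go (x ℤ.%ℕ 2) refl (ℤDM.n%ℕd<d x 2)
  where
  q = x ℤ./ℕ 2
  x≡ : ∀ {r} → x ℤ.%ℕ 2 ≡ r → x ≡ + r ℤ.+ q ℤ.* + 2
  x≡ e = trans (ℤDM.a≡a%ℕn+[a/ℕn]*n x 2) (cong (λ r → + r ℤ.+ q ℤ.* + 2) e)
  go : ∀ r → x ℤ.%ℕ 2 ≡ r → r < 2 → ∃ λ k → x ≡ 1ℤ ℤ.+ k ℤ.* + 2
  go 0 e _ = contradiction (divides q (trans (x≡ e) (ℤₚ.+-identityˡ (q ℤ.* + 2)))) odd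
  go 1 e _ = q , x≡ e
  go (suc (suc r)) e (s≤s (s≤s ()))

odd+odd : ∀ x y → ¬ Even x → ¬ Even y → Even (x ℤ.+ y)
odd+odd x y 2∤x 2∤y with odd-ℤ x 2∤x | odd-ℤ y 2∤y
... | k , refl | l , refl = divides (1ℤ ℤ.+ k ℤ.+ l) (lemma k l)
  where
  lemma : ∀ k l → 1ℤ ℤ.+ k ℤ.* + 2 ℤ.+ (1ℤ ℤ.+ l ℤ.* + 2) ≡ (1ℤ ℤ.+ k ℤ.+ l) ℤ.* + 2
  lemma = solve-∀

¬even-odd-1 : ∀ {p} → p % 4 ≡ 1 → ¬ 2 ∣ p
¬even-odd-1 {p} e 2∣p = contradiction (∣.∣1⇒≡1 (∣.∣m+n∣m⇒∣n
  (subst (2 ∣_) (trans (DM.m≡m%n+[m/n]*n p 4) (trans (cong (_+ (p / 4) * 4) e) (+-comm 1 ((p / 4) * 4)))) 2∣p)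
  (∣.∣n⇒∣m*n (p / 4) (divides 2 refl)))) λ ()

¬four-∣-suc : ∀ {p} → p % 4 ≡ 1 → ¬ + 4 ∣ᶻ + p ℤ.+ 1ℤ
¬four-∣-suc {p} e h = contradiction (∣⇒∣ᵤ {+ 4} {+ 2} (ℤ∣.∣m+n∣n⇒∣m {+ 4} {+ 2} {+ (p / 4) ℤ.* + 4}
    (∣-resp (trans (cong (ℤ._+ 1ℤ) p≡) (lemma (+ (p / 4)))) h)
    (ℤ∣.∣n⇒∣m*n (+ (p / 4)) (ℤ∣.∣-refl {+ 4})))) (from-no (4 ∣? 2))
  where
  p≡ : + p ≡ + 1 ℤ.+ + (p / 4) ℤ.* + 4
  p≡ = trans (cong +_ (trans (DM.m≡m%n+[m/n]*n p 4) (cong (_+ (p / 4) * 4) e))) (cong (λ x → + 1 ℤ.+ x) (ℤₚ.pos-* (p / 4) 4))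
  lemma : ∀ k → + 1 ℤ.+ k ℤ.* + 4 ℤ.+ 1ℤ ≡ + 2 ℤ.+ k ℤ.* + 4
  lemma = solve-∀

-- Refuting 2 G ∣ X only takes some n ∣ G with 2 n ∤ X, which avoids evaluating G.
∣-double : ∀ {n g x} → n ∣ g → + (2 * g) ∣ᶻ x → + (2 * n) ∣ᶻ x
∣-double {n} {g} n∣g = ℤ∣.∣-trans (∣ᵤ⇒∣ {+ (2 * n)} {+ (2 * g)} (∣.*-monoʳ-∣ 2 n∣g))

AtMostTwo-squares : ∀ {n E} → AtMostTwo E → All (SquareIsOne n 1ℤ) E
AtMostTwo-squares none = []
AtMostTwo-squares two  = tt ∷ []

-- With p the only prime of d, the product condition is n ∣ p + 1, and p² - 1 is a multiple of p +
-- 1.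
suc-∣-G : ∀ {n p E} → WF ((p , full 0) ∷ E) → AtMostTwo E → + n ∣ᶻ + p ℤ.+ 1ℤ → Divides n ((p , full 0) ∷ E) 1ℤ 1ℤ
suc-∣-G {n} {p} {E} wf two≥ h = product⇒Divides {n} {(p , full 0) ∷ E} {1ℤ} {1ℤ} (full ∷ AtMostTwo-thin two≥)
  (∣-resp (lemma₁ (+ p)) (ℤ∣.∣n⇒∣m*n (+ p ℤ.- 1ℤ) h) ∷ AtMostTwo-squares two≥)
  (∣-resp (sym (trans (cong₂ (λ d s → 1ℤ ℤ.* d ℤ.- 1ℤ ℤ.* (ℤ.- s))
      (trans (+[p*m] p (dOf E)) (trans (cong (λ d → + p ℤ.* + d) (AtMostTwo-d two≥)) (ℤₚ.*-identityʳ (+ p)))) (AtMostTwo-sgn two≥))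
          (lemma₂ (+ p)))) h)
  where
  lemma₁ : ∀ p → (p ℤ.- 1ℤ) ℤ.* (p ℤ.+ 1ℤ) ≡ (p ℤ.* p ℤ.- 1ℤ) ℤ.* 1ℤ
  lemma₁ = solve-∀
  lemma₂ : ∀ p → 1ℤ ℤ.* p ℤ.- 1ℤ ℤ.* (ℤ.- 1ℤ) ≡ p ℤ.+ 1ℤ
  lemma₂ = solve-∀

-- The right-hand side is the gap at p with the coordinate sum 1 of the prime 2 already computed.
-- Since 2 ∣ G, divisibility would give 4 ∣ p + 1.
odd-beside-special : ∀ {p u} → WF ((p , full 0) ∷ (2 , u) ∷ []) → Special u → p % 4 ≡ 1 →
  ¬ + (2 * G ((p , full 0) ∷ (2 , u) ∷ [])) ∣ᶻ (-1ℤ ℤ.* (+ p ℤ.+ 1ℤ)) ℤ.* 1ℤ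
odd-beside-special {p} {u} wf@(_ , pp ∷ _) sp e h = ¬four-∣-suc e (∣-resp (lemma (+ p)) (ℤ∣.∣n⇒∣m*n -1ℤ (∣-double {2} {G L} 2∣G h)))
  where
  L = (p , full 0) ∷ (2 , u) ∷ []
  lemma : ∀ p → -1ℤ ℤ.* ((-1ℤ ℤ.* (p ℤ.+ 1ℤ)) ℤ.* 1ℤ) ≡ p ℤ.+ 1ℤ
  lemma = solve-∀
  D₁ : Divides 2 ((p , full 0) ∷ []) 1ℤ 1ℤ
  D₁ = suc-∣-G (([] ∷ []) , (pp ∷ [])) none (even-suc (¬even-odd-1 e))
  2∣G : 2 ∣ G L
  2∣G = Divides⇒∣G {2} {L} wf (Divides-↭ {2} {(2 , u) ∷ (p , full 0) ∷ []} {L} {1ℤ} {1ℤ} (swap _ _ ↭-refl)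
    (Divides-cons {2} {2} {u} {(p , full 0) ∷ []} sp ∣.∣-refl D₁))

-- p - 1 and p + 1 are even and differ by 2, so they are not both divisible by 4.
valuation-one : ∀ {p α β} a b → p ℤ.- 1ℤ ≡ + (2 ^ a) ℤ.* α → p ℤ.+ 1ℤ ≡ + (2 ^ b) ℤ.* β →
                Even (p ℤ.- 1ℤ) → Even (p ℤ.+ 1ℤ) → ¬ Even α → ¬ Even β → a ≡ 1 ⊎ b ≡ 1
valuation-one {α = α} zero b e _ h _ 2∤α _ = contradiction (∣-resp (trans e (ℤₚ.*-identityˡ α)) h) 2∤α
valuation-one 1 b _ _ _ _ _ _ = inj₁ refl
valuation-one {β = β} (suc (suc a)) zero _ e _ h _ 2∤β = contradiction (∣-resp (trans e (ℤₚ.*-identityˡ β)) h) 2∤β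
valuation-one (suc (suc a)) 1 _ _ _ _ _ _ = inj₂ refl
valuation-one {p} {α} {β} (suc (suc a)) (suc (suc b)) e f _ _ _ _ = contradiction
  (∣⇒∣ᵤ (∣-resp (lemma p) (ℤ∣.∣m∣n⇒∣m-n (four b f) (four a e)))) (from-no (4 ∣? 2))
  where
  lemma : ∀ p → p ℤ.+ 1ℤ ℤ.- (p ℤ.- 1ℤ) ≡ + 2
  lemma = solve-∀
  four : ∀ c {x γ} → x ≡ + (2 ^ suc (suc c)) ℤ.* γ → + 4 ∣ᶻ x
  four c {x} {γ} e = ∣-resp (sym e) (ℤ∣.∣m⇒∣m*n γ (∣ᵤ⇒∣ {+ 4} {+ (2 ^ suc (suc c))} (subst (4 ∣_) (*-assoc 2 2 (2 ^ c)) (∣.m∣m*n (2 ^ c)))))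

-- One of a, b is 1. If a = 1, write p q - 1 = p (q + 1) - (p + 1) and take out 2^b; if b = 1, write
-- it as p (q - 1) + (p - 1) and take out 2^a. The cofactor combines two odd numbers and supplies
-- the missing factor 2.
balanced-divisors : ∀ {p q α β γ ε} a b →
  p ℤ.- 1ℤ ≡ + (2 ^ a) ℤ.* α → p ℤ.+ 1ℤ ≡ + (2 ^ b) ℤ.* β → q ℤ.- 1ℤ ≡ + (2 ^ a) ℤ.* γ → q ℤ.+ 1ℤ ≡ + (2 ^ b) ℤ.* ε →
  Even (p ℤ.- 1ℤ) → Even (p ℤ.+ 1ℤ) → ¬ Even p → ¬ Even α → ¬ Even β → ¬ Even γ → ¬ Even ε →
  + (2 ^ (a + b)) ∣ᶻ p ℤ.* q ℤ.- 1ℤ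
balanced-divisors {p} {q} {α} {β} {γ} {ε} a b eα eβ eγ eε h h′ 2∤p 2∤α 2∤β 2∤γ 2∤ε with valuation-one {p} {α} {β} a b eα eβ h h′ 2∤α 2∤β
... | inj₁ refl = subst₂ _∣ᶻ_ (sym (ℤₚ.pos-* 2 (2 ^ b))) (trans (lemma′ (+ (2 ^ b)) p β ε)
    (trans (cong₂ (λ x y → p ℤ.* x ℤ.- y) (sym eε) (sym eβ)) (lemma p q)))
  (∣-*-mono {+ 2} {p ℤ.* ε ℤ.+ (ℤ.- β)} {+ (2 ^ b)} {+ (2 ^ b)}
      (odd+odd (p ℤ.* ε) (ℤ.- β) (odd-* p ε 2∤p 2∤ε) (λ h → 2∤β (∣-resp (ℤₚ.neg-involutive β) (ℤ∣.∣m⇒∣-m h)))) ℤ∣.∣-refl)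
  where
  lemma : ∀ p q → p ℤ.* (q ℤ.+ 1ℤ) ℤ.- (p ℤ.+ 1ℤ) ≡ p ℤ.* q ℤ.- 1ℤ
  lemma = solve-∀
  lemma′ : ∀ B p β ε → (p ℤ.* ε ℤ.+ (ℤ.- β)) ℤ.* B ≡ p ℤ.* (B ℤ.* ε) ℤ.- B ℤ.* β
  lemma′ = solve-∀
... | inj₂ refl = subst₂ _∣ᶻ_ (trans (sym (ℤₚ.pos-* 2 (2 ^ a))) (cong (λ k → + (2 ^ k)) (+-comm 1 a)))
    (trans (lemma′ (+ (2 ^ a)) p α γ) (trans (cong₂ (λ x y → p ℤ.* x ℤ.+ y) (sym eγ) (sym eα)) (lemma p q)))
  (∣-*-mono {+ 2} {p ℤ.* γ ℤ.+ α} {+ (2 ^ a)} {+ (2 ^ a)} (odd+odd (p ℤ.* γ) α (odd-* p γ 2∤p 2∤γ) 2∤α) ℤ∣.∣-refl)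
  where
  lemma : ∀ p q → p ℤ.* (q ℤ.- 1ℤ) ℤ.+ (p ℤ.- 1ℤ) ≡ p ℤ.* q ℤ.- 1ℤ
  lemma = solve-∀
  lemma′ : ∀ A p α γ → (p ℤ.* γ ℤ.+ α) ℤ.* A ≡ p ℤ.* (A ℤ.* γ) ℤ.+ A ℤ.* α
  lemma′ = solve-∀

pow-+ : ∀ a b → + (2 ^ (a + b)) ≡ + (2 ^ a) ℤ.* + (2 ^ b)
pow-+ a b = trans (cong +_ (^-distribˡ-+-* 2 a b)) (ℤₚ.pos-* (2 ^ a) (2 ^ b))

square-divisor : ∀ {p α β} a b → p ℤ.- 1ℤ ≡ + (2 ^ a) ℤ.* α → p ℤ.+ 1ℤ ≡ + (2 ^ b) ℤ.* β → + (2 ^ (a + b)) ∣ᶻ (p ℤ.* p ℤ.- 1ℤ) ℤ.* 1ℤ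
square-divisor {p} {α} {β} a b eα eβ = divides (α ℤ.* β) (trans (lemma p) (trans (cong₂ ℤ._*_ eα eβ)
  (trans (lemma′ (+ (2 ^ a)) (+ (2 ^ b)) α β) (cong (α ℤ.* β ℤ.*_) (sym (pow-+ a b))))))
  where
  lemma : ∀ p → (p ℤ.* p ℤ.- 1ℤ) ℤ.* 1ℤ ≡ (p ℤ.- 1ℤ) ℤ.* (p ℤ.+ 1ℤ)
  lemma = solve-∀
  lemma′ : ∀ A B α β → A ℤ.* α ℤ.* (B ℤ.* β) ≡ α ℤ.* β ℤ.* (A ℤ.* B)
  lemma′ = solve-∀

odd-cofactor : ∀ {p q β γ} a b → p ℤ.+ 1ℤ ≡ + (2 ^ b) ℤ.* β → q ℤ.- 1ℤ ≡ + (2 ^ a) ℤ.* γ → ¬ Even β → ¬ Even γ →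
               ¬ + (2 * 2 ^ (a + b)) ∣ᶻ (p ℤ.+ 1ℤ) ℤ.* (q ℤ.- 1ℤ)
odd-cofactor {p} {q} {β} {γ} a b eβ eγ 2∤β 2∤γ h = odd-* β γ 2∤β 2∤γ
  (ℤ∣.*-cancelʳ-∣ (+ (2 ^ (a + b))) {+ 2} {β ℤ.* γ} {{ℤ.≢-nonZero {+ (2 ^ (a + b))} λ e →
      ≢-nonZero⁻¹ (2 ^ (a + b)) {{m^n≢0 2 (a + b)}} (ℤₚ.+-injective e)}}
    (subst₂ _∣ᶻ_ (ℤₚ.pos-* 2 (2 ^ (a + b))) (trans (cong₂ ℤ._*_ eβ eγ)
        (trans (lemma (+ (2 ^ a)) (+ (2 ^ b)) β γ) (cong (β ℤ.* γ ℤ.*_) (sym (pow-+ a b))))) h))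
  where
  lemma : ∀ A B β γ → B ℤ.* β ℤ.* (A ℤ.* γ) ≡ β ℤ.* γ ℤ.* (A ℤ.* B)
  lemma = solve-∀

-- The witness is 2^(a+b) with the common valuations a of p - 1, q - 1 and b of p + 1, q + 1. It
-- divides p² - 1, q² - 1 and p q - 1, hence G, and it is the exact power of 2 in the gap -(p + 1)(q
-- - 1).
odd-balanced : ∀ {p q E} → WF ((p , full 0) ∷ (q , full 0) ∷ E) → BalancedPrimes p q → AtMostTwo E →
               ¬ + (2 * G ((p , full 0) ∷ (q , full 0) ∷ E)) ∣ᶻ gap p (full 0) ((q , full 0) ∷ E)
odd-balanced {p} {q} {E} wf ((pp , p≢2) , (pq , q≢2) , _ , va , vb) two≥ h = go (twoAdic pp) (twoAdic pq)
  where
  L = (p , full 0) ∷ (q , full 0) ∷ E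
  2∤p = odd-prime pp p≢2
  gap≡ : gap p (full 0) ((q , full 0) ∷ E) ≡ -1ℤ ℤ.* ((+ p ℤ.+ 1ℤ) ℤ.* (+ q ℤ.- 1ℤ))
  gap≡ = trans (cong (λ t → oddGap p (full 0) ℤ.* ((+ q ℤ.- 1ℤ) ℤ.* t)) (AtMostTwo-total two≥))
    (trans (cong (oddGap p (full 0) ℤ.*_) (ℤₚ.*-identityʳ (+ q ℤ.- 1ℤ))) (ℤₚ.*-assoc -1ℤ (+ p ℤ.+ 1ℤ) (+ q ℤ.- 1ℤ)))
  lemma : ∀ x → -1ℤ ℤ.* (-1ℤ ℤ.* x) ≡ x
  lemma = solve-∀
  go : TwoAdic p → TwoAdic q → ⊥
  go P Q = odd-cofactor {+ p} {+ q} {P.β} {Q.α} a b P.suc-≡ eγ P.odd-β Q.odd-α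
    (∣-resp (trans (cong (-1ℤ ℤ.*_) gap≡) (lemma ((+ p ℤ.+ 1ℤ) ℤ.* (+ q ℤ.- 1ℤ)))) (ℤ∣.∣n⇒∣m*n -1ℤ (∣-double {2 ^ (a + b)} {G L} n∣G h)))
    where
    module P = TwoAdic P
    module Q = TwoAdic Q
    a = val 2 (p ∸ 1)
    b = val 2 (p + 1)
    eγ : + q ℤ.- 1ℤ ≡ + (2 ^ a) ℤ.* Q.α
    eγ = subst (λ a → + q ℤ.- 1ℤ ≡ + (2 ^ a) ℤ.* Q.α) (sym va) Q.pred-≡
    eε : + q ℤ.+ 1ℤ ≡ + (2 ^ b) ℤ.* Q.β
    eε = subst (λ b → + q ℤ.+ 1ℤ ≡ + (2 ^ b) ℤ.* Q.β) (sym vb) Q.suc-≡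
    pq-1 : + (2 ^ (a + b)) ∣ᶻ + p ℤ.* + q ℤ.- 1ℤ
    pq-1 = balanced-divisors {+ p} {+ q} {P.α} {P.β} {Q.α} {Q.β} a b P.pred-≡ P.suc-≡ eγ eε
      (even-pred 2∤p) (even-suc 2∤p) (2∤p ∘ ∣⇒∣ᵤ) P.odd-α P.odd-β Q.odd-α Q.odd-β
    lemma′ : ∀ p q → p ℤ.* q ℤ.- 1ℤ ≡ 1ℤ ℤ.* (p ℤ.* q) ℤ.- 1ℤ ℤ.* (ℤ.- (ℤ.- 1ℤ))
    lemma′ = solve-∀
    n∣G : 2 ^ (a + b) ∣ G L
    n∣G = Divides⇒∣G {2 ^ (a + b)} {L} wf (product⇒Divides {2 ^ (a + b)} {L} {1ℤ} {1ℤ} (full ∷ full ∷ AtMostTwo-thin two≥)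
      (square-divisor {+ p} {P.α} {P.β} a b P.pred-≡ P.suc-≡ ∷ square-divisor {+ q} {Q.α} {Q.β} a b eγ eε ∷ AtMostTwo-squares two≥)
      (∣-resp (trans (lemma′ (+ p) (+ q)) (cong₂ (λ d s → 1ℤ ℤ.* d ℤ.- 1ℤ ℤ.* (ℤ.- (ℤ.- s))) (sym (dOf-pair {p} {q} two≥)) (sym (AtMostTwo-sgn two≥)))) pq-1))

-- The gap is -(p + 1) and p + 1 itself divides G, so divisibility by 2 G fails by size.
odd-one-prime : ∀ {p E} → WF ((p , full 0) ∷ E) → AtMostTwo E → ¬ + (2 * G ((p , full 0) ∷ E)) ∣ᶻ gap p (full 0) E
odd-one-prime {p} {E} wf two≥ h = contradiction (∣.∣⇒≤ {{>-nonZero (m≤n+m 1 p)}}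
    (∣⇒∣ᵤ (∣-resp eq (ℤ∣.∣n⇒∣m*n -1ℤ (∣-double {p + 1} {G ((p , full 0) ∷ E)} n∣G h)))))
    (<⇒≱ (m<m+n (p + 1) (≤-trans (m≤n+m 1 p) (m≤m+n (p + 1) 0))))
  where
  n∣G : p + 1 ∣ G ((p , full 0) ∷ E)
  n∣G = Divides⇒∣G {p + 1} {(p , full 0) ∷ E} wf (suc-∣-G wf two≥ ℤ∣.∣-refl)
  lemma : ∀ p → -1ℤ ℤ.* (-1ℤ ℤ.* (p ℤ.+ 1ℤ) ℤ.* 1ℤ) ≡ p ℤ.+ 1ℤ
  lemma = solve-∀
  eq : -1ℤ ℤ.* gap p (full 0) E ≡ + (p + 1)
  eq = trans (cong (λ t → -1ℤ ℤ.* (oddGap p (full 0) ℤ.* t)) (AtMostTwo-total two≥)) (lemma (+ p))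

two-∣-double : ∀ {g x} → + (2 * g) ∣ᶻ x → Even x
two-∣-double {g} = ℤ∣.∣-trans (∣ᵤ⇒∣ {+ 2} {+ (2 * g)} (∣.m∣m*n g))

odd-power-full : ∀ {r′ g} → suc r′ % 2 ≡ 1 → ¬ + (2 * g) ∣ᶻ gap 2 (full r′) []
odd-power-full {r′} {g} e h with parity-cases (suc r′)
... | inj₂ (e′ , _) = contradiction (trans (sym e) e′) λ ()
... | inj₁ (_ , π) = from-no (2 ∣? 3) (∣⇒∣ᵤ (two-∣-double {g} (subst (λ x → + (2 * g) ∣ᶻ (ℤ.- x) ℤ.* + 3 ℤ.* 1ℤ) π h)))

odd-power-mid : ∀ {f′ k g} → suc f′ % 2 ≡ 0 → ¬ + (2 * g) ∣ᶻ gap 2 (mid f′ k) []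
odd-power-mid {f′} {k} {g} e h with parity-cases (suc f′)
... | inj₁ (e′ , _) = contradiction (trans (sym e) e′) λ ()
... | inj₂ (_ , π) = from-no (2 ∣? 3) (∣⇒∣ᵤ (two-∣-double {g} (subst (λ x → + (2 * g) ∣ᶻ (1ℤ ℤ.- x ℤ.* + 3) ℤ.* + 3 ℤ.* 1ℤ) π h)))

-- The gap is -6, while 2 ∣ G would make it divisible by 4.
odd-power-two : ∀ {k} → WF ((2 , mid 0 k) ∷ []) → ¬ + (2 * G ((2 , mid 0 k) ∷ [])) ∣ᶻ gap 2 (mid 0 k) []
odd-power-two {k} wf h = from-no (4 ∣? 6) (∣⇒∣ᵤ (∣-double {2} {G ((2 , mid 0 k) ∷ [])}
  (Divides⇒∣G {2} {(2 , mid 0 k) ∷ []} wf (Divides-cons {2} {2} {mid 0 k} {[]} mid ∣.∣-refl (∣-0 (+ 2)))) h))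

¬all-even : ∀ p s L → WF ((p , s) ∷ L) → Prime p → ¬ + (2 * G ((p , s) ∷ L)) ∣ᶻ gap p s L →
            ¬ AllPwEven (NOf ((p , s) ∷ L)) (C (NOf ((p , s) ∷ L)) (dOf ((p , s) ∷ L)))
¬all-even p s L wf pp odd all = odd (Pw-even⇒ {p} {s} {L} wf (all p pp))

exceptional⇒¬all-even : ∀ L → WF L → Exceptional L → ¬ AllPwEven (NOf L) (C (NOf L) (dOf L))
exceptional⇒¬all-even .((2 , full r′) ∷ []) wf (power-full {r′} e) =
  ¬all-even 2 (full r′) [] wf prime[2] (odd-power-full {r′} {G ((2 , full r′) ∷ [])} e)
exceptional⇒¬all-even .((2 , mid 0 k) ∷ []) wf (power-two {k}) =
  ¬all-even 2 (mid 0 k) [] wf prime[2] (odd-power-two {k} wf)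
exceptional⇒¬all-even .((2 , mid f′ k) ∷ []) wf (power-mid {f′} {k} e) =
  ¬all-even 2 (mid f′ k) [] wf prime[2] (odd-power-mid {f′} {k} {G ((2 , mid f′ k) ∷ [])} e)
exceptional⇒¬all-even .((p , full 0) ∷ (2 , mid 0 k) ∷ []) wf (two-prime {p} {k} e) =
  ¬all-even p (full 0) ((2 , mid 0 k) ∷ []) wf (All.head (proj₂ wf)) (odd-beside-special {p} {mid 0 k} wf mid e)
exceptional⇒¬all-even .((p , full 0) ∷ (2 , full 1) ∷ []) wf (four-prime {p} e) =
  ¬all-even p (full 0) ((2 , full 1) ∷ []) wf (All.head (proj₂ wf)) (odd-beside-special {p} {full 1} wf full e)
exceptional⇒¬all-even .((p , full 0) ∷ E) wf (odd-one {p} {E} op two≥) =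
  ¬all-even p (full 0) E wf (All.head (proj₂ wf)) (odd-one-prime {p} {E} wf two≥)
exceptional⇒¬all-even .((p , full 0) ∷ (q , full 0) ∷ E) wf (odd-two {p} {q} {E} b two≥) =
  ¬all-even p (full 0) ((q , full 0) ∷ E) wf (All.head (proj₂ wf)) (odd-balanced {p} {q} {E} wf b two≥)

-- Exceptional lists and the conditions on N and d.

Condition : ℕ → ℕ → Set
Condition N d = (d ≡ N × 𝔥-Cond N) ⊎ (d ≢ N × 𝔥₂-Cond N d)

d≢N-from-co : ∀ {p s L} → WF ((p , s) ∷ L) → coExp s ≢ 0 → dOf ((p , s) ∷ L) ≢ NOf ((p , s) ∷ L)
d≢N-from-co {p} {s} {L} wf@(_ , pL@(pp ∷ _)) co≢0 d≡N = prime≢1 pp (∣.∣1⇒≡1 (subst (p ∣_) co≡1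
  (∣.∣m⇒∣m*n (power coExp L) (p∣p^k p co≢0))))
  where
  co≡1 : power coExp ((p , s) ∷ L) ≡ 1
  co≡1 = *-cancelˡ-≡ (power coExp ((p , s) ∷ L)) 1 (dOf ((p , s) ∷ L)) {{power≢0 {(p , s) ∷ L} fExp pL}}
    (trans (sym (dOf*co ((p , s) ∷ L))) (trans (sym d≡N) (sym (*-identityʳ (dOf ((p , s) ∷ L))))))

d≢N-tail : ∀ {p s q t L} → WF ((p , s) ∷ (q , t) ∷ L) → coExp t ≢ 0 →
           dOf ((p , s) ∷ (q , t) ∷ L) ≢ NOf ((p , s) ∷ (q , t) ∷ L)
d≢N-tail {p} {s} {q} {t} {L} wf co≢0 e = d≢N-from-co {q} {t} {(p , s) ∷ L} (WF-↭ π wf) co≢0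
  (trans (sym (power-↭ fExp π)) (trans e (power-↭ rExp π)))
  where
  π : (p , s) ∷ (q , t) ∷ L ↭ (q , t) ∷ (p , s) ∷ L
  π = swap _ _ ↭-refl

p^1*1 : ∀ p → p ^ 1 * 1 ≡ p
p^1*1 p = trans (*-identityʳ (p ^ 1)) (*-identityʳ p)

private
  pairN : ∀ p A → p * 1 * (A * 1) ≡ A * p
  pairN = ℕR.solve-∀
  tripleN : ∀ p q A → p * 1 * (q * 1 * (A * 1)) ≡ A * (p * q)
  tripleN = ℕR.solve-∀
  pair : ∀ p q → p * 1 * (q * 1 * 1) ≡ p * q
  pair = ℕR.solve-∀

exceptional⇒condition : ∀ {L} → WF L → Exceptional L → Condition (NOf L) (dOf L)
exceptional⇒condition wf (power-full {r′} e) = inj₁ (refl , inj₂ (inj₁ (suc r′ , *-identityʳ (2 ^ suc r′) , e)))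
exceptional⇒condition wf (power-two {k}) = inj₂ (d≢N-from-co {2} {mid 0 k} {[]} wf (λ ()) ,
  inj₁ (suc (suc k) , *-identityʳ (2 ^ suc (suc k)) , s≤s (s≤s z≤n) , refl))
exceptional⇒condition wf (power-mid {f′} {k} e) = inj₂ (d≢N-from-co {2} {mid f′ k} {[]} wf (λ ()) ,
  inj₂ (inj₁ (suc f′ + suc k , *-identityʳ (2 ^ (suc f′ + suc k)) , s≤s (≤-trans (s≤s z≤n) (m≤n+m (suc k) f′)) ,
    suc f′ , *-identityʳ (2 ^ suc f′) , ∣.m%n≡0⇒n∣m (suc f′) 2 e)))
exceptional⇒condition wf@(_ , pp ∷ _) (two-prime {p} {k} e) = inj₂ (d≢N-tail {p} {full 0} {2} {mid 0 k} {[]} wf (λ ()) ,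
  inj₂ (inj₂ (inj₁ (suc (suc k) , p , pairN p (2 ^ suc (suc k)) , s≤s (s≤s z≤n) , pairN p 2 , pp , e))))
exceptional⇒condition wf@(_ , pp ∷ _) (four-prime {p} e) = inj₁ (refl , inj₂ (inj₂ (inj₂ (p , pairN p 4 , pp , e))))
exceptional⇒condition (_ , pp ∷ _) (odd-one {p} op none) = inj₁ (refl , inj₁ (subst Prime (sym (p^1*1 p)) pp))
exceptional⇒condition wf (odd-one {p} op (two {r′})) = inj₂ (d≢N-tail {p} {full 0} {2} {absent r′} {[]} wf (λ ()) ,
  inj₂ (inj₂ (inj₂ (inj₁ (suc r′ , trans (pairN p (2 ^ suc r′)) (cong (2 ^ suc r′ *_) (sym (p^1*1 p))) , s≤s z≤n ,
    subst OddPrime (sym (p^1*1 p)) op)))))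
exceptional⇒condition wf (odd-two {p} {q} b none) = inj₁ (refl , inj₂ (inj₂ (inj₁ (p , q , pair p q , b))))
exceptional⇒condition wf (odd-two {p} {q} b (two {r′})) = inj₂ (
  (λ e → d≢N-from-co {2} {absent r′} {(p , full 0) ∷ (q , full 0) ∷ []} (WF-↭ π wf) (λ ())
      (trans (sym (power-↭ fExp π)) (trans e (power-↭ rExp π)))) ,
  inj₂ (inj₂ (inj₂ (inj₂ (suc r′ , trans (tripleN p q (2 ^ suc r′)) (cong (2 ^ suc r′ *_) (sym (pair p q))) , s≤s z≤n , p , q ,
      pair p q , b)))))
  where
  π : (p , full 0) ∷ (q , full 0) ∷ (2 , absent r′) ∷ [] ↭ (2 , absent r′) ∷ (p , full 0) ∷ (q , full 0) ∷ []
  π = ↭-trans (prep _ (swap _ _ ↭-refl)) (swap _ _ ↭-refl)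

Realised : ℕ → ℕ → Set
Realised N d = ∃ λ L → WF L × Exceptional L × N ≡ NOf L × d ≡ dOf L

wf₁ : ∀ {p s} → Prime p → WF ((p , s) ∷ [])
wf₁ pp = ([] ∷ []) , (pp ∷ [])

wf₂ : ∀ {p s q t} → p ≢ q → Prime p → Prime q → WF ((p , s) ∷ (q , t) ∷ [])
wf₂ p≢q pp pq = ((p≢q ∷ []) ∷ [] ∷ []) , (pp ∷ pq ∷ [])

¬prime-2≡1%4 : ∀ {p} → p % 4 ≡ 1 → p ≢ 2
¬prime-2≡1%4 () refl

𝔥-Cond⇒ : ∀ {N} → 𝔥-Cond N → Realised N N
𝔥-Cond⇒ {N} (inj₁ pN) with N ≟ 2
-- `odd-one` is reserved for odd primes; the prime 2 is covered as the odd power 2^1.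
... | yes refl = (2 , full 0) ∷ [] , wf₁ pN , power-full refl , refl , refl
... | no  N≢2  = (N , full 0) ∷ [] , wf₁ pN , odd-one (pN , N≢2) none , sym (p^1*1 N) , sym (p^1*1 N)
𝔥-Cond⇒ (inj₂ (inj₁ (zero , _ , ())))
𝔥-Cond⇒ (inj₂ (inj₁ (suc r′ , refl , e))) = (2 , full r′) ∷ [] , wf₁ prime[2] , power-full e , sym (*-identityʳ (2 ^ suc r′)) ,
    sym (*-identityʳ (2 ^ suc r′))
𝔥-Cond⇒ (inj₂ (inj₂ (inj₁ (p , q , refl , b@((pp , _) , (pq , _) , p≢q , _))))) =
  (p , full 0) ∷ (q , full 0) ∷ [] , wf₂ p≢q pp pq , odd-two b none , sym (pair p q) , sym (pair p q)
𝔥-Cond⇒ (inj₂ (inj₂ (inj₂ (p , refl , pp , e)))) =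
  (p , full 0) ∷ (2 , full 1) ∷ [] , wf₂ (¬prime-2≡1%4 e) pp prime[2] , four-prime e , sym (pairN p 4) , sym (pairN p 4)

𝔥₂-Cond⇒ : ∀ {N d} → d ∣ N → d ≢ 1 → d ≢ N → 𝔥₂-Cond N d → Realised N d
𝔥₂-Cond⇒ _ _ _ (inj₁ (suc (suc k) , refl , s≤s (s≤s z≤n) , refl)) =
  (2 , mid 0 k) ∷ [] , wf₁ prime[2] , power-two , sym (*-identityʳ (2 ^ suc (suc k))) , refl
-- The exponent f = 0 is even but gives d = 1; below, f = r is discarded because it gives d = N.
𝔥₂-Cond⇒ d∣N d≢1 d≢N (inj₂ (inj₁ (r , refl , _ , zero , refl , _))) = contradiction refl d≢1
𝔥₂-Cond⇒ d∣N d≢1 d≢N (inj₂ (inj₁ (r , refl , _ , suc f′ , refl , 2∣f))) with m≤n⇒m<n∨m≡n f≤r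
  where
  f≤r : suc f′ ≤ r
  f≤r = pow-∣⇒≤ {2} {1} (suc f′) r prime[2] (λ h → contradiction (∣.∣1⇒≡1 h) λ ()) (subst (2 ^ suc f′ ∣_) (sym (*-identityʳ (2 ^ r))) d∣N)
... | inj₂ refl = contradiction refl d≢N
... | inj₁ f<r  = (2 , mid f′ k) ∷ [] , wf₁ prime[2] , power-mid (∣.n∣m⇒m%n≡0 (suc f′) 2 2∣f) ,
    trans (cong (2 ^_) (sym r≡)) (sym (*-identityʳ (2 ^ (suc f′ + suc k)))) , sym (*-identityʳ (2 ^ suc f′))
  where
  k = r ∸ suc (suc f′)
  r≡ : suc f′ + suc k ≡ r
  r≡ = trans (+-suc (suc f′) k) (m+[n∸m]≡n f<r)
𝔥₂-Cond⇒ _ _ _ (inj₂ (inj₂ (inj₁ (suc (suc k) , p , refl , s≤s (s≤s z≤n) , refl , pp , e)))) =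
  (p , full 0) ∷ (2 , mid 0 k) ∷ [] , wf₂ (¬prime-2≡1%4 e) pp prime[2] , two-prime e ,
  sym (pairN p (2 ^ suc (suc k))) , sym (pairN p 2)
𝔥₂-Cond⇒ {d = d} _ _ _ (inj₂ (inj₂ (inj₂ (inj₁ (suc r′ , refl , s≤s z≤n , op@(pd , d≢2)))))) =
  (d , full 0) ∷ (2 , absent r′) ∷ [] , wf₂ d≢2 pd prime[2] , odd-one op two , sym (pairN d (2 ^ suc r′)) , sym (p^1*1 d)
𝔥₂-Cond⇒ _ _ _ (inj₂ (inj₂ (inj₂ (inj₂ (suc r′ , refl , s≤s z≤n , p , q , refl , b@((pp , p≢2) , (pq , q≢2) , p≢q , _)))))) =
  (p , full 0) ∷ (q , full 0) ∷ (2 , absent r′) ∷ [] ,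
  (((p≢q ∷ p≢2 ∷ []) ∷ (q≢2 ∷ []) ∷ [] ∷ []) , (pp ∷ pq ∷ prime[2] ∷ [])) ,
  odd-two b two , sym (tripleN p q (2 ^ suc r′)) , sym (pair p q)

condition⇒ : ∀ {N d} → d ∣ N → d ≢ 1 → Condition N d → Realised N d
condition⇒ d∣N d≢1 (inj₁ (refl , h))  = 𝔥-Cond⇒ h
condition⇒ d∣N d≢1 (inj₂ (d≢N , h)) = 𝔥₂-Cond⇒ d∣N d≢1 d≢N h

𝔥-agree : ∀ N d → (Condition N d → ¬ AllPwEven N (C N d)) → (¬ Condition N d → AllPwEven N (C N d)) →
          𝔥-div N (C N d) ≡ 𝔥₂ N d
𝔥-agree N d to from = go (d ≟ N) (𝔥-cond? N) (𝔥₂-cond? N d)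
  where
  odd : Condition N d → 𝔥-div N (C N d) ≡ 2
  odd h = if-no (allPwEven? N (C N d)) (to h)
  even : ¬ Condition N d → 𝔥-div N (C N d) ≡ 1
  even h = if-yes (allPwEven? N (C N d)) (from h)
  ¬condition : (d ≡ N → ¬ 𝔥-Cond N) → (d ≢ N → ¬ 𝔥₂-Cond N d) → ¬ Condition N d
  ¬condition a b (inj₁ (e , h)) = a e h
  ¬condition a b (inj₂ (e , h)) = b e h
  go : Dec (d ≡ N) → Dec (𝔥-Cond N) → Dec (𝔥₂-Cond N d) → 𝔥-div N (C N d) ≡ 𝔥₂ N d
  go (yes e) (yes h) _ = trans (odd (inj₁ (e , h))) (sym (trans (if-yes (d ≟ N) e) (if-yes (𝔥-cond? N) h)))
  go (yes e) (no ¬h) _ = trans (even (¬condition (λ _ → ¬h) (λ ¬e → contradiction e ¬e)))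
      (sym (trans (if-yes (d ≟ N) e) (if-no (𝔥-cond? N) ¬h)))
  go (no ¬e) _ (yes h) = trans (odd (inj₂ (¬e , h))) (sym (trans (if-no (d ≟ N) ¬e) (if-yes (𝔥₂-cond? N d) h)))
  go (no ¬e) _ (no ¬h) = trans (even (¬condition (λ e → contradiction e ¬e) (λ _ → ¬h)))
      (sym (trans (if-no (d ≟ N) ¬e) (if-no (𝔥₂-cond? N d) ¬h)))

𝔥-theorem : ∀ L → WF L → dOf L ≢ 1 → 𝔥-div (NOf L) (C (NOf L) (dOf L)) ≡ 𝔥₂ (NOf L) (dOf L)
𝔥-theorem L wf d≢1 = 𝔥-agree (NOf L) (dOf L) to from
  where
  d∣N : dOf L ∣ NOf L
  d∣N = subst (dOf L ∣_) (sym (dOf*co L)) (∣.m∣m*n (power coExp L))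
  to : Condition (NOf L) (dOf L) → ¬ AllPwEven (NOf L) (C (NOf L) (dOf L))
  to h with condition⇒ d∣N d≢1 h
  ... | L′ , wf′ , exc , N≡ , d≡ = transfer (λ N d → ¬ AllPwEven N (C N d)) (NOf L) (NOf L′) (dOf L) (dOf L′) N≡ d≡ (exceptional⇒¬all-even L′ wf′ exc)
  from : ¬ Condition (NOf L) (dOf L) → AllPwEven (NOf L) (C (NOf L) (dOf L))
  from ¬h = all-even L wf d≢1 λ (L′ , π , exc) → ¬h (subst₂ Condition (sym (power-↭ rExp π)) (sym (power-↭ fExp π))
    (exceptional⇒condition (WF-↭ π wf) exc))

theorem3p22 : ∀ (N : ℕ) .{{_ : NonZero N}} (d : ℕ) → d ∣ N → d ≢ 1 →
    GCD N (C N d) ≡ 𝔤₂ N d × 𝔥-div N (C N d) ≡ 𝔥₂ N d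
theorem3p22 N d d∣N d≢1 = go (local-data N d d∣N) d≢1
  where
  go : ∀ {N d} → (∃ λ L → WF L × N ≡ NOf L × d ≡ dOf L) → d ≢ 1 →
       GCD N (C N d) ≡ 𝔤₂ N d × 𝔥-div N (C N d) ≡ 𝔥₂ N d
  go (L , wf , refl , refl) d≢1 = GCD-theorem L wf , 𝔥-theorem L wf d≢1
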